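{- For all integers $r\ge 2$ and $k\ge r-1$ there is an integer $n_0=n_0(k,r)$ such that for all $n>n_0$, $$f(n,k,r)=g(n,k,r).$$ Furthermore, for all $n>n_0$, if $\mathcal H$ is an $r$-uniform hypergraph with $n$ vertices and $f(n,k,r)$ edges in which every $k$-set of vertices is covered, then $\mathcal H$ is isomorphic to some element of $\mathcal G(n,k,r)$.
   Context: Notation: $[n]=\{1,\dots,n\}$; $X^{(j)}$ is the set of all $j$-element subsets of $X$; an $r$-uniform hypergraph on a vertex set $X$ is a set $\mathcal H\subseteq X^{(r)}$ of edges, and $|\mathcal H|$ is its number of edges. Covering: let $\mathcal H$ be an $r$-uniform hypergraph with vertex set $X$. A set $A\subset X$ is covered in $\mathcal H$ if there is a vertex $u\in X\setminus A$ such that $B\cup\{u\}\in\mathcal H$ for every $B\in A^{(r-1)}$. $f(n,k,r)$ is the minimum number of edges in an $r$-uniform hypergraph with vertex set $[n]$ such that every $k$-set in $[n]$ is covered. $D(n,r)$ is the minimum number of edges in an $r$-uniform hypergraph with vertex set $[n]$ such that every $(r-1)$-subset of $[n]$ is contained in some edge. For $n>k\ge r-1$, $\mathcal G(n,k,r)$ is the family of all $r$-uniform hypergraphs on vertex set $[n]$ whose edges are: (i) all $r$-subsets of $[n]$ that meet $\{1,\dots,k-r+1\}$ (no such edges if $k=r-1$); and (ii) a collection of exactly $D(n-k+r-1,r)$ $r$-subsets of $\{k-r+2,\dots,n\}$ such that every $(r-1)$-subset of $\{k-r+2,\dots,n\}$ is contained in at least one of them. $g(n,k,r)$ is the common number of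 edges of the elements of $\mathcal G(n,k,r)$, that is, $$g(n,k,r)=\binom{n}{r}-\binom{n-k+r-1}{r}+D(n-k+r-1,r).$$ -}

module Defs where

open import Data.Bool.Properties using () renaming (_≟_ to _≟ᴮ_)
open import Data.Empty using (⊥-elim)
open import Data.Fin using (Fin; zero; suc; toℕ)
open import Data.Fin.Permutation using (Permutation′; _⟨$⟩ˡ_)
open import Data.Fin.Properties using (any?)
open import Data.Fin.Subset
  using (Subset; inside; outside; _∈_; _∉_; _⊆_; _∪_; ⁅_⁆; ∣_∣)
open import Data.Fin.Subset.Properties
  using (_∈?_; _⊆?_; anySubset?; p⊆p∪q; ∪-identityʳ)
open import Data.List using (List; []; _∷_; [_]; _++_; map; filter; length)
open import Data.List.Extrema.Nat using (min; min≤v⁺; argmin-sel)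
open import Data.List.Membership.Propositional using () renaming (_∈_ to _∈ᴸ_)
open import Data.List.Membership.Propositional.Properties
  using (∈-map⁺; ∈-map⁻; ∈-++⁺ˡ; ∈-++⁺ʳ; ∈-++⁻; ∈-filter⁺; ∈-filter⁻; ∈-∃++)
open import Data.List.Properties using (length-++)
open import Data.List.Relation.Binary.Disjoint.Propositional using (Disjoint)
open import Data.List.Relation.Binary.Sublist.Propositional
  using ([]; _∷_; _∷ʳ_) renaming (_⊆_ to _⊑_)
open import Data.List.Relation.Binary.Sublist.Propositional.Properties
  using (All-resp-⊆; filter-⊆)
open import Data.List.Relation.Unary.All as All using (All; []; _∷_)
open import Data.List.Relation.Unary.All.Properties using (all-filter)
open import Data.List.Relation.Unary.Any as Any using (here; there)
open import Data.List.Relation.Unary.AllPairs using ([]; _∷_)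
open import Data.List.Relation.Unary.Unique.Propositional using (Unique)
import Data.List.Relation.Unary.Unique.Propositional.Properties as Uniqueₚ
open import Data.Nat
  using (ℕ; zero; suc; _+_; _∸_; _≤_; _<_; z≤n; s≤s; _≟_)
open import Data.Nat.Combinatorics using (_C_)
open import Data.Nat.Properties
  using (≤-refl; ≤-trans; ≤-reflexive; +-suc)
open import Data.Product using (∃; _×_; _,_; proj₁; proj₂)
open import Data.Sum using (_⊎_; inj₁; inj₂)
open import Data.Vec using ([]; _∷_; lookup; tabulate; here; there)
open import Data.Vec.Properties using (≡-dec; ∷-injectiveʳ)
open import Function using (_⇔_; _∘_; Equivalence; mk⇔)
open import Relation.Binary.PropositionalEquality
  using (_≡_; refl; sym; trans; cong)
open import Relation.Nullary using (Dec)
open import Relation.Nullary.Decidable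
  using (¬?; _×-dec_; _→-dec_; map′; decidable-stable)
open import Relation.Unary using (Decidable)

private variable
  n r : ℕ

record Hypergraph (n r : ℕ) : Set where
  field
    edges   : List (Subset n)
    uniform : All (λ e → ∣ e ∣ ≡ r) edges
    unique  : Unique edges

open Hypergraph public

infix 4 _∈ᴱ_

_∈ᴱ_ : Subset n → Hypergraph n r → Set
e ∈ᴱ H = e ∈ᴸ edges H

size : Hypergraph n r → ℕ
size H = length (edges H)

Covered : Hypergraph n r → Subset n → Set
Covered {n} {r} H A = ∃ λ (u : Fin n) → u ∉ A ×
  (∀ B → B ⊆ A → ∣ B ∣ ≡ r ∸ 1 → (B ∪ ⁅ u ⁆) ∈ᴱ H)

AllCovered : ℕ → Hypergraph n r → Set
AllCovered k H = ∀ A → ∣ A ∣ ≡ k → Covered H A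

AllContained : Hypergraph n r → Set
AllContained {n} {r} H =
  ∀ A → ∣ A ∣ ≡ r ∸ 1 → ∃ λ e → e ∈ᴱ H × A ⊆ e

allSubset? : ∀ {P : Subset n → Set} → Decidable P → Dec (∀ A → P A)
allSubset? P? = map′
  (λ ¬∃ A → decidable-stable (P? A) (λ ¬p → ¬∃ (A , ¬p)))
  (λ ∀p (A , ¬p) → ¬p (∀p A))
  (¬? (anySubset? (¬? ∘ P?)))

_∈ᴱ?_ : ∀ (e : Subset n) (H : Hypergraph n r) → Dec (e ∈ᴱ H)
e ∈ᴱ? H = Any.any? (≡-dec _≟ᴮ_ e) (edges H)

covered? : ∀ (H : Hypergraph n r) → Decidable (Covered H)
covered? {r = r} H A = any? λ u → ¬? (u ∈? A) ×-dec
  allSubset? λ B → (B ⊆? A) →-dec ((∣ B ∣ ≟ r ∸ 1) →-dec ((B ∪ ⁅ u ⁆) ∈ᴱ? H))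

allCovered? : ∀ k → Decidable (AllCovered {n} {r} k)
allCovered? k H = allSubset? λ A → (∣ A ∣ ≟ k) →-dec covered? H A

allContained? : Decidable (AllContained {n} {r})
allContained? {r = r} H = allSubset? λ A → (∣ A ∣ ≟ r ∸ 1) →-dec
  anySubset? λ e → (e ∈ᴱ? H) ×-dec (A ⊆? e)

allSubsets : ∀ n → List (Subset n)
allSubsets zero    = [ [] ]
allSubsets (suc n) =
  map (inside ∷_) (allSubsets n) ++ map (outside ∷_) (allSubsets n)

allSubsets-complete : ∀ (A : Subset n) → A ∈ᴸ allSubsets n
allSubsets-complete []            = here refl
allSubsets-complete (inside  ∷ A) = ∈-++⁺ˡ (∈-map⁺ _ (allSubsets-complete A))
allSubsets-complete (outside ∷ A) =
  ∈-++⁺ʳ (map (inside ∷_) (allSubsets _)) (∈-map⁺ _ (allSubsets-complete A))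

allSubsets-unique : ∀ n → Unique (allSubsets n)
allSubsets-unique zero    = [] ∷ []
allSubsets-unique (suc n) = Uniqueₚ.++⁺
  (Uniqueₚ.map⁺ ∷-injectiveʳ (allSubsets-unique n))
  (Uniqueₚ.map⁺ ∷-injectiveʳ (allSubsets-unique n))
  disjoint
  where
  disjoint : Disjoint (map (inside ∷_) (allSubsets n))
                      (map (outside ∷_) (allSubsets n))
  disjoint (p , q) with ∈-map⁻ (inside ∷_) p | ∈-map⁻ (outside ∷_) q
  ... | _ , _ , refl | _ , _ , ()

sublists : ∀ {A : Set} (xs : List A) → List (∃ λ ys → ys ⊑ xs)
sublists []       = [ [] , [] ]
sublists (x ∷ xs) =
  map (λ (ys , τ) → x ∷ ys , refl ∷ τ) (sublists xs) ++
  map (λ (ys , τ) → ys , x ∷ʳ τ) (sublists xs)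

sublists-complete : ∀ {A : Set} {xs ys : List A} (τ : ys ⊑ xs) →
                    (ys , τ) ∈ᴸ sublists xs
sublists-complete []         = here refl
sublists-complete (x ∷ʳ τ)   = ∈-++⁺ʳ (map _ (sublists _))
                                 (∈-map⁺ _ (sublists-complete τ))
sublists-complete (refl ∷ τ) = ∈-++⁺ˡ (∈-map⁺ _ (sublists-complete τ))

Unique-resp-⊑ : ∀ {A : Set} {xs ys : List A} → ys ⊑ xs → Unique xs → Unique ys
Unique-resp-⊑ []         []       = []
Unique-resp-⊑ (_ ∷ʳ τ)   (_ ∷ u)  = Unique-resp-⊑ τ u
Unique-resp-⊑ (refl ∷ τ) (px ∷ u) = All-resp-⊆ τ px ∷ Unique-resp-⊑ τ u

complete : ∀ n r → Hypergraph n r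
complete n r = record
  { edges   = filter (λ e → ∣ e ∣ ≟ r) (allSubsets n)
  ; uniform = all-filter (λ e → ∣ e ∣ ≟ r) (allSubsets n)
  ; unique  = Uniqueₚ.filter⁺ (λ e → ∣ e ∣ ≟ r) (allSubsets-unique n)
  }

subHypergraph : ∀ (H : Hypergraph n r) → (∃ λ es → es ⊑ edges H) → Hypergraph n r
subHypergraph H (es , τ) = record
  { edges   = es
  ; uniform = All-resp-⊆ τ (uniform H)
  ; unique  = Unique-resp-⊑ τ (unique H)
  }

hypergraphs : ∀ n r → List (Hypergraph n r)
hypergraphs n r = map (subHypergraph (complete n r)) (sublists (edges (complete n r)))

-- The value 0 on [] is never used: see f-isMinimum and D-isMinimum below.
minimum : List ℕ → ℕ
minimum []       = 0
minimum (x ∷ xs) = min x xs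

f : ℕ → ℕ → ℕ → ℕ
f n k r = minimum (map size (filter (allCovered? k) (hypergraphs n r)))

D : ℕ → ℕ → ℕ
D n r = minimum (map size (filter allContained? (hypergraphs n r)))

g : ℕ → ℕ → ℕ → ℕ
g n k r = ((n C r) ∸ (m C r)) + D m r
  where
  m : ℕ
  m = (n ∸ k) + (r ∸ 1)

-- The vertex i of {1,…,n} is the x : Fin n with toℕ x ≡ i ∸ 1, so the set
-- {1,…,k-r+1} consists of the x with toℕ x < suc k ∸ r.

MeetsHead : ℕ → ℕ → Subset n → Set
MeetsHead k r e = ∃ λ x → x ∈ e × toℕ x < suc k ∸ r

InTail : ℕ → ℕ → Subset n → Set
InTail k r e = ∀ x → x ∈ e → suc k ∸ r ≤ toℕ x

record TailCollection (n k r : ℕ) (T : Hypergraph n r) : Set where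
  field
    inTail  : ∀ e → e ∈ᴱ T → InTail k r e
    covers  : ∀ A → InTail k r A → ∣ A ∣ ≡ r ∸ 1 → ∃ λ e → e ∈ᴱ T × A ⊆ e
    minimal : size T ≡ D ((n ∸ k) + (r ∸ 1)) r

𝒢 : ∀ n k r → Hypergraph n r → Set
𝒢 n k r G = ∃ λ T → TailCollection n k r T ×
  (∀ e → e ∈ᴱ G ⇔ ((∣ e ∣ ≡ r × MeetsHead k r e) ⊎ e ∈ᴱ T))

image : Permutation′ n → Subset n → Subset n
image π e = tabulate (λ i → lookup e (π ⟨$⟩ˡ i))

infix 4 _≅_

_≅_ : Hypergraph n r → Hypergraph n r → Set
_≅_ {n} H G = ∃ λ (π : Permutation′ n) → ∀ e → e ∈ᴱ H ⇔ image π e ∈ᴱ G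

record IsMinimum (P : Hypergraph n r → Set) (m : ℕ) : Set where
  field
    attained : ∃ λ H → P H × size H ≡ m
    least    : ∀ H → P H → m ≤ size H

∈-complete : ∀ {e : Subset n} → ∣ e ∣ ≡ r → e ∈ᴱ complete n r
∈-complete {r = r} p = ∈-filter⁺ (λ e → ∣ e ∣ ≟ r) (allSubsets-complete _) p

length-mono : ∀ {A : Set} {xs ys : List A} → Unique xs →
              (∀ {x} → x ∈ᴸ xs → x ∈ᴸ ys) → length xs ≤ length ys
length-mono {xs = []} _ _ = z≤n
length-mono {xs = x ∷ xs} (x∉ ∷ u) sub with ∈-∃++ (sub (here refl))
... | ys₁ , ys₂ , refl = ≤-trans (s≤s (length-mono u sub′)) (≤-reflexive eq)
  where
  sub′ : ∀ {y} → y ∈ᴸ xs → y ∈ᴸ ys₁ ++ ys₂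
  sub′ y∈ with ∈-++⁻ ys₁ (sub (there y∈))
  ... | inj₁ p          = ∈-++⁺ˡ p
  ... | inj₂ (here y≡x) = ⊥-elim (All.lookup x∉ y∈ (sym y≡x))
  ... | inj₂ (there p)  = ∈-++⁺ʳ ys₁ p
  eq : suc (length (ys₁ ++ ys₂)) ≡ length (ys₁ ++ x ∷ ys₂)
  eq = trans (cong suc (length-++ ys₁))
         (trans (sym (+-suc (length ys₁) (length ys₂))) (sym (length-++ ys₁)))

hypergraphs-complete : ∀ (H : Hypergraph n r) → ∃ λ H′ →
  H′ ∈ᴸ hypergraphs n r × (∀ e → e ∈ᴱ H ⇔ e ∈ᴱ H′) × size H′ ≤ size H
hypergraphs-complete {n} {r} H =
  H′ , ∈-map⁺ _ (sublists-complete τ) , (λ e → mk⇔ to (from {e})) ,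
  length-mono (unique H′) from
  where
  τ  = filter-⊆ (_∈ᴱ? H) (edges (complete n r))
  H′ = subHypergraph (complete n r) (_ , τ)
  to : ∀ {e} → e ∈ᴱ H → e ∈ᴱ H′
  to e∈ = ∈-filter⁺ (_∈ᴱ? H) (∈-complete (All.lookup (uniform H) e∈)) e∈
  from : ∀ {e} → e ∈ᴱ H′ → e ∈ᴱ H
  from e∈ = proj₂ (∈-filter⁻ (_∈ᴱ? H) {xs = edges (complete n r)} e∈)

minimum≤ : ∀ {x xs} → x ∈ᴸ xs → minimum xs ≤ x
minimum≤ {xs = y ∷ ys} (here refl) = min≤v⁺ y ys (inj₁ ≤-refl)
minimum≤ {xs = y ∷ ys} (there p)   =
  min≤v⁺ y ys (inj₂ (Any.map (λ where refl → ≤-refl) p))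

minimum∈ : ∀ {x xs} → x ∈ᴸ xs → minimum xs ∈ᴸ xs
minimum∈ {xs = y ∷ ys} _ with argmin-sel (λ x → x) y ys
... | inj₁ eq = here eq
... | inj₂ p  = there p

minimum-isMinimum :
  ∀ {P : Hypergraph n r → Set} (P? : Decidable P) →
  (∀ {H H′} → (∀ e → e ∈ᴱ H ⇔ e ∈ᴱ H′) → P H → P H′) →
  ∃ P → IsMinimum P (minimum (map size (filter P? (hypergraphs n r))))
minimum-isMinimum {n} {r} {P} P? resp (H₀ , pH₀) = record
  { attained = attained
  ; least    = λ H pH → let (H′ , _ , H′≤H , H′∈) = canonical H pH in
                        ≤-trans (minimum≤ H′∈) H′≤H
  }
  where
  sizes : List ℕ
  sizes = map size (filter P? (hypergraphs n r))
  canonical : ∀ H → P H → ∃ λ H′ → P H′ × size H′ ≤ size H × size H′ ∈ᴸ sizes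
  canonical H pH =
    let (H′ , H′∈ , same , H′≤H) = hypergraphs-complete H
        pH′ = resp {H} {H′} same pH
    in H′ , pH′ , H′≤H , ∈-map⁺ size (∈-filter⁺ P? H′∈ pH′)
  attained : ∃ λ H → P H × size H ≡ minimum sizes
  attained with ∈-map⁻ size (minimum∈ (proj₂ (proj₂ (proj₂ (canonical H₀ pH₀)))))
  ... | H , H∈ , eq = H , proj₂ (∈-filter⁻ P? {xs = hypergraphs n r} H∈) , sym eq

∃∉ : ∀ (A : Subset n) → ∣ A ∣ < n → ∃ λ u → u ∉ A
∃∉ (outside ∷ A) _         = zero , λ ()
∃∉ (inside  ∷ A) (s≤s A<n) with ∃∉ A A<n
... | u , u∉A = suc u , λ where (there u∈A) → u∉A u∈A

∣A∪⁅u⁆∣ : ∀ (A : Subset n) u → u ∉ A → ∣ A ∪ ⁅ u ⁆ ∣ ≡ suc ∣ A ∣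
∣A∪⁅u⁆∣ (inside  ∷ A) zero    u∉A = ⊥-elim (u∉A here)
∣A∪⁅u⁆∣ (outside ∷ A) zero    u∉A = cong (suc ∘ ∣_∣) (∪-identityʳ A)
∣A∪⁅u⁆∣ (inside  ∷ A) (suc u) u∉A = cong suc (∣A∪⁅u⁆∣ A u (u∉A ∘ there))
∣A∪⁅u⁆∣ (outside ∷ A) (suc u) u∉A = ∣A∪⁅u⁆∣ A u (u∉A ∘ there)

f-isMinimum : ∀ {n k r} → 1 ≤ r → k < n → IsMinimum {n} {r} (AllCovered k) (f n k r)
f-isMinimum {n} {k} {suc r} _ k<n =
  minimum-isMinimum (allCovered? k) (λ {H H′} → resp {H} {H′}) (complete n (suc r) , cover)
  where
  resp : ∀ {H H′ : Hypergraph n (suc r)} → (∀ e → e ∈ᴱ H ⇔ e ∈ᴱ H′) →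
         AllCovered k H → AllCovered k H′
  resp same cov A ∣A∣≡k with cov A ∣A∣≡k
  ... | u , u∉A , h = u , u∉A , λ B B⊆A ∣B∣ → Equivalence.to (same _) (h B B⊆A ∣B∣)
  cover : AllCovered k (complete n (suc r))
  cover A refl with ∃∉ A k<n
  ... | u , u∉A = u , u∉A , λ B B⊆A ∣B∣≡r →
    ∈-complete (trans (∣A∪⁅u⁆∣ B u (u∉A ∘ B⊆A)) (cong suc ∣B∣≡r))

D-isMinimum : ∀ {n r} → 1 ≤ r → r ≤ n → IsMinimum {n} {r} AllContained (D n r)
D-isMinimum {n} {suc r} _ r<n =
  minimum-isMinimum allContained? (λ {H H′} → resp {H} {H′}) (complete n (suc r) , contain)
  where
  resp : ∀ {H H′ : Hypergraph n (suc r)} → (∀ e → e ∈ᴱ H ⇔ e ∈ᴱ H′) →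
         AllContained H → AllContained H′
  resp same con A ∣A∣≡r with con A ∣A∣≡r
  ... | e , e∈H , A⊆e = e , Equivalence.to (same e) e∈H , A⊆e
  contain : AllContained (complete n (suc r))
  contain A refl with ∃∉ A r<n
  ... | u , u∉A = A ∪ ⁅ u ⁆ , ∈-complete (∣A∪⁅u⁆∣ A u u∉A) , p⊆p∪q ⁅ u ⁆

{-# OPTIONS --safe #-}
module Submission where

-- Put s = k - r + 1 and let H cover all k-sets with at most g(n,k,r) edges.  A weak Kruskal–Katona
-- theorem shows that only few r-sets have all their (r-1)-subsets in the link of a single light
-- vertex, one of degree at most a small multiple of n^(r-1); there are boundedly many heavy ones.
-- If an (r-1)-set B has fewer than s heavy neighbours, these together with B and any further
-- vertex y form a set of size at most k, so B ∪ {y} is joined to a light vertex: such B are rare.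
-- Comparing |H| with D shows that having more than s heavy neighbours is rare too.  If two
-- (r-1)-sets sharing r-2 vertices have different sets of s heavy neighbours, their union and the
-- common heavy neighbours are at most k vertices, so the union is again joined to a light vertex.
-- Hence almost all (r-1)-sets have the same set S of heavy neighbours; relabel so that S comes first.
--
-- Let T consist of the edges avoiding S.  If an r-set e meeting S is missing from H, then every
-- r-set R ⊇ e ∖ S avoiding S is joined within T to some u ∉ R.  Let 𝓑 be the family of (r-1)-sets
-- obtained by enlarging the sets e ∖ S; it is small, and there are at most c |𝓑| missing edges.
-- For Z in the shadow of 𝓑 fix b with Z ∪ {b} ∈ 𝓑.  For each x, if u is joined to Z ∪ {b, x}, the
-- edge R = Z ∪ {x, u} of T is needed for Z ∪ {x} only: its other (r-1)-subsets lie in the edges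
-- (R ∖ {y}) ∪ {b}.  Delete a conflict-free proportion of these edges and cover the sets Z ∪ {x} two
-- at a time by Z ∪ {x, x′}.  This saves of the order of m |shadow| edges, which exceeds c |𝓑| by
-- weak Kruskal–Katona.  So |T| > D + |missing|, which contradicts the bound on |H| unless every
-- r-set meeting S is an edge; then |H| ≥ g, with equality only for members of 𝒢.

open import Defs
open import Data.Bool.Properties using () renaming (_≟_ to _≟ᴮ_)
open import Data.Empty using (⊥-elim) renaming (⊥ to ⊥ᵗ)
open import Data.Fin using (Fin; zero; suc; toℕ; fromℕ<; punchOut; _↑ʳ_)
open import Data.Fin.Permutation
  using (Permutation′; _⟨$⟩ʳ_; _⟨$⟩ˡ_; inverseˡ; inverseʳ; flip; id; lift₀; insert)
open import Data.Fin.Properties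
  using (any?; all?; toℕ-fromℕ<) renaming (_≟_ to _≟ᶠ_; suc-injective to sucᶠ-injective)
open import Data.Fin.Subset
open import Data.Fin.Subset.Properties
open import Data.List
  using (List; []; _∷_; [_]; _++_; map; filter; length; concatMap; cartesianProduct;
    cartesianProductWith; allFin; upTo)
open import Data.List.Membership.Propositional
  using (lose; find) renaming (_∈_ to _∈ᴸ_; _∉_ to _∉ᴸ_)
open import Data.List.Membership.Propositional.Properties
  using (∈-map⁺; ∈-map⁻; ∈-++⁺ˡ; ∈-++⁺ʳ; ∈-++⁻; ∈-filter⁺; ∈-filter⁻; ∈-concatMap⁺; ∈-concatMap⁻;
    ∈-allFin; ∈-cartesianProduct⁻; ∈-upTo⁺; ∈-upTo⁻)
open import Data.List.Properties
  using (length-++; length-map; length-filter; filter-accept; filter-reject; filter-++;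
    length-tabulate; length-upTo)
open import Data.List.Relation.Unary.All as All using (All; []; _∷_)
open import Data.List.Relation.Unary.Any as Any using (here; there)
open import Data.List.Relation.Unary.AllPairs using ([]; _∷_)
open import Data.List.Relation.Unary.Unique.Propositional using (Unique)
import Data.List.Relation.Unary.Unique.Propositional.Properties as Uniqueₚ
open import Data.Maybe using (Maybe; just; nothing)
open import Data.Maybe.Properties using () renaming (≡-dec to ≡-decᴹ)
open import Data.Nat
  using (ℕ; zero; suc; _+_; _*_; _∸_; _^_; _≤_; _<_; z≤n; s≤s; _≤?_; _≟_; NonZero; >-nonZero;
    >-nonZero⁻¹)
open import Data.Nat.Combinatorics using (_C_; nCk≡nC[n∸k]; nCn≡1; nCk+nC[k+1]≡[n+1]C[k+1])
open import Data.Nat.ListAction using (sum)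
open import Data.Nat.Properties hiding (_≟_)
open import Data.Nat.Tactic.RingSolver using (solve-∀)
open import Data.Product using (∃; _×_; _,_; proj₁; proj₂)
open import Data.Sum using (_⊎_; inj₁; inj₂)
open import Data.Vec using (Vec; []; _∷_; lookup; removeAt; here; there)
open import Data.Vec.Properties
  using (∷-injective; lookup∘tabulate; lookup⇒[]=; []=⇒lookup) renaming (≡-dec to ≡-decᵛ)
open import Function using (_∘_; case_of_; mk⇔; _⇔_)
open import Relation.Binary.Definitions using (DecidableEquality)
open import Relation.Binary.PropositionalEquality hiding ([_])
open import Relation.Nullary using (Dec; yes; no; ¬_)
open import Relation.Nullary.Decidable using (¬?; _×-dec_; _⊎-dec_; _→-dec_)
open import Relation.Unary using (Decidable)

-- Sums over lists, counting, averaging and enumeration of tuples.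

module Counting where

  private variable
    X Y : Set
    n i j : ℕ

  opaque
    ∑ : List X → (X → ℕ) → ℕ
    ∑ xs f = sum (map f xs)

  syntax ∑ xs (λ x → e) = ∑[ x ∈ xs ] e

  opaque
    unfolding ∑

    ∑-++ : ∀ (xs ys : List X) f → ∑ (xs ++ ys) f ≡ ∑ xs f + ∑ ys f
    ∑-++ []       ys f = refl
    ∑-++ (x ∷ xs) ys f = trans (cong (f x +_) (∑-++ xs ys f)) (sym (+-assoc (f x) _ _))

    ∑-map : ∀ (h : X → Y) xs f → ∑ (map h xs) f ≡ ∑ xs (f ∘ h)
    ∑-map h []       f = refl
    ∑-map h (x ∷ xs) f = cong (f (h x) +_) (∑-map h xs f)

    ∑-concatMap : ∀ (h : X → List Y) xs f → ∑ (concatMap h xs) f ≡ ∑[ x ∈ xs ] ∑ (h x) f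
    ∑-concatMap h []       f = refl
    ∑-concatMap h (x ∷ xs) f =
      trans (∑-++ (h x) (concatMap h xs) f) (cong (∑ (h x) f +_) (∑-concatMap h xs f))

    ∑-mono : ∀ (xs : List X) {f h} → (∀ {x} → x ∈ᴸ xs → f x ≤ h x) → ∑ xs f ≤ ∑ xs h
    ∑-mono []       _ = z≤n
    ∑-mono (x ∷ xs) p = +-mono-≤ (p (here refl)) (∑-mono xs (p ∘ there))

    ∑-cong : ∀ (xs : List X) {f h} → (∀ x → f x ≡ h x) → ∑ xs f ≡ ∑ xs h
    ∑-cong []       _ = refl
    ∑-cong (x ∷ xs) p = cong₂ _+_ (p x) (∑-cong xs p)

    ∑-distrib-+ : ∀ (xs : List X) f h → ∑[ x ∈ xs ] (f x + h x) ≡ ∑ xs f + ∑ xs h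
    ∑-distrib-+ []       f h = refl
    ∑-distrib-+ (x ∷ xs) f h rewrite ∑-distrib-+ xs f h = lemma (f x) (h x) (∑ xs f) (∑ xs h)
      where
      lemma : ∀ a b c d → a + b + (c + d) ≡ a + c + (b + d)
      lemma = solve-∀

    ∑-*ʳ : ∀ (xs : List X) f c → ∑[ x ∈ xs ] (f x * c) ≡ ∑ xs f * c
    ∑-*ʳ []       f c = refl
    ∑-*ʳ (x ∷ xs) f c rewrite ∑-*ʳ xs f c = sym (*-distribʳ-+ c (f x) (∑ xs f))

    ∑-*ˡ : ∀ (xs : List X) f c → ∑[ x ∈ xs ] (c * f x) ≡ c * ∑ xs f
    ∑-*ˡ xs f c = trans (∑-cong xs (λ x → *-comm c (f x))) (trans (∑-*ʳ xs f c) (*-comm _ c))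

    ∑-const : ∀ (xs : List X) c → ∑[ _ ∈ xs ] c ≡ length xs * c
    ∑-const []       c = refl
    ∑-const (x ∷ xs) c = cong (c +_) (∑-const xs c)

    ∑-0 : ∀ (xs : List X) → ∑[ _ ∈ xs ] 0 ≡ 0
    ∑-0 []       = refl
    ∑-0 (_ ∷ xs) = ∑-0 xs

    ∑-swap : ∀ (xs : List X) (ys : List Y) (f : X → Y → ℕ) →
             ∑[ x ∈ xs ] ∑[ y ∈ ys ] f x y ≡ ∑[ y ∈ ys ] ∑[ x ∈ xs ] f x y
    ∑-swap []       ys f = sym (∑-0 ys)
    ∑-swap (x ∷ xs) ys f = trans (cong (∑ ys (f x) +_) (∑-swap xs ys f))
      (sym (∑-distrib-+ ys (f x) (λ y → ∑[ z ∈ xs ] f z y)))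

    ∑≤length* : ∀ (xs : List X) {f c} → (∀ {x} → x ∈ᴸ xs → f x ≤ c) → ∑ xs f ≤ length xs * c
    ∑≤length* xs {c = c} p = ≤-trans (∑-mono xs p) (≤-reflexive (∑-const xs c))

    ∑-cartesianProduct : ∀ (xs : List X) (ys : List Y) f →
      ∑ (cartesianProduct xs ys) f ≡ ∑[ x ∈ xs ] ∑[ y ∈ ys ] f (x , y)
    ∑-cartesianProduct []       ys f = refl
    ∑-cartesianProduct (x ∷ xs) ys f = trans (∑-++ (map (x ,_) ys) (cartesianProduct xs ys) f)
      (cong₂ _+_ (∑-map (x ,_) ys f) (∑-cartesianProduct xs ys f))

    length-concatMap : ∀ (h : X → List Y) xs → length (concatMap h xs) ≡ ∑ xs (length ∘ h)
    length-concatMap h []       = refl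
    length-concatMap h (x ∷ xs) =
      trans (length-++ (h x)) (cong (length (h x) +_) (length-concatMap h xs))

  length-concatMap≤ : ∀ (h : X → List Y) xs {c} → (∀ {x} → x ∈ᴸ xs → length (h x) ≤ c) →
                      length (concatMap h xs) ≤ length xs * c
  length-concatMap≤ h xs p = ≤-trans (≤-reflexive (length-concatMap h xs)) (∑≤length* xs p)

  opaque
    unfolding ∑

    -- Averaging: if the first term exceeds `c`, the remaining terms still total at most `c` times
    -- their number, so the search goes on among them.
    ∃-small : ∀ (xs : List X) {f c} → 0 < length xs → ∑ xs f ≤ length xs * c →
              ∃ λ x → x ∈ᴸ xs × f x ≤ c
    ∃-small (x ∷ xs) {f} {c} _ h with f x ≤? c
    ... | yes p = x , here refl , p
    ... | no ¬p with xs
    ...   | []     = x , here refl , subst₂ _≤_ (+-identityʳ _) (+-identityʳ _) h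
    ...   | y ∷ ys with ∃-small (y ∷ ys) (s≤s z≤n)
                      (+-cancelˡ-≤ c _ _ (≤-trans (+-monoˡ-≤ _ (<⇒≤ (≰⇒> ¬p))) h))
    ...     | z , z∈ , q = z , there z∈ , q

  𝟙 : {P : Set} → Dec P → ℕ
  𝟙 (yes _) = 1
  𝟙 (no  _) = 0

  𝟙-yes : ∀ {P : Set} (p? : Dec P) → P → 𝟙 p? ≡ 1
  𝟙-yes (yes _) _ = refl
  𝟙-yes (no ¬p) p = ⊥-elim (¬p p)

  𝟙-no : ∀ {P : Set} (p? : Dec P) → ¬ P → 𝟙 p? ≡ 0
  𝟙-no (yes p) ¬p = ⊥-elim (¬p p)
  𝟙-no (no  _) _  = refl

  𝟙-mono : ∀ {P Q : Set} (p? : Dec P) (q? : Dec Q) → (P → Q) → 𝟙 p? ≤ 𝟙 q?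
  𝟙-mono (yes p) q? f = ≤-reflexive (sym (𝟙-yes q? (f p)))
  𝟙-mono (no  _) q? f = z≤n

  𝟙-mono-⊎ : ∀ {P Q R : Set} (p? : Dec P) (q? : Dec Q) (r? : Dec R) → (P → Q ⊎ R) →
             𝟙 p? ≤ 𝟙 q? + 𝟙 r?
  𝟙-mono-⊎ (no _)  q? r? f = z≤n
  𝟙-mono-⊎ (yes p) q? r? f with f p
  ... | inj₁ q rewrite 𝟙-yes q? q = s≤s z≤n
  ... | inj₂ r rewrite 𝟙-yes r? r = m≤n+m 1 (𝟙 q?)

  # : {P : X → Set} → Decidable P → List X → ℕ
  # P? xs = ∑[ x ∈ xs ] 𝟙 (P? x)

  opaque
    unfolding ∑

    #≡length-filter : ∀ {P : X → Set} (P? : Decidable P) xs → # P? xs ≡ length (filter P? xs)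
    #≡length-filter P? []       = refl
    #≡length-filter P? (x ∷ xs) with P? x
    ... | yes _ = cong suc (#≡length-filter P? xs)
    ... | no  _ = #≡length-filter P? xs

  #-mono : ∀ {P Q : X → Set} (P? : Decidable P) (Q? : Decidable Q) xs → (∀ x → P x → Q x) →
           # P? xs ≤ # Q? xs
  #-mono P? Q? xs f = ∑-mono xs (λ {x} _ → 𝟙-mono (P? x) (Q? x) (f x))

  #-mono-⊎ : ∀ {P Q R : X → Set} (P? : Decidable P) (Q? : Decidable Q) (R? : Decidable R) xs →
             (∀ x → P x → Q x ⊎ R x) → # P? xs ≤ # Q? xs + # R? xs
  #-mono-⊎ P? Q? R? xs f = ≤-trans
    (∑-mono xs (λ {x} _ → 𝟙-mono-⊎ (P? x) (Q? x) (R? x) (f x)))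
    (≤-reflexive (∑-distrib-+ xs _ _))

  #≤length : ∀ {P : X → Set} (P? : Decidable P) xs → # P? xs ≤ length xs
  #≤length P? xs = ≤-trans (≤-reflexive (#≡length-filter P? xs)) (length-filter P? xs)

  length≤# : ∀ {P : X → Set} (P? : Decidable P) {xs ys} → Unique xs →
             (∀ {x} → x ∈ᴸ xs → P x × x ∈ᴸ ys) → length xs ≤ # P? ys
  length≤# P? {xs} {ys} u f = ≤-trans
    (length-mono u (λ x∈ → ∈-filter⁺ P? (proj₂ (f x∈)) (proj₁ (f x∈))))
    (≤-reflexive (sym (#≡length-filter P? ys)))

  #≤length⁺ : ∀ {P : X → Set} (P? : Decidable P) {xs ys} → Unique xs →
              (∀ {x} → x ∈ᴸ xs → P x → x ∈ᴸ ys) → # P? xs ≤ length ys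
  #≤length⁺ P? {xs} u f = ≤-trans (≤-reflexive (#≡length-filter P? xs))
    (length-mono (Uniqueₚ.filter⁺ P? u)
      (λ x∈ → let (p , q) = ∈-filter⁻ P? {xs = xs} x∈ in f p q))

  opaque
    unfolding ∑

    #+#¬ : ∀ {P : X → Set} (P? : Decidable P) xs → # P? xs + # (¬? ∘ P?) xs ≡ length xs
    #+#¬ P? []       = refl
    #+#¬ P? (x ∷ xs) with P? x
    ... | yes _ = cong suc (#+#¬ P? xs)
    ... | no  _ = trans (+-suc _ _) (cong suc (#+#¬ P? xs))

  ∈-concatMap : ∀ {h : X → List Y} {xs x y} → x ∈ᴸ xs → y ∈ᴸ h x → y ∈ᴸ concatMap h xs
  ∈-concatMap {h = h} x∈ y∈ = ∈-concatMap⁺ h (lose x∈ y∈)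

  length-fibres : ∀ {xs : List X} {ys : List Y} (h : Y → List X) {c} → Unique xs →
                  (∀ {x} → x ∈ᴸ xs → ∃ λ y → y ∈ᴸ ys × x ∈ᴸ h y) →
                  (∀ {y} → y ∈ᴸ ys → length (h y) ≤ c) → length xs ≤ length ys * c
  length-fibres {ys = ys} h u f b = ≤-trans
    (length-mono u (λ x∈ → let (y , y∈ , x∈h) = f x∈ in ∈-concatMap y∈ x∈h))
    (length-concatMap≤ h ys b)

  length-image : ∀ {xs : List X} {ys : List Y} (g : Y → X) → Unique xs →
                 (∀ {x} → x ∈ᴸ xs → ∃ λ y → y ∈ᴸ ys × x ≡ g y) → length xs ≤ length ys
  length-image {ys = ys} g u f = ≤-trans
    (length-mono {ys = map g ys} u
      (λ x∈ → let (y , y∈ , eq) = f x∈ in subst (_∈ᴸ map g ys) (sym eq) (∈-map⁺ g y∈)))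
    (≤-reflexive (length-map g ys))

  length-allFin : ∀ n → length (allFin n) ≡ n
  length-allFin n = length-tabulate (λ x → x)

  opaque
    vecs : List X → ∀ j → List (Vec X j)
    vecs xs zero    = [ [] ]
    vecs xs (suc j) = concatMap (λ y → map (y ∷_) (vecs xs j)) xs

  tuples : ∀ n j → List (Vec (Fin n) j)
  tuples n = vecs (allFin n)

  opaque
    unfolding ∑ vecs

    ∑-tuples-zero : (f : Vec (Fin n) zero → ℕ) → ∑ (tuples n zero) f ≡ f []
    ∑-tuples-zero f = +-identityʳ (f [])

    ∑-tuples : ∀ j (f : Vec (Fin n) (suc j) → ℕ) →
               ∑ (tuples n (suc j)) f ≡ ∑[ y ∈ allFin n ] ∑[ x ∈ tuples n j ] f (y ∷ x)
    ∑-tuples {n} j f = trans (∑-concatMap _ (allFin n) f)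
      (∑-cong (allFin n) (λ y → ∑-map (y ∷_) (tuples n j) f))

    length-vecs : ∀ (xs : List X) j → length (vecs xs j) ≡ length xs ^ j
    length-vecs xs zero    = refl
    length-vecs xs (suc j) = trans (length-concatMap _ xs)
      (trans (∑-cong xs (λ y → trans (length-map (y ∷_) (vecs xs j)) (length-vecs xs j)))
      (∑-const xs (length xs ^ j)))

    ∈-vecs : ∀ {xs : List X} (v : Vec X j) → (∀ p → lookup v p ∈ᴸ xs) → v ∈ᴸ vecs xs j
    ∈-vecs []      _ = here refl
    ∈-vecs (y ∷ v) h = ∈-concatMap (h zero) (∈-map⁺ (y ∷_) (∈-vecs v (h ∘ suc)))

    vecs-unique : ∀ {xs : List X} j → Unique xs → Unique (vecs xs j)
    vecs-unique zero    _ = [] ∷ []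
    vecs-unique {xs = xs} (suc j) u = subst Unique (eq xs)
      (Uniqueₚ.cartesianProductWith⁺ _∷_ ∷-injective u (vecs-unique j u))
      where
      eq : ∀ ys → cartesianProductWith _∷_ ys (vecs xs j) ≡ concatMap (λ y → map (y ∷_) (vecs xs j)) ys
      eq []       = refl
      eq (y ∷ ys) = cong (map (y ∷_) (vecs xs j) ++_) (eq ys)

  length-tuples : ∀ n j → length (tuples n j) ≡ n ^ j
  length-tuples n j = trans (length-vecs (allFin n) j) (cong (_^ j) (length-allFin n))

  ∈-tuples : ∀ (x : Vec (Fin n) j) → x ∈ᴸ tuples n j
  ∈-tuples x = ∈-vecs x (λ p → ∈-allFin (lookup x p))

  tuples-unique : ∀ n j → Unique (tuples n j)
  tuples-unique n j = vecs-unique j (Uniqueₚ.allFin⁺ n)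

  infix 4 _≟ˢ_

  _≟ˢ_ : DecidableEquality (Subset n)
  _≟ˢ_ = ≡-decᵛ _≟ᴮ_

open Counting

-- The weak Kruskal-Katona bound and disagreements between tuples.

module Tuples where

  private variable
    X Y : Set
    n i j : ℕ

  -- Every tuple obtained by deleting one entry lies in `E`. The recursion separates the deletion of
  -- the first entry from the deletions that keep it, so that induction can pass to the section of
  -- `E` at a first entry.
  Omits : (Vec (Fin n) j → Set) → Vec (Fin n) (suc j) → Set
  Omits {j = zero}  E (y ∷ []) = E []
  Omits {j = suc _} E (y ∷ x)  = E x × Omits (E ∘ (y ∷_)) x

  omits? : {E : Vec (Fin n) j → Set} → Decidable E → Decidable (Omits E)
  omits? {j = zero}  E? (y ∷ []) = E? []
  omits? {j = suc _} E? (y ∷ x)  = E? x ×-dec omits? (E? ∘ (y ∷_)) x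

  omits⁺ : {E : Vec (Fin n) j → Set} (x : Vec (Fin n) (suc j)) →
           (∀ p → E (removeAt x p)) → Omits E x
  omits⁺ {j = zero}  (y ∷ [])       h = h zero
  omits⁺ {j = suc _} (y ∷ x@(_ ∷ _)) h = h zero , omits⁺ x (h ∘ suc)

  #-omits-zero : {E : Vec (Fin n) zero → Set} (E? : Decidable E) → ¬ E [] →
                 # (omits? E?) (tuples n 1) ≡ 0
  #-omits-zero {n} E? ¬e = n≤0⇒n≡0 (≤-trans (∑≤length* (tuples n 1) (λ {x} _ → none x))
                                            (≤-reflexive (*-zeroʳ (length (tuples n 1)))))
    where
    none : ∀ x → 𝟙 (omits? E? x) ≤ 0
    none (y ∷ []) = ≤-reflexive (𝟙-no (E? []) ¬e)

  -- A weak Kruskal–Katona theorem: either the section of E at y is dense, and there are few such y,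
  -- or it is sparse and the bound holds for it by induction.
  #-omits : ∀ n j M {E : Vec (Fin n) j → Set} (E? : Decidable E) →
            # E? (tuples n j) * (2 * M ^ j) ≤ n ^ j →
            # (omits? E?) (tuples n (suc j)) * M ≤ n * # E? (tuples n j)
  #-omits zero j M E? _ = *-monoˡ-≤ M
    (≤-trans (#≤length (omits? E?) (tuples 0 (suc j))) (≤-reflexive (length-tuples 0 (suc j))))
  #-omits n@(suc _) zero M E? h = case E? [] of λ where
    -- There is only one empty tuple, so if `E []` holds the hypothesis reads 2 ≤ 1.
    (yes e) → ⊥-elim (<⇒≱ (s≤s (s≤s z≤n)) (subst (λ w → w * 2 ≤ 1) (trans (∑-tuples-zero (𝟙 ∘ E?)) (𝟙-yes (E? []) e)) h))
    (no ¬e) → ≤-trans (≤-reflexive (cong (_* M) (#-omits-zero E? ¬e))) z≤n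
  #-omits n@(suc n′) (suc j) M {E} E? h = begin
    # (omits? E?) (tuples n (suc (suc j))) * M
      ≡⟨ cong (_* M) (∑-tuples (suc j) (𝟙 ∘ omits? E?)) ⟩
    (∑[ y ∈ allFin n ] ∑[ x ∈ tuples n (suc j) ] 𝟙 (omits? E? (y ∷ x))) * M
      ≡⟨ ∑-*ʳ (allFin n) _ M ⟨
    ∑[ y ∈ allFin n ] ((∑[ x ∈ tuples n (suc j) ] 𝟙 (omits? E? (y ∷ x))) * M)
      ≤⟨ ∑-mono (allFin n) (λ {y} _ → section y) ⟩
    ∑[ y ∈ allFin n ] (n * # (E? ∘ (y ∷_)) (tuples n j))
      ≡⟨ ∑-*ˡ (allFin n) _ n ⟩
    n * (∑[ y ∈ allFin n ] # (E? ∘ (y ∷_)) (tuples n j))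
      ≡⟨ cong (n *_) (∑-tuples j (𝟙 ∘ E?)) ⟨
    n * # E? (tuples n (suc j)) ∎
    where
    open ≤-Reasoning
    instance
      n^j≢0 : NonZero (n ^ j)
      n^j≢0 = m^n≢0 n j
    section : ∀ y → (∑[ x ∈ tuples n (suc j) ] 𝟙 (omits? E? (y ∷ x))) * M ≤
                    n * # (E? ∘ (y ∷_)) (tuples n j)
    section y with # (E? ∘ (y ∷_)) (tuples n j) * (2 * M ^ j) ≤? n ^ j
    ... | yes sparse = ≤-trans
      (*-monoˡ-≤ M (#-mono (omits? E? ∘ (y ∷_)) (omits? (E? ∘ (y ∷_))) (tuples n (suc j)) (λ x → drop x)))
      (#-omits n j M (E? ∘ (y ∷_)) sparse)
      where
      drop : ∀ x → Omits E (y ∷ x) → Omits (E ∘ (y ∷_)) x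
      drop (_ ∷ _) = proj₂
    -- In a dense section only the condition `E x` is kept, which bounds `K` by `e`. Density
    -- exchanges `n ^ j` for `eʸ * (2 * M ^ j)`, and then the hypothesis `h` on the whole of `E`
    -- bounds `e`.
    ... | no dense = *-cancelʳ-≤ _ _ (n ^ j) (begin
      K * M * n ^ j           ≤⟨ *-monoˡ-≤ (n ^ j) (*-monoˡ-≤ M
                                   (#-mono (omits? E? ∘ (y ∷_)) E? (tuples n (suc j)) (λ x → keep x))) ⟩
      e * M * n ^ j           ≤⟨ *-monoʳ-≤ (e * M) (<⇒≤ (≰⇒> dense)) ⟩
      e * M * (eʸ * (2 * M ^ j)) ≡⟨ rearrange e M eʸ (M ^ j) ⟩
      eʸ * (e * (2 * (M * M ^ j))) ≤⟨ *-monoʳ-≤ eʸ h ⟩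
      eʸ * (n * n ^ j)        ≡⟨ rearrange′ eʸ n (n ^ j) ⟩
      n * eʸ * n ^ j          ∎)
      where
      K  = ∑[ x ∈ tuples n (suc j) ] 𝟙 (omits? E? (y ∷ x))
      e  = # E? (tuples n (suc j))
      eʸ = # (E? ∘ (y ∷_)) (tuples n j)
      keep : ∀ x → Omits E (y ∷ x) → E x
      keep (_ ∷ _) = proj₁
      rearrange : ∀ a b c d → a * b * (c * (2 * d)) ≡ c * (a * (2 * (b * d)))
      rearrange = solve-∀
      rearrange′ : ∀ a b c → a * (b * c) ≡ b * a * c
      rearrange′ = solve-∀

  module _ {T : Set} (_≟ᵀ_ : DecidableEquality T) where

    disagreements : (Vec (Fin n) j → T) → ℕ
    disagreements {n} {j} t = ∑[ x ∈ tuples n j ] # (λ y → ¬? (t x ≟ᵀ t y)) (tuples n j)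

    -- x is turned into y one coordinate at a time; z lists the coordinates of two consecutive
    -- tuples on the way, which are obtained from z by omitting one entry.
    disagreements-bound : ∀ n j (t : Vec (Fin n) j → T) {Bd : Vec (Fin n) (suc j) → Set}
      (Bd? : Decidable Bd) → (∀ z → ¬ Bd z → ∀ p q → t (removeAt z p) ≡ t (removeAt z q)) →
      n * disagreements t ≤ j * (n ^ j * # Bd? (tuples n (suc j)))
    disagreements-bound n zero t Bd? agree = ≤-reflexive (trans (cong (n *_)
      (trans (∑-tuples-zero _) (trans (∑-tuples-zero _) (𝟙-no (¬? (t [] ≟ᵀ t [])) (λ ne → ne refl)))))
      (*-zeroʳ n))
    disagreements-bound n (suc j) t {Bd} Bd? agree = begin
      n * disagreements t
        ≤⟨ *-monoʳ-≤ n step ⟩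
      n * (n ^ j * b + n * ∑[ v ∈ F ] disagreements (t ∘ (v ∷_)))
        ≡⟨ cong (λ w → n * (n ^ j * b + w)) (∑-*ˡ F _ n) ⟨
      n * (n ^ j * b + ∑[ v ∈ F ] (n * disagreements (t ∘ (v ∷_))))
        ≤⟨ *-monoʳ-≤ n (+-monoʳ-≤ (n ^ j * b) (∑-mono F (λ {v} _ → disagreements-bound n j (t ∘ (v ∷_)) (Bd? ∘ (v ∷_))
             (λ z ¬bd p q → agree′ v z ¬bd p q)))) ⟩
      n * (n ^ j * b + ∑[ v ∈ F ] (j * (n ^ j * bv v)))
        ≡⟨ cong (λ w → n * (n ^ j * b + w)) (trans (∑-*ˡ F _ j) (cong (j *_) (∑-*ˡ F _ (n ^ j)))) ⟩
      n * (n ^ j * b + j * (n ^ j * ∑[ v ∈ F ] bv v))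
        ≡⟨ cong (λ w → n * (n ^ j * b + j * (n ^ j * w))) (∑-tuples (suc j) (𝟙 ∘ Bd?)) ⟨
      n * (n ^ j * b + j * (n ^ j * b))
        ≡⟨ rearrange n (n ^ j) b j ⟩
      suc j * (n ^ suc j * b) ∎
      where
      open ≤-Reasoning
      F = allFin n
      Tⱼ = tuples n j
      b = # Bd? (tuples n (suc (suc j)))
      bv : Fin n → ℕ
      bv v = # (Bd? ∘ (v ∷_)) (tuples n (suc j))
      rearrange : ∀ n m b j → n * (m * b + j * (m * b)) ≡ suc j * (n * m * b)
      rearrange = solve-∀
      agree′ : ∀ v z → ¬ Bd (v ∷ z) → ∀ p q → t (v ∷ removeAt z p) ≡ t (v ∷ removeAt z q)
      agree′ v z@(_ ∷ _) ¬bd p q = agree (v ∷ z) ¬bd (suc p) (suc q)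
      d : Fin n → Vec (Fin n) j → Fin n → Vec (Fin n) j → ℕ
      d u x v y = 𝟙 (¬? (t (u ∷ x) ≟ᵀ t (v ∷ y)))
      -- Both `u ∷ x` and `v ∷ x` arise from `v ∷ u ∷ x` by one deletion. Unless that tuple is bad
      -- they have the same type, and a disagreement must already occur within the section at `v`.
      split : ∀ u x v y → d u x v y ≤ 𝟙 (Bd? (v ∷ u ∷ x)) + d v x v y
      split u x v y = 𝟙-mono-⊎ (¬? (t (u ∷ x) ≟ᵀ t (v ∷ y))) (Bd? (v ∷ u ∷ x)) (¬? (t (v ∷ x) ≟ᵀ t (v ∷ y))) choose
        where
        choose : _ → _
        choose ne with Bd? (v ∷ u ∷ x)
        ... | yes bd = inj₁ bd
        ... | no ¬bd = inj₂ (λ eq → ne (trans (agree (v ∷ u ∷ x) ¬bd zero (suc zero)) eq))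
      step : disagreements t ≤ n ^ j * b + n * ∑[ v ∈ F ] disagreements (t ∘ (v ∷_))
      step = begin
        disagreements t
          ≡⟨ ∑-tuples j _ ⟩
        ∑[ u ∈ F ] ∑[ x ∈ Tⱼ ] # (λ y → ¬? (t (u ∷ x) ≟ᵀ t y)) (tuples n (suc j))
          ≡⟨ ∑-cong F (λ u → ∑-cong Tⱼ (λ x → ∑-tuples j _)) ⟩
        ∑[ u ∈ F ] ∑[ x ∈ Tⱼ ] ∑[ v ∈ F ] ∑[ y ∈ Tⱼ ] d u x v y
          ≤⟨ ∑-mono F (λ {u} _ → ∑-mono Tⱼ (λ {x} _ → ∑-mono F (λ {v} _ → ∑-mono Tⱼ (λ {y} _ → split u x v y)))) ⟩
        ∑[ u ∈ F ] ∑[ x ∈ Tⱼ ] ∑[ v ∈ F ] ∑[ y ∈ Tⱼ ] (𝟙 (Bd? (v ∷ u ∷ x)) + d v x v y)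
          ≡⟨ ∑-cong F (λ u → ∑-cong Tⱼ (λ x → ∑-cong F (λ v →
               trans (∑-distrib-+ Tⱼ _ _) (cong (_+ ∑ Tⱼ (d v x v)) (trans (∑-const Tⱼ _) (cong (_* _) (length-tuples n j))))))) ⟩
        ∑[ u ∈ F ] ∑[ x ∈ Tⱼ ] ∑[ v ∈ F ] (n ^ j * 𝟙 (Bd? (v ∷ u ∷ x)) + ∑[ y ∈ Tⱼ ] d v x v y)
          ≡⟨ ∑-cong F (λ u → trans (∑-cong Tⱼ (λ x → ∑-distrib-+ F _ _)) (∑-distrib-+ Tⱼ _ _)) ⟩
        ∑[ u ∈ F ] ((∑[ x ∈ Tⱼ ] ∑[ v ∈ F ] (n ^ j * 𝟙 (Bd? (v ∷ u ∷ x)))) + same)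
          ≡⟨ trans (∑-distrib-+ F _ _) (cong₂ _+_ first (trans (∑-const F _) (cong (_* same) (length-allFin n)))) ⟩
        n ^ j * b + n * same
          ≡⟨ cong (λ w → n ^ j * b + n * w) (∑-swap Tⱼ F _) ⟩
        n ^ j * b + n * ∑[ v ∈ F ] disagreements (t ∘ (v ∷_)) ∎
        where
        same = ∑[ x ∈ Tⱼ ] ∑[ v ∈ F ] ∑[ y ∈ Tⱼ ] d v x v y
        first : ∑[ u ∈ F ] ∑[ x ∈ Tⱼ ] ∑[ v ∈ F ] (n ^ j * 𝟙 (Bd? (v ∷ u ∷ x))) ≡ n ^ j * b
        first = trans (∑-cong F (λ u → trans (∑-cong Tⱼ (λ x → ∑-*ˡ F _ (n ^ j))) (∑-*ˡ Tⱼ _ (n ^ j))))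
          (trans (∑-*ˡ F _ (n ^ j)) (cong (n ^ j *_)
          (trans (∑-cong F (λ u → ∑-swap Tⱼ F _))
          (trans (∑-swap F F _)
          (trans (∑-cong F (λ v → sym (∑-tuples j _))) (sym (∑-tuples (suc j) (𝟙 ∘ Bd?))))))))

open Tuples

-- Subsets of `Fin n`, their enumeration, and the tuples that span them.

module Subsets where

  private variable
    n i j k : ℕ
    A B : Subset n
    x y u : Fin n

  ∈-insertˡ : x ∈ A → x ∈ A ∪ ⁅ u ⁆
  ∈-insertˡ x∈ = x∈p∪q⁺ (inj₁ x∈)

  ∈-insertʳ : ∀ (A : Subset n) u → u ∈ A ∪ ⁅ u ⁆
  ∈-insertʳ A u = x∈p∪q⁺ {p = A} (inj₂ (x∈⁅x⁆ u))

  ∈-insert⁻ : ∀ (A : Subset n) {u x} → x ∈ A ∪ ⁅ u ⁆ → x ∈ A ⊎ x ≡ u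
  ∈-insert⁻ A {u} x∈ with x∈p∪q⁻ A ⁅ u ⁆ x∈
  ... | inj₁ p = inj₁ p
  ... | inj₂ q = inj₂ (x∈⁅y⁆⇒x≡y u q)

  insert-⊆ : A ⊆ B → u ∈ B → A ∪ ⁅ u ⁆ ⊆ B
  insert-⊆ {A = A} A⊆B u∈B x∈ with ∈-insert⁻ A x∈
  ... | inj₁ p    = A⊆B p
  ... | inj₂ refl = u∈B

  insert-mono : A ⊆ B → A ∪ ⁅ u ⁆ ⊆ B ∪ ⁅ u ⁆
  insert-mono {B = B} {u = u} A⊆B = insert-⊆ (∈-insertˡ ∘ A⊆B) (∈-insertʳ B u)

  ∉-insert : x ∉ A → x ≢ u → x ∉ A ∪ ⁅ u ⁆
  ∉-insert {A = A} x∉ x≢ x∈ with ∈-insert⁻ A x∈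
  ... | inj₁ p = x∉ p
  ... | inj₂ q = x≢ q

  ∣insert∣≤ : ∀ (A : Subset n) u → ∣ A ∪ ⁅ u ⁆ ∣ ≤ suc ∣ A ∣
  ∣insert∣≤ A u with u ∈? A
  ... | no  u∉ = ≤-reflexive (∣A∪⁅u⁆∣ A u u∉)
  ... | yes u∈ = m≤n⇒m≤1+n (p⊆q⇒∣p∣≤∣q∣ (insert-⊆ ⊆-refl u∈))

  x∉p-x : ∀ (A : Subset n) x → x ∉ A - x
  x∉p-x (inside  ∷ A) zero    ()
  x∉p-x (outside ∷ A) zero    ()
  x∉p-x (_ ∷ A)       (suc x) (there x∈) = x∉p-x A x x∈

  ∈-remove⁻ : ∀ (A : Subset n) {x y} → x ∈ A - y → x ∈ A × x ≢ y
  ∈-remove⁻ A {x} {y} x∈ = p─q⊆p A ⁅ y ⁆ x∈ , λ where refl → x∉p-x A x x∈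

  remove-insert : x ∈ A → (A - x) ∪ ⁅ x ⁆ ≡ A
  remove-insert {x = x} {A = A} x∈A = ⊆-antisym
    (insert-⊆ (proj₁ ∘ ∈-remove⁻ A) x∈A) back
    where
    back : A ⊆ (A - x) ∪ ⁅ x ⁆
    back {y} y∈ with y ≟ᶠ x
    ... | yes refl = ∈-insertʳ (A - x) x
    ... | no  y≢x  = ∈-insertˡ (x∈p∧x≢y⇒x∈p-y y∈ y≢x)

  ∣remove∣ : x ∈ A → suc ∣ A - x ∣ ≡ ∣ A ∣
  ∣remove∣ {x = x} {A = A} x∈A = trans (sym (∣A∪⁅u⁆∣ (A - x) x (x∉p-x A x))) (cong ∣_∣ (remove-insert x∈A))

  ⊆∧∣≥∣⇒⊇ : A ⊆ B → ∣ B ∣ ≤ ∣ A ∣ → B ⊆ A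
  ⊆∧∣≥∣⇒⊇ {A = A} A⊆B B≤A {x} x∈B with x ∈? A
  ... | yes x∈A = x∈A
  ... | no  x∉A = ⊥-elim (<⇒≱ (p⊂q⇒∣p∣<∣q∣ (A⊆B , x , x∈B , x∉A)) B≤A)

  ⊆∧∣≥∣⇒≡ : A ⊆ B → ∣ B ∣ ≤ ∣ A ∣ → A ≡ B
  ⊆∧∣≥∣⇒≡ A⊆B B≤A = ⊆-antisym A⊆B (⊆∧∣≥∣⇒⊇ A⊆B B≤A)

  ∃∈∉ : ∀ (A B : Subset n) → ∣ A ∣ < ∣ B ∣ → ∃ λ x → x ∈ B × x ∉ A
  ∃∈∉ A B A<B with any? (λ x → (x ∈? B) ×-dec ¬? (x ∈? A))
  ... | yes p = p
  ... | no ¬p = ⊥-elim (<⇒≱ A<B (p⊆q⇒∣p∣≤∣q∣ B⊆A))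
    where
    B⊆A : B ⊆ A
    B⊆A {x} x∈B with x ∈? A
    ... | yes x∈A = x∈A
    ... | no  x∉A = ⊥-elim (¬p (x , x∈B , x∉A))

  ∃∈ : ∀ (A : Subset n) → 0 < ∣ A ∣ → ∃ λ x → x ∈ A
  ∃∈ {n} A 0<A with ∃∈∉ ⊥ A (subst (_< ∣ A ∣) (sym (∣⊥∣≡0 n)) 0<A)
  ... | x , x∈ , _ = x , x∈

  ∣p∪q∣≤∣p∣+∣q∣ : ∀ (A B : Subset n) → ∣ A ∪ B ∣ ≤ ∣ A ∣ + ∣ B ∣
  ∣p∪q∣≤∣p∣+∣q∣ []            []            = z≤n
  ∣p∪q∣≤∣p∣+∣q∣ (inside  ∷ A) (inside  ∷ B) = s≤s (≤-trans (∣p∪q∣≤∣p∣+∣q∣ A B) (+-monoʳ-≤ ∣ A ∣ (n≤1+n _)))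
  ∣p∪q∣≤∣p∣+∣q∣ (inside  ∷ A) (outside ∷ B) = s≤s (∣p∪q∣≤∣p∣+∣q∣ A B)
  ∣p∪q∣≤∣p∣+∣q∣ (outside ∷ A) (inside  ∷ B) =
    ≤-trans (s≤s (∣p∪q∣≤∣p∣+∣q∣ A B)) (≤-reflexive (sym (+-suc ∣ A ∣ ∣ B ∣)))
  ∣p∪q∣≤∣p∣+∣q∣ (outside ∷ A) (outside ∷ B) = ∣p∪q∣≤∣p∣+∣q∣ A B

  fill : ℕ → Subset n → Subset n
  fill zero    A             = A
  fill (suc k) []            = []
  fill (suc k) (inside  ∷ A) = inside ∷ fill (suc k) A
  fill (suc k) (outside ∷ A) = inside ∷ fill k A

  ⊆-fill : ∀ k (A : Subset n) → A ⊆ fill k A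
  ⊆-fill zero    A             x∈         = x∈
  ⊆-fill (suc k) (inside  ∷ A) here       = here
  ⊆-fill (suc k) (inside  ∷ A) (there x∈) = there (⊆-fill (suc k) A x∈)
  ⊆-fill (suc k) (outside ∷ A) (there x∈) = there (⊆-fill k A x∈)

  ∣fill∣ : ∀ k (A : Subset n) → ∣ A ∣ + k ≤ n → ∣ fill k A ∣ ≡ ∣ A ∣ + k
  ∣fill∣ zero    A             _       = sym (+-identityʳ ∣ A ∣)
  ∣fill∣ (suc k) (inside  ∷ A) (s≤s h) = cong suc (∣fill∣ (suc k) A h)
  ∣fill∣ {suc n} (suc k) (outside ∷ A) h = trans
    (cong suc (∣fill∣ k A (≤-pred (subst (_≤ suc n) (+-suc ∣ A ∣ k) h)))) (sym (+-suc ∣ A ∣ k))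

  -- Pads small sets: covering is stated for sets of size exactly `k` and edges have size exactly
  -- `r`, while the constructions produce sets that may be smaller.
  fillTo : ℕ → Subset n → Subset n
  fillTo j A = fill (j ∸ ∣ A ∣) A

  ⊆-fillTo : ∀ j (A : Subset n) → A ⊆ fillTo j A
  ⊆-fillTo j A = ⊆-fill (j ∸ ∣ A ∣) A

  ∣fillTo∣ : ∀ {j} (A : Subset n) → ∣ A ∣ ≤ j → j ≤ n → ∣ fillTo j A ∣ ≡ j
  ∣fillTo∣ {j = j} A A≤j j≤n = trans (∣fill∣ _ A (≤-trans (≤-reflexive eq) j≤n)) eq
    where
    eq : ∣ A ∣ + (j ∸ ∣ A ∣) ≡ j
    eq = m+[n∸m]≡n A≤j

  elems : Subset n → List (Fin n)
  elems []            = []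
  elems (inside  ∷ A) = zero ∷ map suc (elems A)
  elems (outside ∷ A) = map suc (elems A)

  length-elems : ∀ (A : Subset n) → length (elems A) ≡ ∣ A ∣
  length-elems []            = refl
  length-elems (inside  ∷ A) = cong suc (trans (length-map suc (elems A)) (length-elems A))
  length-elems (outside ∷ A) = trans (length-map suc (elems A)) (length-elems A)

  ∈-elems⁺ : x ∈ A → x ∈ᴸ elems A
  ∈-elems⁺ {A = inside  ∷ A} here       = here refl
  ∈-elems⁺ {A = inside  ∷ A} (there x∈) = there (∈-map⁺ suc (∈-elems⁺ x∈))
  ∈-elems⁺ {A = outside ∷ A} (there x∈) = ∈-map⁺ suc (∈-elems⁺ x∈)

  ∈-elems⁻ : x ∈ᴸ elems A → x ∈ A
  ∈-elems⁻ {A = inside  ∷ A} (here refl) = here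
  ∈-elems⁻ {A = inside  ∷ A} (there x∈) with ∈-map⁻ suc x∈
  ... | _ , y∈ , refl = there (∈-elems⁻ y∈)
  ∈-elems⁻ {A = outside ∷ A} x∈ with ∈-map⁻ suc x∈
  ... | _ , y∈ , refl = there (∈-elems⁻ y∈)

  subsetsOf : Subset n → List (Subset n)
  subsetsOf []            = [ [] ]
  subsetsOf (inside  ∷ A) = map (inside ∷_) (subsetsOf A) ++ map (outside ∷_) (subsetsOf A)
  subsetsOf (outside ∷ A) = map (outside ∷_) (subsetsOf A)

  length-subsetsOf : ∀ (A : Subset n) → length (subsetsOf A) ≡ 2 ^ ∣ A ∣
  length-subsetsOf []            = refl
  length-subsetsOf (inside  ∷ A) = trans (length-++ (map (inside ∷_) (subsetsOf A)))
    (cong₂ _+_ (trans (length-map _ (subsetsOf A)) (length-subsetsOf A))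
      (trans (length-map _ (subsetsOf A)) (trans (length-subsetsOf A) (sym (+-identityʳ _)))))
  length-subsetsOf (outside ∷ A) = trans (length-map _ (subsetsOf A)) (length-subsetsOf A)

  ∈-subsetsOf : ∀ {A B : Subset n} → A ⊆ B → A ∈ᴸ subsetsOf B
  ∈-subsetsOf {A = []}          {[]}          _ = here refl
  ∈-subsetsOf {A = inside  ∷ A} {inside  ∷ B} h = ∈-++⁺ˡ (∈-map⁺ _ (∈-subsetsOf (drop-∷-⊆ h)))
  ∈-subsetsOf {A = outside ∷ A} {inside  ∷ B} h =
    ∈-++⁺ʳ (map (inside ∷_) (subsetsOf B)) (∈-map⁺ _ (∈-subsetsOf (drop-∷-⊆ h)))
  ∈-subsetsOf {A = inside  ∷ A} {outside ∷ B} h with h here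
  ... | ()
  ∈-subsetsOf {A = outside ∷ A} {outside ∷ B} h = ∈-map⁺ _ (∈-subsetsOf (drop-∷-⊆ h))

  sets : ∀ n j → List (Subset n)
  sets n j = edges (complete n j)

  ∈-sets⁻ : A ∈ᴸ sets n j → ∣ A ∣ ≡ j
  ∈-sets⁻ {n = n} {j = j} A∈ = proj₂ (∈-filter⁻ (λ e → ∣ e ∣ ≟ j) {xs = allSubsets n} A∈)

  ∈-sets⁺ : ∣ A ∣ ≡ j → A ∈ᴸ sets n j
  ∈-sets⁺ = ∈-complete

  -- Entries may repeat, so the set can be smaller than the length of the tuple. Counting is done on
  -- tuples, where sections and deletions are simple, and is carried over to sets by `length-sets≤#`
  -- and `#tuples≤`.
  set : Vec (Fin n) j → Subset n
  set []      = ⊥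
  set (x ∷ v) = set v ∪ ⁅ x ⁆

  ∣set∣≤ : ∀ (v : Vec (Fin n) j) → ∣ set v ∣ ≤ j
  ∣set∣≤ {n} []  = ≤-reflexive (∣⊥∣≡0 n)
  ∣set∣≤ (x ∷ v) = ≤-trans (∣insert∣≤ (set v) x) (s≤s (∣set∣≤ v))

  lookup∈set : ∀ (v : Vec (Fin n) j) p → lookup v p ∈ set v
  lookup∈set (x ∷ v) zero    = ∈-insertʳ (set v) x
  lookup∈set (x ∷ v) (suc p) = ∈-insertˡ (lookup∈set v p)

  set-removeAt : ∀ (v : Vec (Fin n) (suc j)) p → set v ≡ set (removeAt v p) ∪ ⁅ lookup v p ⁆
  set-removeAt (x ∷ v)           zero    = refl
  set-removeAt (x ∷ v@(_ ∷ _)) (suc p) = ⊆-antisym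
    (insert-⊆ (λ z∈ → insert-mono (p⊆p∪q ⁅ x ⁆) (subst (_ ∈_) (set-removeAt v p) z∈))
              (∈-insertˡ (∈-insertʳ R x)))
    (insert-⊆ (insert-mono (subst (R ⊆_) (sym (set-removeAt v p)) (p⊆p∪q _)))
              (∈-insertˡ (lookup∈set v p)))
    where R = set (removeAt v p)

  set-removeAt-⊆ : ∀ (v : Vec (Fin n) (suc j)) p → set (removeAt v p) ⊆ set v
  set-removeAt-⊆ v p x∈ = subst (_ ∈_) (sym (set-removeAt v p)) (∈-insertˡ x∈)

  ∣set-removeAt∣ : ∀ (v : Vec (Fin n) (suc j)) p → ∣ set v ∣ ≡ suc j → ∣ set (removeAt v p) ∣ ≡ j
  ∣set-removeAt∣ v p eq = ≤-antisym (∣set∣≤ (removeAt v p))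
    (≤-pred (≤-trans (≤-reflexive (trans (sym eq) (cong ∣_∣ (set-removeAt v p))))
                     (∣insert∣≤ (set (removeAt v p)) (lookup v p))))

  ∃-tuple : ∀ j (A : Subset n) → ∣ A ∣ ≡ j → ∃ λ (v : Vec (Fin n) j) → set v ≡ A
  ∃-tuple {n} zero A A≡0 = [] , ⊆∧∣≥∣⇒≡ ⊥⊆ (≤-reflexive (trans A≡0 (sym (∣⊥∣≡0 n))))
  ∃-tuple (suc j) A A≡ with ∃∈ A (subst (0 <_) (sym A≡) (s≤s z≤n))
  ... | x , x∈ with ∃-tuple j (A - x) (suc-injective (trans (∣remove∣ x∈) A≡))
  ...   | v , eq = x ∷ v , trans (cong (_∪ ⁅ x ⁆) eq) (remove-insert x∈)

  -- Every `j`-set is spanned by at least one `j`-tuple, so passing from sets to tuples loses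
  -- nothing.
  length-sets≤# : ∀ {P : Vec (Fin n) j → Set} (P? : Decidable P) {𝓢 : List (Subset n)} → Unique 𝓢 →
                  (∀ {A} → A ∈ᴸ 𝓢 → ∣ A ∣ ≡ j × (∀ v → set v ≡ A → P v)) →
                  length 𝓢 ≤ # P? (tuples n j)
  length-sets≤# {n} {j} P? u h = ≤-trans
    (length-image set u λ A∈ → let (A≡ , p) = h A∈ ; (v , eq) = ∃-tuple j _ A≡ in
      v , ∈-filter⁺ P? (∈-tuples v) (p v eq) , sym eq)
    (≤-reflexive (sym (#≡length-filter P? (tuples n j))))

  -- All entries of a tuple lie in the set that it spans, which leaves at most `j ^ j` tuples for a
  -- set of size `j`.
  #tuples≤ : ∀ {P : Vec (Fin n) j → Set} (P? : Decidable P) (𝓢 : List (Subset n)) →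
             (∀ v → P v → set v ∈ᴸ 𝓢) → (∀ {A} → A ∈ᴸ 𝓢 → ∣ A ∣ ≡ j) →
             # P? (tuples n j) ≤ length 𝓢 * j ^ j
  #tuples≤ {n} {j} P? 𝓢 h ∣𝓢∣ = ≤-trans
    (#≤length⁺ P? {ys = concatMap (λ A → vecs (elems A) j) 𝓢} (tuples-unique n j)
      λ {v} _ p → ∈-concatMap (h v p) (∈-vecs v (λ q → ∈-elems⁺ (lookup∈set v q))))
    (length-concatMap≤ (λ A → vecs (elems A) j) 𝓢 (λ {A} A∈ → ≤-reflexive
      (trans (length-vecs (elems A) j) (cong (_^ j) (trans (length-elems A) (∣𝓢∣ A∈))))))

  length-sets≤^ : ∀ n j → length (sets n j) ≤ n ^ j
  length-sets≤^ n j = ≤-trans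
    (length-image {ys = tuples n j} set (unique (complete n j)) λ A∈ →
      let (v , eq) = ∃-tuple j _ (∈-sets⁻ {n = n} {j = j} A∈) in v , ∈-tuples v , sym eq)
    (≤-reflexive (length-tuples n j))

  filter-map : ∀ {X Y : Set} {P : Y → Set} {Q : X → Set} (P? : Decidable P) (Q? : Decidable Q)
               (h : X → Y) xs → (∀ x → P (h x) → Q x) → (∀ x → Q x → P (h x)) →
               filter P? (map h xs) ≡ map h (filter Q? xs)
  filter-map P? Q? h []       to from = refl
  filter-map P? Q? h (x ∷ xs) to from with Q? x
  ... | yes q = trans (filter-accept P? (from x q)) (cong (h x ∷_) (filter-map P? Q? h xs to from))
  ... | no ¬q = trans (filter-reject P? (λ p → ¬q (to x p))) (filter-map P? Q? h xs to from)

  -- Pascal's rule: the sets are split by whether they contain the first vertex.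
  length-sets : ∀ n j → length (sets n j) ≡ n C j
  length-sets zero    zero    = refl
  length-sets zero    (suc j) = refl
  length-sets (suc n) j = trans (cong length (filter-++ (∣?∣≡ j) (map (inside ∷_) (allSubsets n)) _))
    (trans (length-++ (filter (∣?∣≡ j) (map (inside ∷_) (allSubsets n))))
    (trans (cong (λ w → length (filter (∣?∣≡ j) (map (inside ∷_) (allSubsets n))) + w) outs) (ins j)))
    where
    ∣?∣≡ : ∀ {m} j (e : Subset m) → Dec (∣ e ∣ ≡ j)
    ∣?∣≡ j e = ∣ e ∣ ≟ j
    outs : length (filter (∣?∣≡ j) (map (outside ∷_) (allSubsets n))) ≡ n C j
    outs = trans (cong length (filter-map (∣?∣≡ j) (∣?∣≡ j) (outside ∷_) (allSubsets n) (λ _ p → p) (λ _ p → p)))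
      (trans (length-map _ (filter (∣?∣≡ j) (allSubsets n))) (length-sets n j))
    ins : ∀ j → length (filter (∣?∣≡ j) (map (inside ∷_) (allSubsets n))) + n C j ≡ suc n C j
    ins zero = trans (cong (_+ n C 0) (n≤0⇒n≡0 none)) (trans (nCk≡1 n) (sym (nCk≡1 (suc n))))
      where
      nCk≡1 : ∀ n → n C 0 ≡ 1
      nCk≡1 n = trans (nCk≡nC[n∸k] {k = 0} {n = n} z≤n) (nCn≡1 n)
      none : length (filter (∣?∣≡ 0) (map (inside ∷_) (allSubsets n))) ≤ 0
      none = length-mono {ys = []} (Uniqueₚ.filter⁺ (∣?∣≡ 0) (Uniqueₚ.map⁺ (λ where refl → refl) (allSubsets-unique n)))
        (λ e∈ → let (p , q) = ∈-filter⁻ (∣?∣≡ 0) {xs = map (inside ∷_) (allSubsets n)} e∈ in ⊥-elim (absurd p q))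
        where
        absurd : ∀ {e} → e ∈ᴸ map (inside ∷_) (allSubsets n) → ∣ e ∣ ≢ 0
        absurd p q with ∈-map⁻ (inside ∷_) p
        absurd p () | _ , _ , refl
    ins (suc j) = trans (cong (_+ n C suc j)
      (trans (cong length (filter-map (∣?∣≡ (suc j)) (∣?∣≡ j) (inside ∷_) (allSubsets n)
                            (λ _ → suc-injective) (λ _ → cong suc)))
        (trans (length-map _ (filter (∣?∣≡ j) (allSubsets n))) (length-sets n j))))
      (nCk+nC[k+1]≡[n+1]C[k+1] n j)

open Subsets

-- Independent sets in sparse digraphs, and the repair of coverings.

module Coverings where

  private variable
    n m r i : ℕ

  #-filters : ∀ {A : Set} {P : A → Set} (P? : Decidable P) xs →
              length (filter P? xs) + length (filter (¬? ∘ P?) xs) ≡ length xs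
  #-filters P? xs = trans (sym (cong₂ _+_ (#≡length-filter P? xs) (#≡length-filter (¬? ∘ P?) xs))) (#+#¬ P? xs)

  module _ {A : Set} (_≟ᴬ_ : DecidableEquality A) where

    ∈ᴸ? : ∀ (x : A) xs → Dec (x ∈ᴸ xs)
    ∈ᴸ? x xs = Any.any? (x ≟ᴬ_) xs

    module _ (φ : A → List A) (d : ℕ) where

      -- `φ` is a digraph given by its lists of out-neighbours. The factor in the last clause counts
      -- a chosen vertex, its `d` out-neighbours and its `d` in-neighbours.
      Independent : List A → List A → Set
      Independent N I = Unique I × (∀ {x} → x ∈ᴸ I → x ∈ᴸ N) ×
        (∀ {x y} → x ∈ᴸ I → y ∈ᴸ I → y ∉ᴸ φ x) × length N ≤ suc (d + d) * length I

      -- Greedily: some vertex has in-degree at most the average, hence at most d; choose it and discard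
      -- its at most 2d neighbours.
      independent : ∀ fuel N → length N ≤ fuel → Unique N → (∀ {x} → x ∈ᴸ N → length (φ x) ≤ d) →
                    (∀ {x} → x ∈ᴸ N → x ∉ᴸ φ x) → ∃ (Independent N)
      independent _ [] _ _ _ _ = [] , [] , (λ ()) , (λ ()) , z≤n
      independent (suc fuel) N@(_ ∷ _) (s≤s N≤) u ∣φ∣ irr with ∃-small N {f = λ v → # (λ w → ∈ᴸ? v (φ w)) N} {c = d} (s≤s z≤n) average
        where
        -- Within `N`, in-degrees and out-degrees have the same sum, and each out-degree is at most
        -- `d`.
        average : ∑[ v ∈ N ] # (λ w → ∈ᴸ? v (φ w)) N ≤ length N * d
        average = ≤-trans (≤-reflexive (∑-swap N N _)) (∑≤length* N (λ {w} w∈ →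
          ≤-trans (#≤length⁺ (λ v → ∈ᴸ? v (φ w)) u (λ _ p → p)) (∣φ∣ w∈)))
      ... | v , v∈ , indeg with independent fuel N′ N′≤ (Uniqueₚ.filter⁺ far? u) (∣φ∣ ∘ sub) (irr ∘ sub)
        where
        Far : A → Set
        Far w = (¬ w ≡ v) × (¬ w ∈ᴸ φ v) × (¬ v ∈ᴸ φ w)
        far? : Decidable Far
        far? w = ¬? (w ≟ᴬ v) ×-dec ¬? (∈ᴸ? w (φ v)) ×-dec ¬? (∈ᴸ? v (φ w))
        N′ = filter far? N
        sub : ∀ {x} → x ∈ᴸ N′ → x ∈ᴸ N
        sub x∈ = proj₁ (∈-filter⁻ far? {xs = N} x∈)
        N′≤ : length N′ ≤ fuel
        N′≤ = ≤-pred (≤-trans (length-mono {xs = v ∷ N′}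
          (All.tabulate (λ x∈ v≡x → proj₁ (proj₂ (∈-filter⁻ far? {xs = N} x∈)) (sym v≡x)) ∷ Uniqueₚ.filter⁺ far? u)
          λ { (here refl) → v∈ ; (there x∈) → sub x∈ }) (s≤s N≤))
      ...   | I , uI , I⊆ , ind , N′≤I = v ∷ I , All.tabulate (λ x∈ v≡x → proj₁ (far x∈) (sym v≡x)) ∷ uI
        , (λ { (here refl) → v∈ ; (there x∈) → proj₁ (∈-filter⁻ far? {xs = N} (I⊆ x∈)) })
        , (λ { (here refl) (here refl) → irr v∈
             ; (here refl) (there y∈)  → proj₁ (proj₂ (far y∈))
             ; (there x∈)  (here refl) → proj₂ (proj₂ (far x∈))
             ; (there x∈)  (there y∈)  → ind x∈ y∈ })
        , bound
        where
        far? : Decidable (λ w → (¬ w ≡ v) × (¬ w ∈ᴸ φ v) × (¬ v ∈ᴸ φ w))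
        far? w = ¬? (w ≟ᴬ v) ×-dec ¬? (∈ᴸ? w (φ v)) ×-dec ¬? (∈ᴸ? v (φ w))
        N′ = filter far? N
        far : ∀ {w} → w ∈ᴸ I → (¬ w ≡ v) × (¬ w ∈ᴸ φ v) × (¬ v ∈ᴸ φ w)
        far w∈ = proj₂ (∈-filter⁻ far? {xs = N} (I⊆ w∈))
        pre = filter (λ w → ∈ᴸ? v (φ w)) N
        split : ∀ {w} → w ∈ᴸ N → w ∈ᴸ (v ∷ φ v ++ pre) ++ N′
        split {w} w∈ with w ≟ᴬ v
        ... | yes refl = here refl
        ... | no w≢v with ∈ᴸ? w (φ v)
        ...   | yes p = there (∈-++⁺ˡ (∈-++⁺ˡ p))
        ...   | no ¬p with ∈ᴸ? v (φ w)
        ...     | yes q = there (∈-++⁺ˡ (∈-++⁺ʳ (φ v) (∈-filter⁺ (λ w → ∈ᴸ? v (φ w)) w∈ q)))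
        ...     | no ¬q = ∈-++⁺ʳ (v ∷ φ v ++ pre) (∈-filter⁺ far? w∈ (w≢v , ¬p , ¬q))
        bound : length N ≤ suc (d + d) * suc (length I)
        bound = begin
          length N                                ≤⟨ length-mono u split ⟩
          length ((v ∷ φ v ++ pre) ++ N′)         ≡⟨ length-++ (v ∷ φ v ++ pre) ⟩
          suc (length (φ v ++ pre)) + length N′   ≡⟨ cong (λ w → suc w + length N′) (length-++ (φ v)) ⟩
          suc (length (φ v) + length pre) + length N′
            ≤⟨ +-mono-≤ (s≤s (+-mono-≤ (∣φ∣ v∈) (≤-trans (≤-reflexive (sym (#≡length-filter (λ w → ∈ᴸ? v (φ w)) N))) indeg))) N′≤I ⟩
          suc (d + d) + suc (d + d) * length I    ≡⟨ *-suc (suc (d + d)) (length I) ⟨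
          suc (d + d) * suc (length I)            ∎
          where open ≤-Reasoning

  module _ (m r i : ℕ) (r≡ : r ≡ suc (suc i)) (r≤m : r ≤ m) where

    private
      Enlarged : List (Subset m) → Subset m × Fin m → Set
      Enlarged Y (Z , x) = ∃ λ e → e ∈ᴸ Y × ∣ e ∣ ≡ r × Z ∪ ⁅ x ⁆ ⊆ e

      there′ : ∀ {Y e p} → Enlarged Y p → Enlarged (e ∷ Y) p
      there′ (e , e∈ , h) = e , there e∈ , h

      enlarge : ∀ (e : Subset m) → ∣ e ∣ ≤ r → ∣ fillTo r e ∣ ≡ r
      enlarge e e≤r = ∣fillTo∣ e e≤r r≤m

      ∣Zx∣ : ∀ (Z : Subset m) → ∣ Z ∣ ≡ i → ∀ x → ∣ Z ∪ ⁅ x ⁆ ∣ ≤ suc i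
      ∣Zx∣ Z Z≡ x = ≤-trans (∣insert∣≤ Z x) (s≤s (≤-reflexive Z≡))

      -- Two sets `Z ∪ ⁅ x ⁆` and `Z ∪ ⁅ y ⁆` with the same `Z` fit into one set of size `r`, so one
      -- new edge serves both; the `+ 1` is for an odd one left over.
      pairUp : ∀ (Z : Subset m) → ∣ Z ∣ ≡ i → ∀ xs → ∃ λ Y → (∀ {x} → x ∈ᴸ xs → Enlarged Y (Z , x)) ×
               2 * length Y ≤ length xs + 1
      pairUp Z Z≡ []           = [] , (λ ()) , z≤n
      pairUp Z Z≡ (x ∷ [])     = [ fillTo r (Z ∪ ⁅ x ⁆) ] ,
        (λ { (here refl) → _ , here refl , enlarge (Z ∪ ⁅ x ⁆) (≤-trans (∣Zx∣ Z Z≡ x) (≤-trans (n≤1+n _) (≤-reflexive (sym r≡)))) , ⊆-fillTo r _ }) ,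
        ≤-refl
      pairUp Z Z≡ (x ∷ y ∷ xs) with pairUp Z Z≡ xs
      -- Filling up handles the case that `x` and `y` coincide or lie in `Z`.
      ... | Y , h , Y≤ = fillTo r e ∷ Y ,
        (λ { (here refl)         → fillTo r e , here refl , ∣e∣ , λ z∈ → ⊆-fillTo r e (∈-insertˡ z∈)
           ; (there (here refl)) → fillTo r e , here refl , ∣e∣ , λ z∈ → ⊆-fillTo r e (insert-mono (p⊆p∪q _) z∈)
           ; (there (there x∈))  → there′ (h x∈) }) ,
        ≤-trans (≤-reflexive (double (length Y))) (s≤s (s≤s Y≤))
        where
        e = (Z ∪ ⁅ x ⁆) ∪ ⁅ y ⁆
        ∣e∣ : ∣ fillTo r e ∣ ≡ r
        ∣e∣ = enlarge e (≤-trans (∣insert∣≤ (Z ∪ ⁅ x ⁆) y) (≤-trans (s≤s (∣Zx∣ Z Z≡ x)) (≤-reflexive (sym r≡))))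
        double : ∀ a → 2 * suc a ≡ suc (suc (2 * a))
        double = solve-∀

    -- The pairs are grouped by their first component. Each group is paired up on its own and leaves
    -- at most one odd set, whence the summand `length 𝓩`.
    recover : ∀ 𝓩 𝓔 → (∀ {Z} → Z ∈ᴸ 𝓩 → ∣ Z ∣ ≡ i) → (∀ {p} → p ∈ᴸ 𝓔 → proj₁ p ∈ᴸ 𝓩) →
              ∃ λ Y → (∀ {p} → p ∈ᴸ 𝓔 → Enlarged Y p) × 2 * length Y ≤ length 𝓔 + length 𝓩
    recover [] 𝓔 _ key = [] , (λ p∈ → case key p∈ of λ ()) , z≤n
    recover (Z ∷ 𝓩) 𝓔 ∣𝓩∣ key = Y₁ ++ Y₂ , covered , bound
      where
      at? : Decidable (λ p → proj₁ p ≡ Z)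
      at? p = proj₁ p ≟ˢ Z
      𝓔₁ = filter at? 𝓔
      𝓔₂ = filter (¬? ∘ at?) 𝓔
      star = pairUp Z (∣𝓩∣ (here refl)) (map proj₂ 𝓔₁)
      key′ : ∀ {p} → p ∈ᴸ 𝓔₂ → proj₁ p ∈ᴸ 𝓩
      key′ p∈ with ∈-filter⁻ (¬? ∘ at?) {xs = 𝓔} p∈
      ... | p∈𝓔 , p≢ with key p∈𝓔
      ...   | here eq = ⊥-elim (p≢ eq)
      ...   | there q = q
      rest = recover 𝓩 𝓔₂ (∣𝓩∣ ∘ there) key′
      Y₁ = proj₁ star
      Y₂ = proj₁ rest
      covered : ∀ {p} → p ∈ᴸ 𝓔 → Enlarged (Y₁ ++ Y₂) p
      covered {Z′ , x} p∈ with Z′ ≟ˢ Z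
      ... | yes refl = let (e , e∈ , h) = proj₁ (proj₂ star) (∈-map⁺ proj₂ (∈-filter⁺ at? p∈ refl)) in
                       e , ∈-++⁺ˡ e∈ , h
      ... | no ne    = let (e , e∈ , h) = proj₁ (proj₂ rest) (∈-filter⁺ (¬? ∘ at?) p∈ ne) in
                       e , ∈-++⁺ʳ Y₁ e∈ , h
      bound : 2 * length (Y₁ ++ Y₂) ≤ length 𝓔 + suc (length 𝓩)
      bound = begin
        2 * length (Y₁ ++ Y₂)                    ≡⟨ cong (2 *_) (length-++ Y₁) ⟩
        2 * (length Y₁ + length Y₂)              ≡⟨ *-distribˡ-+ 2 (length Y₁) (length Y₂) ⟩
        2 * length Y₁ + 2 * length Y₂            ≤⟨ +-mono-≤ (proj₂ (proj₂ star)) (proj₂ (proj₂ rest)) ⟩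
        length (map proj₂ 𝓔₁) + 1 + (length 𝓔₂ + length 𝓩) ≡⟨ cong (λ w → w + 1 + (length 𝓔₂ + length 𝓩)) (length-map proj₂ 𝓔₁) ⟩
        length 𝓔₁ + 1 + (length 𝓔₂ + length 𝓩) ≡⟨ rearrange (length 𝓔₁) (length 𝓔₂) (length 𝓩) ⟩
        length 𝓔₁ + length 𝓔₂ + suc (length 𝓩) ≡⟨ cong (_+ suc (length 𝓩)) (#-filters at? 𝓔) ⟩
        length 𝓔 + suc (length 𝓩)               ∎
        where
        open ≤-Reasoning
        rearrange : ∀ a b c → a + 1 + (b + c) ≡ a + b + suc c
        rearrange = solve-∀

  hyper : ∀ {P : Subset n → Set} r → Decidable P → Hypergraph n r
  hyper {n} r P? = record
    { edges   = filter P? (sets n r)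
    ; uniform = All.tabulate (λ e∈ → ∈-sets⁻ {n = n} (proj₁ (∈-filter⁻ P? {xs = sets n r} e∈)))
    ; unique  = Uniqueₚ.filter⁺ P? (unique (complete n r))
    }

  ∈-hyper⁺ : ∀ {P : Subset n → Set} {r} (P? : Decidable P) {e} → ∣ e ∣ ≡ r → P e → e ∈ᴱ hyper r P?
  ∈-hyper⁺ P? e≡ p = ∈-filter⁺ P? (∈-sets⁺ e≡) p

  ∈-hyper⁻ : ∀ {P : Subset n → Set} {r} (P? : Decidable P) {e} → e ∈ᴱ hyper r P? → ∣ e ∣ ≡ r × P e
  ∈-hyper⁻ {n} {r = r} P? e∈ = let (p , q) = ∈-filter⁻ P? {xs = sets n r} e∈ in ∈-sets⁻ {n = n} p , q

  -- `Y` may contain repetitions and sets of other sizes; its `r`-sets, taken once each, form a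
  -- hypergraph with at most `length Y` edges.
  D≤ : 1 ≤ r → r ≤ m → (Y : List (Subset m)) →
       (∀ P → ∣ P ∣ ≡ r ∸ 1 → ∃ λ e → e ∈ᴸ Y × ∣ e ∣ ≡ r × P ⊆ e) → D m r ≤ length Y
  D≤ {r} {m} 1≤r r≤m Y cover = ≤-trans
    (IsMinimum.least (D-isMinimum 1≤r r≤m) (hyper r ∈Y?)
      λ P P≡ → let (e , e∈ , e≡ , P⊆e) = cover P P≡ in e , ∈-hyper⁺ ∈Y? e≡ e∈ , P⊆e)
    (length-mono (unique (hyper r ∈Y?)) (λ e∈ → proj₂ (∈-hyper⁻ {r = r} ∈Y? e∈)))
    where
    ∈Y? : Decidable (_∈ᴸ Y)
    ∈Y? e = ∈ᴸ? _≟ˢ_ e Y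

  -- A covering with gaps still bounds `D`: the gaps listed in `𝓔` are filled at half an edge each,
  -- apart from one odd gap for each key.
  D≤-recover : ∀ {m i} → suc (suc i) ≤ m → (T : List (Subset m)) (𝓩 : List (Subset m)) (𝓔 : List (Subset m × Fin m)) →
    (∀ {Z} → Z ∈ᴸ 𝓩 → ∣ Z ∣ ≡ i) → (∀ {p} → p ∈ᴸ 𝓔 → proj₁ p ∈ᴸ 𝓩) →
    (∀ P → ∣ P ∣ ≡ suc i → (∃ λ e → e ∈ᴸ T × ∣ e ∣ ≡ suc (suc i) × P ⊆ e) ⊎
                            (∃ λ p → p ∈ᴸ 𝓔 × P ⊆ proj₁ p ∪ ⁅ proj₂ p ⁆)) →
    2 * D m (suc (suc i)) ≤ 2 * length T + (length 𝓔 + length 𝓩)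
  D≤-recover {m} {i} r≤m T 𝓩 𝓔 ∣𝓩∣ key cover with recover m (suc (suc i)) i refl r≤m 𝓩 𝓔 ∣𝓩∣ key
  ... | Y , enlarged , Y≤ = begin
    2 * D m (suc (suc i))           ≤⟨ *-monoʳ-≤ 2 (D≤ (s≤s z≤n) r≤m (T ++ Y) cover′) ⟩
    2 * length (T ++ Y)             ≡⟨ cong (2 *_) (length-++ T) ⟩
    2 * (length T + length Y)       ≡⟨ *-distribˡ-+ 2 (length T) (length Y) ⟩
    2 * length T + 2 * length Y     ≤⟨ +-monoʳ-≤ (2 * length T) Y≤ ⟩
    2 * length T + (length 𝓔 + length 𝓩) ∎
    where
    open ≤-Reasoning
    cover′ : ∀ P → ∣ P ∣ ≡ suc i → ∃ λ e → e ∈ᴸ T ++ Y × ∣ e ∣ ≡ suc (suc i) × P ⊆ e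
    cover′ P P≡ with cover P P≡
    ... | inj₁ (e , e∈ , h) = e , ∈-++⁺ˡ e∈ , h
    ... | inj₂ (p , p∈ , P⊆) = let (e , e∈ , e≡ , ⊆e) = enlarged p∈ in e , ∈-++⁺ʳ T e∈ , e≡ , λ x∈ → ⊆e (P⊆ x∈)

open Coverings

-- Linear arithmetic by certificate: `X ≤ Y` is a combination of the available inequalities with
-- suitable multipliers, `d` is the slack, and the identity is left to the ring solver. The
-- multipliers chosen at each use carry the content of the estimate.
≤-certificate : ∀ {X Y} a b d → X ≤ Y → a + Y + d ≡ b + X → a ≤ b
≤-certificate {X} {Y} a b d X≤Y eq = +-cancelʳ-≤ Y a b (begin
  a + Y     ≤⟨ m≤m+n (a + Y) d ⟩
  a + Y + d ≡⟨ eq ⟩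
  b + X     ≤⟨ +-monoʳ-≤ b X≤Y ⟩
  b + Y     ∎)
  where open ≤-Reasoning

Joined : ∀ {n} → List (Subset n) → ℕ → Subset n → Fin n → Set
Joined T j A u = ∀ Q → Q ⊆ A → ∣ Q ∣ ≡ j → Q ∪ ⁅ u ⁆ ∈ᴸ T

joined? : ∀ {n} (T : List (Subset n)) j A u → Dec (Joined T j A u)
joined? T j A u = allSubset? λ Q → (Q ⊆? A) →-dec (∣ Q ∣ ≟ j) →-dec ∈ᴸ? _≟ˢ_ (Q ∪ ⁅ u ⁆) T

opaque
  -- With `r = 2 + i`, the product of two losses: at most `2 ^ r * r` pairs `(Z , x)` lie within one
  -- edge, and an independent set retains one vertex in `2 * r + 1`. The successor makes it visibly
  -- positive.
  overcount : ℕ → ℕ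
  overcount i = suc (2 ^ (2 + i) * (2 + i) * suc ((2 + i) + (2 + i)))

  overcount≡ : ∀ i → overcount i ≡ suc (2 ^ (2 + i) * (2 + i) * suc ((2 + i) + (2 + i)))
  overcount≡ i = refl

  instance
    overcount≢0 : ∀ {i} → NonZero (overcount i)
    overcount≢0 = _

-- Edges saved in a covering when all `r`-sets above a given family are joined.

module Savings (m i : ℕ) (r≤m : 2 + i ≤ m) (T : List (Subset m)) (uT : Unique T)
  (∣T∣ : ∀ {e} → e ∈ᴸ T → ∣ e ∣ ≡ 2 + i)
  (cover : ∀ P → ∣ P ∣ ≡ 1 + i → ∃ λ e → e ∈ᴸ T × P ⊆ e)
  (𝓑 : List (Subset m)) (u𝓑 : Unique 𝓑) (∣𝓑∣ : ∀ {B} → B ∈ᴸ 𝓑 → ∣ B ∣ ≡ 1 + i)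
  (joined : ∀ {B} → B ∈ᴸ 𝓑 → ∀ R → B ⊆ R → ∣ R ∣ ≡ 2 + i → ∃ λ u → u ∉ R × Joined T (1 + i) R u)
  where

  r : ℕ
  r = 2 + i

  Shadow : Subset m → Set
  Shadow Z = ∃ λ b → b ∉ Z × Z ∪ ⁅ b ⁆ ∈ᴸ 𝓑

  shadow? : Decidable Shadow
  shadow? Z = any? λ b → ¬? (b ∈? Z) ×-dec ∈ᴸ? _≟ˢ_ (Z ∪ ⁅ b ⁆) 𝓑

  𝓩 : List (Subset m)
  𝓩 = filter shadow? (sets m i)

  ∣𝓩∣ : ∀ {Z} → Z ∈ᴸ 𝓩 → ∣ Z ∣ ≡ i
  ∣𝓩∣ Z∈ = ∈-sets⁻ {n = m} (proj₁ (∈-filter⁻ shadow? {xs = sets m i} Z∈))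

  -- For d = (Z , b , x , u), the edge R = Z ∪ {x, u} may be deleted as long as the edges
  -- (R ∖ {y}) ∪ {b} listed by keep R stay; only Z ∪ {x} can become uncovered.
  Datum : Set
  Datum = Subset m × Fin m × Fin m × Fin m

  Deletable : Subset m → Datum → Set
  Deletable R (Z , b , x , u) = Z ∈ᴸ 𝓩 × b ∉ Z × x ∉ Z ∪ ⁅ b ⁆ × u ∉ (Z ∪ ⁅ b ⁆) ∪ ⁅ x ⁆ ×
    R ≡ (Z ∪ ⁅ x ⁆) ∪ ⁅ u ⁆ × Joined T (1 + i) ((Z ∪ ⁅ b ⁆) ∪ ⁅ x ⁆) u

  deletable? : ∀ R → Dec (∃ λ Z → ∃ λ b → ∃ λ x → ∃ λ u → Deletable R (Z , b , x , u))
  deletable? R = anySubset? λ Z → any? λ b → any? λ x → any? λ u →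
    ∈ᴸ? _≟ˢ_ Z 𝓩 ×-dec ¬? (b ∈? Z) ×-dec ¬? (x ∈? Z ∪ ⁅ b ⁆) ×-dec ¬? (u ∈? (Z ∪ ⁅ b ⁆) ∪ ⁅ x ⁆)
    ×-dec (R ≟ˢ (Z ∪ ⁅ x ⁆) ∪ ⁅ u ⁆) ×-dec joined? T (1 + i) ((Z ∪ ⁅ b ⁆) ∪ ⁅ x ⁆) u

  -- The search fixes at most one datum for each edge, so that deleting an edge costs a single pair
  -- `(Z , x)`.
  datum : Subset m → List Datum
  datum R with deletable? R
  ... | yes (Z , b , x , u , _) = [ (Z , b , x , u) ]
  ... | no _                    = []

  datum-deletable : ∀ {R d} → d ∈ᴸ datum R → Deletable R d
  datum-deletable {R} d∈ with deletable? R
  datum-deletable (here refl) | yes (_ , _ , _ , _ , p) = p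

  ∃-datum : ∀ {R d} → Deletable R d → ∃ λ d′ → d′ ∈ᴸ datum R
  ∃-datum {R} {Z , b , x , u} p with deletable? R
  ... | yes _ = _ , here refl
  ... | no ¬p = ⊥-elim (¬p (Z , b , x , u , p))

  length-datum : ∀ R → length (datum R) ≤ 1
  length-datum R with deletable? R
  ... | yes _ = ≤-refl
  ... | no  _ = z≤n

  keep : Subset m → List (Subset m)
  keep R = concatMap (λ (_ , b , _ , _) → map (λ y → (R - y) ∪ ⁅ b ⁆) (elems R)) (datum R)

  ∈-keep⁻ : ∀ {R R′} → R′ ∈ᴸ keep R → ∃ λ Z → ∃ λ b → ∃ λ x → ∃ λ u → ∃ λ y →
            Deletable R (Z , b , x , u) × R′ ≡ (R - y) ∪ ⁅ b ⁆
  ∈-keep⁻ {R} R′∈ with find (∈-concatMap⁻ (λ (_ , b , _ , _) → map (λ y → (R - y) ∪ ⁅ b ⁆) (elems R)) {xs = datum R} R′∈)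
  ... | (Z , b , x , u) , d∈ , q with ∈-map⁻ (λ y → (R - y) ∪ ⁅ b ⁆) q
  ...   | y , _ , eq = Z , b , x , u , y , datum-deletable d∈ , eq

  ∈-keep⁺ : ∀ {R d} → d ∈ᴸ datum R → ∀ {y} → y ∈ R → (R - y) ∪ ⁅ proj₁ (proj₂ d) ⁆ ∈ᴸ keep R
  ∈-keep⁺ {R} {d} d∈ {y} y∈ = ∈-concatMap d∈ (∈-map⁺ (λ y → (R - y) ∪ ⁅ proj₁ (proj₂ d) ⁆) (∈-elems⁺ y∈))

  length-keep : ∀ {R} → R ∈ᴸ T → length (keep R) ≤ r
  length-keep {R} R∈ = ≤-trans
    (length-concatMap≤ (λ (_ , b , _ , _) → map (λ y → (R - y) ∪ ⁅ b ⁆) (elems R)) (datum R) {r}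
      (λ _ → ≤-reflexive (trans (length-map _ (elems R)) (trans (length-elems R) (∣T∣ R∈)))))
    (≤-trans (*-monoˡ-≤ r (length-datum R)) (≤-reflexive (*-identityˡ r)))

  -- Every member of `keep R` contains `b`, whereas `b` differs from `x` and `u` and is not in `Z`,
  -- so it is not in `R`.
  keep-irreflexive : ∀ {R} → R ∉ᴸ keep R
  keep-irreflexive {R} R∈ with ∈-keep⁻ R∈
  ... | Z , b , x , u , y , (_ , b∉Z , x∉ , u∉ , R≡ , _) , eq =
    ∉-insert (∉-insert b∉Z (λ where refl → x∉ (∈-insertʳ Z b)))
             (λ where refl → u∉ (∈-insertˡ (∈-insertʳ Z b)))
             (subst (b ∈_) R≡ (subst (b ∈_) (sym eq) (∈-insertʳ (R - y) b)))

  𝓡 : List (Subset m)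
  𝓡 = filter deletable? T

  𝓡⊆T : ∀ {R} → R ∈ᴸ 𝓡 → R ∈ᴸ T
  𝓡⊆T R∈ = proj₁ (∈-filter⁻ deletable? {xs = T} R∈)

  abstract
    -- The conflict digraph: deleting `R` relies on the edges in `keep R`, at most one for each of
    -- the `r` vertices of `R`. An independent set can be deleted all at once.
    independent-𝓡 : ∃ (Independent _≟ˢ_ keep r 𝓡)
    independent-𝓡 = independent _≟ˢ_ keep r (length 𝓡) 𝓡 ≤-refl (Uniqueₚ.filter⁺ deletable? uT)
      (length-keep ∘ 𝓡⊆T) (λ _ → keep-irreflexive)

  I : List (Subset m)
  I = proj₁ independent-𝓡

  I⊆𝓡 : ∀ {R} → R ∈ᴸ I → R ∈ᴸ 𝓡
  I⊆𝓡 = proj₁ (proj₂ (proj₂ independent-𝓡))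

  I-independent : ∀ {R R′} → R ∈ᴸ I → R′ ∈ᴸ I → R′ ∉ᴸ keep R
  I-independent = proj₁ (proj₂ (proj₂ (proj₂ independent-𝓡)))

  ∈I? : Decidable (_∈ᴸ I)
  ∈I? R = ∈ᴸ? _≟ˢ_ R I

  T′ : List (Subset m)
  T′ = filter (¬? ∘ ∈I?) T

  ∣I∣+∣T′∣≤∣T∣ : length I + length T′ ≤ length T
  ∣I∣+∣T′∣≤∣T∣ = ≤-trans
    (+-monoˡ-≤ (length T′) (length-mono (proj₁ (proj₂ independent-𝓡)) (λ R∈ → ∈-filter⁺ ∈I? (𝓡⊆T (I⊆𝓡 R∈)) R∈)))
    (≤-reflexive (#-filters ∈I? T))

  lost : Subset m → List (Subset m × Fin m)
  lost R = map (λ (Z , _ , x , _) → Z , x) (datum R)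

  𝓔 : List (Subset m × Fin m)
  𝓔 = concatMap lost I

  length-𝓔 : length 𝓔 ≤ length I
  length-𝓔 = ≤-trans
    (length-concatMap≤ lost I {1} (λ {R} _ → ≤-trans (≤-reflexive (length-map _ (datum R))) (length-datum R)))
    (≤-reflexive (*-identityʳ (length I)))

  key-𝓔 : ∀ {p} → p ∈ᴸ 𝓔 → proj₁ p ∈ᴸ 𝓩
  key-𝓔 p∈ with find (∈-concatMap⁻ lost {xs = I} p∈)
  ... | R , _ , q with ∈-map⁻ _ q
  ...   | d , d∈ , refl = proj₁ (datum-deletable d∈)

  -- If `P` lies in a deleted `R` and avoids `u`, it is inside the lost set `Z ∪ ⁅ x ⁆`. If it
  -- contains `u`, it misses some `y` of `Z ∪ ⁅ x ⁆` and lies in `(R - y) ∪ ⁅ b ⁆`, which survives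
  -- because it belongs to `keep R`.
  cover′ : ∀ P → ∣ P ∣ ≡ suc i → (∃ λ e → e ∈ᴸ T′ × ∣ e ∣ ≡ suc (suc i) × P ⊆ e) ⊎
                                 (∃ λ p → p ∈ᴸ 𝓔 × P ⊆ proj₁ p ∪ ⁅ proj₂ p ⁆)
  cover′ P P≡ with cover P P≡
  ... | R , R∈T , P⊆R with ∈I? R
  ...   | no  R∉I = inj₁ (R , ∈-filter⁺ (¬? ∘ ∈I?) R∈T R∉I , ∣T∣ R∈T , P⊆R)
  ...   | yes R∈I with ∃-datum {R} (proj₂ (proj₂ (proj₂ (proj₂ (proj₂ (∈-filter⁻ deletable? {xs = T} (I⊆𝓡 R∈I)))))))
  ...     | d@(Z , b , x , u) , d∈ with datum-deletable d∈ | u ∈? P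
  ...       | Z∈ , b∉Z , x∉Zb , u∉ , R≡ , jn | no u∉P = inj₂ ((Z , x) , ∈-concatMap R∈I (∈-map⁺ _ d∈) , P⊆Zx)
    where
    P⊆Zx : P ⊆ Z ∪ ⁅ x ⁆
    P⊆Zx {z} z∈ with ∈-insert⁻ (Z ∪ ⁅ x ⁆) (subst (z ∈_) R≡ (P⊆R z∈))
    ... | inj₁ q    = q
    ... | inj₂ refl = ⊥-elim (u∉P z∈)
  ...       | Z∈ , b∉Z , x∉Zb , u∉ , R≡ , jn | yes u∈P =
    inj₁ (R′ , ∈-filter⁺ (¬? ∘ ∈I?) R′∈T (λ R′∈I → I-independent R∈I R′∈I (∈-keep⁺ d∈ y∈R)) , ∣T∣ R′∈T ,
      λ z∈ → ∈-insertˡ (x∈p∧x≢y⇒x∈p-y (P⊆R z∈) (λ where refl → y∉P z∈)))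
    where
    missed = ∃∈∉ P R (≤-reflexive (trans (cong suc P≡) (sym (∣T∣ R∈T))))
    y = proj₁ missed
    y∈R = proj₁ (proj₂ missed)
    y∉P = proj₂ (proj₂ missed)
    y≢u : y ≢ u
    y≢u eq = y∉P (subst (_∈ P) (sym eq) u∈P)
    K = (Z ∪ ⁅ b ⁆) ∪ ⁅ x ⁆
    y∈Zx : y ∈ Z ∪ ⁅ x ⁆
    y∈Zx with ∈-insert⁻ (Z ∪ ⁅ x ⁆) (subst (y ∈_) R≡ y∈R)
    ... | inj₁ q = q
    ... | inj₂ q = ⊥-elim (y≢u q)
    b≢x : b ≢ x
    b≢x refl = x∉Zb (∈-insertʳ Z b)
    b∉Zx : b ∉ Z ∪ ⁅ x ⁆
    b∉Zx = ∉-insert b∉Z b≢x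
    Zx⊆K : Z ∪ ⁅ x ⁆ ⊆ K
    Zx⊆K = insert-⊆ (∈-insertˡ ∘ ∈-insertˡ) (∈-insertʳ (Z ∪ ⁅ b ⁆) x)
    -- The part of `R′` other than `u`. It is a subset of `K`, which is joined to `u`, and so `R′`
    -- is an edge of `T`.
    Q = ((Z ∪ ⁅ x ⁆) - y) ∪ ⁅ b ⁆
    Q⊆K : Q ⊆ K
    Q⊆K = insert-⊆ (Zx⊆K ∘ proj₁ ∘ ∈-remove⁻ (Z ∪ ⁅ x ⁆)) (∈-insertˡ (∈-insertʳ Z b))
    ∣Q∣ : ∣ Q ∣ ≡ 1 + i
    ∣Q∣ = trans (∣A∪⁅u⁆∣ ((Z ∪ ⁅ x ⁆) - y) b (b∉Zx ∘ proj₁ ∘ ∈-remove⁻ (Z ∪ ⁅ x ⁆)))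
      (trans (∣remove∣ y∈Zx) (trans (∣A∪⁅u⁆∣ Z x (x∉Zb ∘ ∈-insertˡ)) (cong suc (∣𝓩∣ Z∈))))
    R′ = (R - y) ∪ ⁅ b ⁆
    R′≡ : Q ∪ ⁅ u ⁆ ≡ R′
    R′≡ = ⊆-antisym
      (insert-⊆ (insert-⊆ (λ z∈ → let (p , q) = ∈-remove⁻ (Z ∪ ⁅ x ⁆) z∈ in
                             ∈-insertˡ (x∈p∧x≢y⇒x∈p-y (subst (_ ∈_) (sym R≡) (∈-insertˡ p)) q))
                          (∈-insertʳ (R - y) b))
                (∈-insertˡ (x∈p∧x≢y⇒x∈p-y (P⊆R u∈P) (y≢u ∘ sym))))
      (insert-⊆ back (∈-insertˡ (∈-insertʳ ((Z ∪ ⁅ x ⁆) - y) b)))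
      where
      back : R - y ⊆ Q ∪ ⁅ u ⁆
      back {z} z∈ with ∈-remove⁻ R z∈
      ... | z∈R , z≢y with ∈-insert⁻ (Z ∪ ⁅ x ⁆) (subst (z ∈_) R≡ z∈R)
      ...   | inj₁ q    = ∈-insertˡ (∈-insertˡ (x∈p∧x≢y⇒x∈p-y q z≢y))
      ...   | inj₂ refl = ∈-insertʳ Q u
    R′∈T : R′ ∈ᴸ T
    R′∈T = subst (_∈ᴸ T) R′≡ (jn Q Q⊆K ∣Q∣)

  -- A deleted edge causes at most one lost pair, which costs half an edge to repair, so half an
  -- edge is gained; the odd pairs cost at most half an edge for each member of `𝓩`.
  saved : 2 * D m r + length I ≤ 2 * length T + length 𝓩
  saved = arith (D m r) (length I) (length T) (length T′) (length 𝓩) (length 𝓔)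
    (D≤-recover r≤m T′ 𝓩 𝓔 ∣𝓩∣ key-𝓔 cover′) length-𝓔 ∣I∣+∣T′∣≤∣T∣
    where
    arith : ∀ d i t t′ z e → 2 * d ≤ 2 * t′ + (e + z) → e ≤ i → i + t′ ≤ t → 2 * d + i ≤ 2 * t + z
    arith d i t t′ z e h₁ h₂ h₃ = ≤-certificate _ _ 0
      (+-mono-≤ h₁ (+-mono-≤ h₂ (*-monoʳ-≤ 2 h₃))) (eq d i t t′ z e)
      where
      eq : ∀ d i t t′ z e → 2 * d + i + (2 * t′ + (e + z) + (i + 2 * t)) + 0 ≡
                            2 * t + z + (2 * d + (e + 2 * (i + t′)))
      eq = solve-∀

  -- The pairs for which `joined` applies to `(Z ∪ ⁅ b ⁆) ∪ ⁅ x ⁆`, a set of size `r`; each of them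
  -- leads to a deletable edge.
  Admissible : Subset m × Fin m → Set
  Admissible (Z , x) = ∃ λ b → b ∉ Z × Z ∪ ⁅ b ⁆ ∈ᴸ 𝓑 × x ∉ Z ∪ ⁅ b ⁆

  admissible? : Decidable Admissible
  admissible? (Z , x) = any? λ b → ¬? (b ∈? Z) ×-dec ∈ᴸ? _≟ˢ_ (Z ∪ ⁅ b ⁆) 𝓑 ×-dec ¬? (x ∈? Z ∪ ⁅ b ⁆)

  pairs : List (Subset m × Fin m)
  pairs = filter admissible? (cartesianProduct 𝓩 (allFin m))

  pairs-unique : Unique pairs
  pairs-unique = Uniqueₚ.filter⁺ admissible?
    (Uniqueₚ.cartesianProduct⁺ (Uniqueₚ.filter⁺ shadow? (unique (complete m i))) (Uniqueₚ.allFin⁺ m))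

  pairsWithin : Subset m → List (Subset m × Fin m)
  pairsWithin R = concatMap (λ Z → map (Z ,_) (elems R)) (subsetsOf R)

  length-pairsWithin : ∀ {R} → R ∈ᴸ T → length (pairsWithin R) ≤ 2 ^ r * r
  length-pairsWithin {R} R∈ = ≤-trans
    (length-concatMap≤ (λ Z → map (Z ,_) (elems R)) (subsetsOf R) {r}
      (λ {Z} _ → ≤-reflexive (trans (length-map (Z ,_) (elems R)) (trans (length-elems R) (∣T∣ R∈)))))
    (≤-reflexive (cong (_* r) (trans (length-subsetsOf R) (cong (2 ^_) (∣T∣ R∈)))))

  -- The deletable edge found for `(Z , x)` contains both `Z` and `x`, and an `r`-set leaves `2 ^ r`
  -- choices for `Z` and `r` for `x`.
  length-pairs : length pairs ≤ length 𝓡 * (2 ^ r * r)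
  length-pairs = length-fibres pairsWithin pairs-unique fibre (λ R∈ → length-pairsWithin (𝓡⊆T R∈))
    where
    fibre : ∀ {p} → p ∈ᴸ pairs → ∃ λ R → R ∈ᴸ 𝓡 × p ∈ᴸ pairsWithin R
    fibre {Z , x} p∈ with ∈-filter⁻ admissible? {xs = cartesianProduct 𝓩 (allFin m)} p∈
    ... | p∈× , b , b∉Z , B∈ , x∉ with joined B∈ ((Z ∪ ⁅ b ⁆) ∪ ⁅ x ⁆) ∈-insertˡ
                                      (trans (∣A∪⁅u⁆∣ (Z ∪ ⁅ b ⁆) x x∉) (cong suc (∣𝓑∣ B∈)))
    ...   | u , u∉ , jn = R , ∈-filter⁺ deletable? R∈T (Z , b , x , u , Z∈ , b∉Z , x∉ , u∉ , refl , jn) ,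
            ∈-concatMap {h = λ Z → map (Z ,_) (elems R)} {xs = subsetsOf R} {x = Z}
              (∈-subsetsOf {A = Z} {B = R} (λ z∈ → ∈-insertˡ (∈-insertˡ z∈)))
              (∈-map⁺ (Z ,_) (∈-elems⁺ {A = R} (∈-insertˡ (∈-insertʳ Z x))))
      where
      Z∈ = proj₁ (∈-cartesianProduct⁻ 𝓩 (allFin m) p∈×)
      R = (Z ∪ ⁅ x ⁆) ∪ ⁅ u ⁆
      R∈T : R ∈ᴸ T
      R∈T = jn (Z ∪ ⁅ x ⁆) (insert-⊆ (∈-insertˡ ∘ ∈-insertˡ) (∈-insertʳ (Z ∪ ⁅ b ⁆) x))
        (trans (∣A∪⁅u⁆∣ Z x (x∉ ∘ ∈-insertˡ)) (cong suc (∣𝓩∣ Z∈)))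

  -- Once `b` is fixed for `Z`, only the `1 + i` elements of `Z ∪ ⁅ b ⁆` are excluded as values of
  -- `x`.
  many-pairs : length 𝓩 * m ≤ length pairs + length 𝓩 * (1 + i)
  many-pairs = begin
    length 𝓩 * m            ≡⟨ ∑-const 𝓩 m ⟨
    ∑[ _ ∈ 𝓩 ] m            ≤⟨ ∑-mono 𝓩 star ⟩
    ∑[ Z ∈ 𝓩 ] (# (admissible? ∘ (Z ,_)) (allFin m) + (1 + i)) ≡⟨ ∑-distrib-+ 𝓩 _ _ ⟩
    (∑[ Z ∈ 𝓩 ] # (admissible? ∘ (Z ,_)) (allFin m)) + ∑[ _ ∈ 𝓩 ] (1 + i)
      ≡⟨ cong₂ _+_ (sym (∑-cartesianProduct 𝓩 (allFin m) _)) (∑-const 𝓩 (1 + i)) ⟩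
    # admissible? (cartesianProduct 𝓩 (allFin m)) + length 𝓩 * (1 + i)
      ≡⟨ cong (_+ length 𝓩 * (1 + i)) (#≡length-filter admissible? (cartesianProduct 𝓩 (allFin m))) ⟩
    length pairs + length 𝓩 * (1 + i) ∎
    where
    open ≤-Reasoning
    star : ∀ {Z} → Z ∈ᴸ 𝓩 → m ≤ # (admissible? ∘ (Z ,_)) (allFin m) + (1 + i)
    star {Z} Z∈ with proj₂ (∈-filter⁻ shadow? {xs = sets m i} Z∈)
    ... | b , b∉Z , B∈ = begin
      m                 ≡⟨ length-allFin m ⟨
      length (allFin m) ≤⟨ length-mono (Uniqueₚ.allFin⁺ m) inside-or-admissible ⟩
      length (filter adm? (allFin m) ++ elems (Z ∪ ⁅ b ⁆)) ≡⟨ length-++ (filter adm? (allFin m)) ⟩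
      length (filter adm? (allFin m)) + length (elems (Z ∪ ⁅ b ⁆))
        ≡⟨ cong₂ _+_ (sym (#≡length-filter adm? (allFin m))) (trans (length-elems (Z ∪ ⁅ b ⁆)) (∣𝓑∣ B∈)) ⟩
      # adm? (allFin m) + (1 + i) ∎
      where
      adm? = admissible? ∘ (Z ,_)
      inside-or-admissible : ∀ {x} → x ∈ᴸ allFin m → x ∈ᴸ filter adm? (allFin m) ++ elems (Z ∪ ⁅ b ⁆)
      inside-or-admissible {x} x∈ with x ∈? Z ∪ ⁅ b ⁆
      ... | yes p = ∈-++⁺ʳ (filter adm? (allFin m)) (∈-elems⁺ p)
      ... | no ¬p = ∈-++⁺ˡ (∈-filter⁺ adm? x∈ (b , b∉Z , B∈ , ¬p))

  q : ℕ
  q = overcount i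

  -- Nearly `length 𝓩 * m` pairs yield deletable edges and these yield members of `I`, with a total
  -- loss of a factor below `q`. The assumption on `m` absorbs the terms of order `length 𝓩`.
  D+shadow≤ : 2 * (1 + i + q) ≤ m → 4 * q * D m r + length 𝓩 * m ≤ 4 * q * length T
  D+shadow≤ m-large = subst (λ q → 4 * q * D m r + length 𝓩 * m ≤ 4 * q * length T) (sym (overcount≡ i)) (arith (D m r) (length I) (length T) (length 𝓩) (length 𝓡) (length pairs) m i (2 ^ r * r) (suc (r + r))
    (subst (λ q → 2 * (1 + i + q) ≤ m) (overcount≡ i) m-large)
    saved many-pairs length-pairs (proj₂ (proj₂ (proj₂ (proj₂ independent-𝓡)))))
    where
    arith : ∀ d I t z R p m i a c → 2 * (1 + i + suc (a * c)) ≤ m → 2 * d + I ≤ 2 * t + z →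
            z * m ≤ p + z * (1 + i) → p ≤ R * a → R ≤ c * I →
            4 * suc (a * c) * d + z * m ≤ 4 * suc (a * c) * t
    arith d I t z R p m i a c h₀ h₁ h₂ h₃ h₄ = ≤-certificate _ _ (2 * I)
      (+-mono-≤ (*-monoʳ-≤ z h₀) (+-mono-≤ (*-monoʳ-≤ (2 * suc (a * c)) h₁)
        (+-mono-≤ (*-monoʳ-≤ 2 h₂) (+-mono-≤ (*-monoʳ-≤ 2 h₃) (*-monoʳ-≤ (2 * a) h₄)))))
      (eq d I t z R p m i a c)
      where
      eq : ∀ d I t z R p m i a c →
        4 * suc (a * c) * d + z * m + (z * m + (2 * suc (a * c) * (2 * t + z) + (2 * (p + z * (1 + i)) + (2 * (R * a) + 2 * a * (c * I))))) + 2 * I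
        ≡ 4 * suc (a * c) * t + (z * (2 * (1 + i + suc (a * c))) + (2 * suc (a * c) * (2 * d + I) + (2 * (z * m) + (2 * p + 2 * a * R))))
      eq = solve-∀

  -- Bounds the number of `i`-tuples that span a given `i`-set; the successor makes it visibly
  -- nonzero.
  κ : ℕ
  κ = suc (i ^ i)

  -- The weak Kruskal-Katona bound for the tuples spanning members of `𝓩`, as all `i`-subsets of a
  -- member of `𝓑` belong to `𝓩`. If these tuples are too dense for that bound, the smallness of `𝓑`
  -- gives the inequality directly.
  shadow-large : ∀ M → length 𝓑 * (M * (2 * M ^ i)) ≤ m ^ (1 + i) → length 𝓑 * M ≤ m * (length 𝓩 * κ)
  shadow-large M small = ≤-trans bound (*-monoʳ-≤ m #E≤)
    where
    E? : Decidable (λ (v : Vec (Fin m) i) → set v ∈ᴸ 𝓩)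
    E? v = ∈ᴸ? _≟ˢ_ (set v) 𝓩
    #E = # E? (tuples m i)
    #E≤ : #E ≤ length 𝓩 * κ
    #E≤ = ≤-trans (#tuples≤ E? 𝓩 (λ _ p → p) ∣𝓩∣) (*-monoʳ-≤ (length 𝓩) (n≤1+n (i ^ i)))
    omitted : ∀ {B} → B ∈ᴸ 𝓑 → ∣ B ∣ ≡ suc i × (∀ v → set v ≡ B → Omits (λ v → set v ∈ᴸ 𝓩) v)
    omitted {B} B∈ = ∣𝓑∣ B∈ , λ v eq → omits⁺ v (λ p →
      let ∣v∣ = trans (cong ∣_∣ eq) (∣𝓑∣ B∈)
          A = set (removeAt v p)
          ∣A∣ = ∣set-removeAt∣ v p ∣v∣
      in ∈-filter⁺ shadow? (∈-sets⁺ ∣A∣)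
        (lookup v p ,
         (λ l∈ → 1+n≢n (trans (sym ∣v∣) (trans (cong ∣_∣ (trans (set-removeAt v p) (⊆-antisym (insert-⊆ ⊆-refl l∈) ∈-insertˡ))) ∣A∣))) ,
         subst (_∈ᴸ 𝓑) (trans (sym eq) (set-removeAt v p)) B∈))
    ∣𝓑∣≤# : length 𝓑 ≤ # (omits? E?) (tuples m (suc i))
    ∣𝓑∣≤# = length-sets≤# (omits? E?) u𝓑 omitted
    bound : length 𝓑 * M ≤ m * #E
    bound with #E * (2 * M ^ i) ≤? m ^ i
    ... | yes sparse = ≤-trans (*-monoˡ-≤ M ∣𝓑∣≤#) (#-omits m i M E? sparse)
    ... | no  dense  = *-cancelʳ-≤ _ _ (2 * M ^ i) ⦃ >-nonZero (pos (2 * M ^ i) dense) ⦄ (begin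
      length 𝓑 * M * (2 * M ^ i)   ≡⟨ *-assoc (length 𝓑) M (2 * M ^ i) ⟩
      length 𝓑 * (M * (2 * M ^ i)) ≤⟨ small ⟩
      m * m ^ i                     ≤⟨ *-monoʳ-≤ m (<⇒≤ (≰⇒> dense)) ⟩
      m * (#E * (2 * M ^ i))        ≡⟨ *-assoc m #E (2 * M ^ i) ⟨
      m * #E * (2 * M ^ i)          ∎)
      where
      open ≤-Reasoning
      pos : ∀ a → ¬ (#E * a ≤ m ^ i) → 0 < a
      pos zero    h = ⊥-elim (h (≤-trans (≤-reflexive (*-zeroʳ #E)) z≤n))
      pos (suc a) _ = s≤s z≤n

  -- The factor `4 * q * κ` of `M` is what `D+shadow≤` and `shadow-large` lose; the factor `suc c`
  -- remains as the gain for each member of `𝓑`.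
  savings : ∀ c → 2 * (1 + i + q) ≤ m →
    let M = 4 * q * κ * suc c in length 𝓑 * (M * (2 * M ^ i)) ≤ m ^ (1 + i) →
    D m r + suc c * length 𝓑 ≤ length T
  savings c m-large small = *-cancelˡ-≤ (4 * q * κ) ⦃ m*n≢0 (4 * q) κ ⦃ m*n≢0 4 q ⦄ ⦄ (arith (D m r) (length T) (length 𝓩) (length 𝓑) m q κ c
    (D+shadow≤ m-large) (shadow-large (4 * q * κ * suc c) small))
    where
    arith : ∀ d t z b m q k c → 4 * q * d + z * m ≤ 4 * q * t → b * (4 * q * k * suc c) ≤ m * (z * k) →
            4 * q * k * (d + suc c * b) ≤ 4 * q * k * t
    arith d t z b m q k c h₁ h₂ = ≤-certificate _ _ 0 (+-mono-≤ (*-monoʳ-≤ k h₁) h₂) (eq d t z b m q k c)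
      where
      eq : ∀ d t z b m q k c → 4 * q * k * (d + suc c * b) + (k * (4 * q * t) + m * (z * k)) + 0 ≡
                               4 * q * k * t + (k * (4 * q * d + z * m) + b * (4 * q * k * suc c))
      eq = solve-∀

-- Splitting the vertices into a head of size `s` and a tail of size `m`; crude bounds.

module HeadAndTail where

  private variable
    n m i j k r s : ℕ
    A B : Subset n
    x y u : Fin n

  ι : ∀ s → Subset m → Subset (s + m)
  ι zero    B = B
  ι (suc s) B = outside ∷ ι s B

  tl : ∀ s → Subset (s + m) → Subset m
  tl zero    e       = e
  tl (suc s) (_ ∷ e) = tl s e

  headSet : ∀ s → Subset (s + m)
  headSet zero    = ⊥
  headSet (suc s) = inside ∷ headSet s

  ∣ι∣ : ∀ s (B : Subset m) → ∣ ι s B ∣ ≡ ∣ B ∣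
  ∣ι∣ zero    B = refl
  ∣ι∣ (suc s) B = ∣ι∣ s B

  tl-ι : ∀ s (B : Subset m) → tl s (ι s B) ≡ B
  tl-ι zero    B = refl
  tl-ι (suc s) B = tl-ι s B

  ∣headSet∣ : ∀ s → ∣ headSet {m} s ∣ ≡ s
  ∣headSet∣ {m} zero = ∣⊥∣≡0 m
  ∣headSet∣ (suc s) = cong suc (∣headSet∣ s)

  ∈-headSet⁺ : ∀ s {x : Fin (s + m)} → toℕ x < s → x ∈ headSet s
  ∈-headSet⁺ (suc s) {zero}  _       = here
  ∈-headSet⁺ (suc s) {suc x} (s≤s h) = there (∈-headSet⁺ s h)

  ∈-headSet⁻ : ∀ s {x : Fin (s + m)} → x ∈ headSet s → toℕ x < s
  ∈-headSet⁻ zero    x∈         = ⊥-elim (∉⊥ x∈)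
  ∈-headSet⁻ (suc s) here       = s≤s z≤n
  ∈-headSet⁻ (suc s) (there x∈) = s≤s (∈-headSet⁻ s x∈)

  ∈-ι⁺ : ∀ s {B : Subset m} {x} → x ∈ B → s ↑ʳ x ∈ ι s B
  ∈-ι⁺ zero    x∈ = x∈
  ∈-ι⁺ (suc s) x∈ = there (∈-ι⁺ s x∈)

  ∈-ι⁻ : ∀ s {B : Subset m} {x} → s ↑ʳ x ∈ ι s B → x ∈ B
  ∈-ι⁻ zero    x∈         = x∈
  ∈-ι⁻ (suc s) (there x∈) = ∈-ι⁻ s x∈

  ∈-ι⇒≥ : ∀ s {B : Subset m} {x} → x ∈ ι s B → s ≤ toℕ x
  ∈-ι⇒≥ zero    _          = z≤n
  ∈-ι⇒≥ (suc s) (there x∈) = s≤s (∈-ι⇒≥ s x∈)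

  ι-tl : ∀ s (e : Subset (s + m)) → (∀ x → x ∈ e → s ≤ toℕ x) → ι s (tl s e) ≡ e
  ι-tl zero    e             h = refl
  ι-tl (suc s) (inside  ∷ e) h = case h zero here of λ ()
  ι-tl (suc s) (outside ∷ e) h = cong (outside ∷_) (ι-tl s e (λ x x∈ → ≤-pred (h (suc x) (there x∈))))

  tl-mono : ∀ s {A B : Subset (s + m)} → A ⊆ B → tl s A ⊆ tl s B
  tl-mono zero    A⊆B = A⊆B
  tl-mono (suc s) {_ ∷ _} {_ ∷ _} A⊆B = tl-mono s (drop-∷-⊆ A⊆B)

  ι-mono : ∀ s {A B : Subset m} → A ⊆ B → ι s A ⊆ ι s B
  ι-mono zero    A⊆B = A⊆B
  ι-mono (suc s) A⊆B (there x∈) = there (ι-mono s A⊆B x∈)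

  ι-∪ : ∀ s (A : Subset m) u → ι s (A ∪ ⁅ u ⁆) ≡ ι s A ∪ ⁅ s ↑ʳ u ⁆
  ι-∪ zero    A u = refl
  ι-∪ (suc s) A u = cong (outside ∷_) (ι-∪ s A u)

  ι-injective : ∀ s {A B : Subset m} → ι s A ≡ ι s B → A ≡ B
  ι-injective s {A} {B} eq = trans (sym (tl-ι s A)) (trans (cong (tl s) eq) (tl-ι s B))

  head-or-tail : ∀ s (x : Fin (s + m)) → toℕ x < s ⊎ ∃ λ y → x ≡ s ↑ʳ y
  head-or-tail zero    x       = inj₂ (x , refl)
  head-or-tail (suc s) zero    = inj₁ (s≤s z≤n)
  head-or-tail (suc s) (suc x) with head-or-tail s x
  ... | inj₁ h          = inj₁ (s≤s h)
  ... | inj₂ (y , refl) = inj₂ (y , refl)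

  ∣tl∣≤ : ∀ s (e : Subset (s + m)) → ∣ tl s e ∣ ≤ ∣ e ∣
  ∣tl∣≤ zero    e       = ≤-refl
  ∣tl∣≤ (suc s) (b ∷ e) = ≤-trans (∣tl∣≤ s e) (∣p∣≤∣x∷p∣ b e)

  ∣tl∣< : ∀ s (e : Subset (s + m)) {x} → x ∈ e → toℕ x < s → ∣ tl s e ∣ < ∣ e ∣
  ∣tl∣< (suc s) (inside ∷ e) here       _       = s≤s (∣tl∣≤ s e)
  ∣tl∣< (suc s) (b ∷ e)      (there x∈) (s≤s h) = <-≤-trans (∣tl∣< s e x∈ h) (∣p∣≤∣x∷p∣ b e)

  tl∪headSet-⊇ : ∀ s (e : Subset (s + m)) → e ⊆ ι s (tl s e) ∪ headSet s
  tl∪headSet-⊇ zero    e            x∈         = p⊆p∪q ⊥ x∈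
  tl∪headSet-⊇ (suc s) (_ ∷ e)      here       = here
  tl∪headSet-⊇ (suc s) (_ ∷ e)      (there x∈) = there (tl∪headSet-⊇ s e x∈)

  prepends : ∀ s → Subset m → List (Subset (s + m))
  prepends zero    C = [ C ]
  prepends (suc s) C = map (inside ∷_) (prepends s C) ++ map (outside ∷_) (prepends s C)

  length-prepends : ∀ s (C : Subset m) → length (prepends s C) ≡ 2 ^ s
  length-prepends zero    C = refl
  length-prepends (suc s) C = trans (length-++ (map (inside ∷_) (prepends s C)))
    (cong₂ _+_ (trans (length-map _ (prepends s C)) (length-prepends s C))
      (trans (length-map _ (prepends s C)) (trans (length-prepends s C) (sym (+-identityʳ _)))))

  ∈-prepends : ∀ s (e : Subset (s + m)) → e ∈ᴸ prepends s (tl s e)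
  ∈-prepends zero    e             = here refl
  ∈-prepends (suc s) (inside  ∷ e) = ∈-++⁺ˡ (∈-map⁺ _ (∈-prepends s e))
  ∈-prepends (suc s) (outside ∷ e) = ∈-++⁺ʳ (map (inside ∷_) (prepends s (tl s e))) (∈-map⁺ _ (∈-prepends s e))

  side : ∀ {P : Set} → Dec P → Side
  side (yes _) = inside
  side (no  _) = outside

  ⟪_⟫ : ∀ {P : Fin n → Set} → Decidable P → Subset n
  ⟪_⟫ {zero}  P? = []
  ⟪_⟫ {suc n} P? = side (P? zero) ∷ ⟪ (λ x → P? (suc x)) ⟫

  ∈-⟪⟫⁺ : ∀ {P : Fin n → Set} (P? : Decidable P) {x} → P x → x ∈ ⟪ P? ⟫
  ∈-⟪⟫⁺ P? {zero} p with P? zero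
  ... | yes _ = here
  ... | no ¬p = ⊥-elim (¬p p)
  ∈-⟪⟫⁺ P? {suc x} p = there (∈-⟪⟫⁺ (λ x → P? (suc x)) p)

  ∈-⟪⟫⁻ : ∀ {P : Fin n → Set} (P? : Decidable P) {x} → x ∈ ⟪ P? ⟫ → P x
  ∈-⟪⟫⁻ P? {zero} x∈ with P? zero
  ∈-⟪⟫⁻ P? {zero} here | yes p = p
  ∈-⟪⟫⁻ P? {suc x} (there x∈) = ∈-⟪⟫⁻ (λ x → P? (suc x)) x∈

  insertAll : List (Fin n) → Subset n → Subset n
  insertAll []       A = A
  insertAll (x ∷ xs) A = insertAll xs A ∪ ⁅ x ⁆

  ∣insertAll∣≤ : ∀ xs (A : Subset n) → ∣ insertAll xs A ∣ ≤ length xs + ∣ A ∣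
  ∣insertAll∣≤ []       A = ≤-refl
  ∣insertAll∣≤ (x ∷ xs) A = ≤-trans (∣insert∣≤ (insertAll xs A) x) (s≤s (∣insertAll∣≤ xs A))

  ⊆-insertAll : ∀ xs (A : Subset n) → A ⊆ insertAll xs A
  ⊆-insertAll []       A x∈ = x∈
  ⊆-insertAll (_ ∷ xs) A x∈ = ∈-insertˡ (⊆-insertAll xs A x∈)

  ∈-insertAll : ∀ {xs} {A : Subset n} {x} → x ∈ᴸ xs → x ∈ insertAll xs A
  ∈-insertAll {xs = y ∷ xs} {A} (here refl) = ∈-insertʳ (insertAll xs A) y
  ∈-insertAll (there x∈)   = ∈-insertˡ (∈-insertAll x∈)

  Apart : Subset n → Subset n → Set
  Apart L B = ∀ x → x ∈ B → x ∉ L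

  apart? : ∀ (L : Subset n) → Decidable (Apart L)
  apart? L B = all? λ x → (x ∈? B) →-dec ¬? (x ∈? L)

  ¬apart⇒meet : ∀ (L B : Subset n) → ¬ Apart L B → ∃ λ x → x ∈ B × x ∈ L
  ¬apart⇒meet L B ¬ap with any? (λ x → (x ∈? B) ×-dec (x ∈? L))
  ... | yes p = p
  ... | no ¬p = ⊥-elim (¬ap (λ x x∈B x∈L → ¬p (x , x∈B , x∈L)))

  elems-unique : ∀ (A : Subset n) → Unique (elems A)
  elems-unique []            = []
  elems-unique (inside  ∷ A) = All.tabulate (λ x∈ eq → case subst (_∈ᴸ map suc (elems A)) (sym eq) x∈ of λ p → case ∈-map⁻ suc p of λ ())
    ∷ Uniqueₚ.map⁺ sucᶠ-injective (elems-unique A)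
  elems-unique (outside ∷ A) = Uniqueₚ.map⁺ sucᶠ-injective (elems-unique A)

  ∣A∣≤#∈ : ∀ (A : Subset n) → ∣ A ∣ ≤ # (_∈? A) (allFin n)
  ∣A∣≤#∈ {n} A = ≤-trans (≤-reflexive (sym (length-elems A)))
    (length≤# (_∈? A) (elems-unique A) (λ x∈ → ∈-elems⁻ x∈ , ∈-allFin _))

  #∈≤∣A∣ : ∀ (A : Subset n) → # (_∈? A) (allFin n) ≤ ∣ A ∣
  #∈≤∣A∣ {n} A = ≤-trans (#≤length⁺ (_∈? A) (Uniqueₚ.allFin⁺ n) (λ _ p → ∈-elems⁺ p)) (≤-reflexive (length-elems A))

  length-injective : ∀ {X Y : Set} {xs : List X} {ys : List Y} (g : X → Y) → Unique xs →
    (∀ {x} → x ∈ᴸ xs → g x ∈ᴸ ys) → (∀ {x x′} → x ∈ᴸ xs → x′ ∈ᴸ xs → g x ≡ g x′ → x ≡ x′) →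
    length xs ≤ length ys
  length-injective {xs = xs} g u into inj = ≤-trans (≤-reflexive (sym (length-map g xs)))
    (length-mono (map-unique u inj) (λ y∈ → case ∈-map⁻ g y∈ of λ { (x , x∈ , refl) → into x∈ }))
    where
    map-unique : ∀ {xs} → Unique xs → (∀ {x x′} → x ∈ᴸ xs → x′ ∈ᴸ xs → g x ≡ g x′ → x ≡ x′) → Unique (map g xs)
    map-unique [] _ = []
    map-unique {x ∷ xs} (x∉ ∷ u) inj = All.tabulate fresh ∷ map-unique u (λ p q → inj (there p) (there q))
      where
      fresh : ∀ {y} → y ∈ᴸ map g xs → g x ≢ y
      fresh y∈ eq with ∈-map⁻ g y∈
      ... | x′ , x′∈ , refl = All.lookup x∉ x′∈ (inj (here refl) (there x′∈) eq)

  -- Brings arbitrary gaps into the form that `D≤-recover` expects, by splitting some vertex off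
  -- each set.
  keyed : ∀ {m i} (Ps : List (Subset m)) → (∀ {P} → P ∈ᴸ Ps → ∣ P ∣ ≡ suc i) → ∃ λ (𝓔 : List (Subset m × Fin m)) →
          length 𝓔 ≡ length Ps × (∀ {p} → p ∈ᴸ 𝓔 → proj₁ p ∈ᴸ sets m i) ×
          (∀ {P} → P ∈ᴸ Ps → ∃ λ p → p ∈ᴸ 𝓔 × P ⊆ proj₁ p ∪ ⁅ proj₂ p ⁆)
  keyed [] _ = [] , refl , (λ ()) , (λ ())
  keyed {m} {i} (P ∷ Ps) ∣Ps∣ with keyed {m} {i} Ps (∣Ps∣ ∘ there) | ∃∈ P (subst (0 <_) (sym (∣Ps∣ (here refl))) (s≤s z≤n))
  ... | 𝓔 , len , keys , cov | x , x∈P = (P - x , x) ∷ 𝓔 , cong suc len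
    , (λ { (here refl) → ∈-sets⁺ (suc-injective (trans (∣remove∣ x∈P) (∣Ps∣ (here refl)))) ; (there p∈) → keys p∈ })
    , (λ { (here refl) → (P - x , x) , here refl , ⊆-reflexive (sym (remove-insert x∈P))
         ; (there q∈) → let (p , p∈ , h) = cov q∈ in p , there p∈ , λ z∈ → h z∈ })

  C-mono : ∀ n i → n C suc i ≤ suc n C suc i
  C-mono n i = ≤-trans (m≤n+m (n C suc i) (n C i)) (≤-reflexive (nCk+nC[k+1]≡[n+1]C[k+1] n i))

  -- Pascal's rule once for each head vertex. This bounds the number of sets of size `2 + i` that
  -- meet the head.
  C-head : ∀ s m i → (s + m) C (2 + i) ≤ m C (2 + i) + s * ((s + m) C (1 + i))
  C-head zero    m i = m≤m+n _ _
  C-head (suc s) m i = begin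
    suc (s + m) C (2 + i)                               ≡⟨ nCk+nC[k+1]≡[n+1]C[k+1] (s + m) (1 + i) ⟨
    (s + m) C (1 + i) + (s + m) C (2 + i)               ≤⟨ +-mono-≤ (C-mono (s + m) i) (C-head s m i) ⟩
    c′ + (m C (2 + i) + s * ((s + m) C (1 + i)))        ≤⟨ +-monoʳ-≤ c′ (+-monoʳ-≤ (m C (2 + i)) (*-monoʳ-≤ s (C-mono (s + m) i))) ⟩
    c′ + (m C (2 + i) + s * c′)                         ≡⟨ rearrange c′ (m C (2 + i)) s ⟩
    m C (2 + i) + suc s * c′                            ∎
    where
    open ≤-Reasoning
    c′ = suc (s + m) C (1 + i)
    rearrange : ∀ a b s → a + (b + s * a) ≡ b + suc s * a
    rearrange = solve-∀

  -- One edge for each set of size `1 + i` already makes a covering.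
  D≤^ : ∀ m i → 2 + i ≤ m → D m (2 + i) ≤ m ^ (1 + i)
  D≤^ m i r≤m = ≤-trans (D≤ (s≤s z≤n) r≤m (map (fillTo (2 + i)) (sets m (1 + i)))
      (λ P P≡ → fillTo (2 + i) P , ∈-map⁺ (fillTo (2 + i)) {x = P} (∈-sets⁺ {A = P} P≡) ,
        ∣fillTo∣ P (≤-trans (≤-reflexive P≡) (n≤1+n _)) r≤m , ⊆-fillTo (2 + i) P))
    (≤-trans (≤-reflexive (length-map _ (sets m (1 + i)))) (length-sets≤^ m (1 + i)))

  #-removeAt : ∀ n j {P : Vec (Fin n) j → Set} (P? : Decidable P) p →
               # (λ z → P? (removeAt z p)) (tuples n (suc j)) ≡ n * # P? (tuples n j)
  #-removeAt n j P? zero = trans (∑-tuples j _) (trans (∑-const (allFin n) _) (cong (_* # P? (tuples n j)) (length-allFin n)))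
  #-removeAt n (suc j) P? (suc p) = trans (∑-tuples (suc j) _)
    (trans (∑-cong (allFin n) (λ y → trans (∑-cong (tuples n (suc j)) (λ z → cong (𝟙 ∘ P?) (eq y z))) (#-removeAt n j (P? ∘ (y ∷_)) p)))
    (trans (∑-*ˡ (allFin n) _ n) (cong (n *_) (sym (∑-tuples j _)))))
    where
    eq : ∀ y (z : Vec (Fin n) (suc j)) → removeAt (y ∷ z) (suc p) ≡ y ∷ removeAt z p
    eq y (_ ∷ _) = refl

  -- The tuples with a repeated entry or an entry in `L`. For fixed `j` and bounded `L` they are a
  -- proportion of order `1 / n` of all tuples.
  Degenerate : Subset n → Vec (Fin n) j → Set
  Degenerate L []      = ⊥ᵗ
  Degenerate L (y ∷ v) = Degenerate L v ⊎ y ∈ set v ∪ L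

  degenerate? : ∀ (L : Subset n) → Decidable (Degenerate {j = j} L)
  degenerate? L []      = no λ ()
  degenerate? L (y ∷ v) = degenerate? L v ⊎-dec (y ∈? set v ∪ L)

  ¬degenerate⇒ : ∀ (L : Subset n) (v : Vec (Fin n) j) → ¬ Degenerate L v → ∣ set v ∣ ≡ j × Apart L (set v)
  ¬degenerate⇒ {n} L []      _ = ∣⊥∣≡0 n , λ _ x∈ → ⊥-elim (∉⊥ x∈)
  ¬degenerate⇒ L (y ∷ v) ¬d with ¬degenerate⇒ L v (¬d ∘ inj₁)
  ... | v≡ , ap = trans (∣A∪⁅u⁆∣ (set v) y (λ y∈ → ¬d (inj₂ (p⊆p∪q L y∈)))) (cong suc v≡) ,
    λ x x∈ → case ∈-insert⁻ (set v) x∈ of λ where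
      (inj₁ p)    → ap x p
      (inj₂ refl) → λ y∈L → ¬d (inj₂ (q⊆p∪q (set v) L y∈L))

  #-degenerate : ∀ n j (L : Subset n) ℓ → ∣ L ∣ ≤ ℓ → n * # (degenerate? L) (tuples n j) ≤ j * (j + ℓ) * n ^ j
  #-degenerate n zero    L ℓ _   = ≤-reflexive (trans (cong (n *_) (∑-tuples-zero _)) (*-zeroʳ n))
  #-degenerate n (suc j) L ℓ L≤ℓ = begin
    n * # (degenerate? L) (tuples n (suc j)) ≡⟨ cong (n *_) (∑-tuples j _) ⟩
    n * (∑[ y ∈ F ] ∑[ v ∈ V ] 𝟙 (degenerate? L (y ∷ v)))
      ≤⟨ *-monoʳ-≤ n (∑-mono F (λ {y} _ → #-mono-⊎ (λ v → degenerate? L (y ∷ v)) (degenerate? L) (λ v → y ∈? set v ∪ L) V (λ _ p → p))) ⟩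
    n * (∑[ y ∈ F ] (d + ∑[ v ∈ V ] 𝟙 (y ∈? set v ∪ L))) ≡⟨ cong (n *_) (∑-distrib-+ F _ _) ⟩
    n * ((∑[ _ ∈ F ] d) + ∑[ y ∈ F ] ∑[ v ∈ V ] 𝟙 (y ∈? set v ∪ L))
      ≡⟨ cong (n *_) (cong₂ _+_ (trans (∑-const F d) (cong (_* d) (length-allFin n))) (∑-swap F V _)) ⟩
    n * (n * d + ∑[ v ∈ V ] # (_∈? set v ∪ L) F)
      ≤⟨ *-monoʳ-≤ n (+-mono-≤ (#-degenerate n j L ℓ L≤ℓ) (≤-trans (∑≤length* V {c = j + ℓ} (λ {v} _ →
           ≤-trans (#∈≤∣A∣ (set v ∪ L)) (≤-trans (∣p∪q∣≤∣p∣+∣q∣ (set v) L) (+-mono-≤ (∣set∣≤ v) L≤ℓ))))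
           (≤-reflexive (cong (_* (j + ℓ)) (length-tuples n j))))) ⟩
    n * (j * (j + ℓ) * n ^ j + n ^ j * (j + ℓ)) ≤⟨ m≤m+n _ (suc j * (n * n ^ j)) ⟩
    n * (j * (j + ℓ) * n ^ j + n ^ j * (j + ℓ)) + suc j * (n * n ^ j) ≡⟨ rearrange n (n ^ j) j ℓ ⟩
    suc j * (suc j + ℓ) * (n * n ^ j) ∎
    where
    open ≤-Reasoning
    F = allFin n
    V = tuples n j
    d = # (degenerate? L) V
    rearrange : ∀ n p j ℓ → n * (j * (j + ℓ) * p + p * (j + ℓ)) + suc j * (n * p) ≡ suc j * (suc j + ℓ) * (n * p)
    rearrange = solve-∀

  -- A vertex covering the padded set also covers each of its subsets.
  covered-≤ : ∀ {n i k} (H : Hypergraph n (2 + i)) → AllCovered k H → k ≤ n → ∀ A → ∣ A ∣ ≤ k →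
              ∃ λ u → u ∉ A × (∀ Q → Q ⊆ A → ∣ Q ∣ ≡ 1 + i → (Q ∪ ⁅ u ⁆) ∈ᴱ H)
  covered-≤ {k = k} H cov k≤n A A≤ with cov (fillTo k A) (∣fillTo∣ A A≤ k≤n)
  ... | u , u∉ , h = u , (λ u∈ → u∉ (⊆-fillTo k A u∈)) , λ Q Q⊆ → h Q (λ x∈ → ⊆-fillTo k A (Q⊆ x∈))

open HeadAndTail

-- Heavy and light vertices, and the common set of heavy neighbours.

CommonHead : ∀ s i m → Hypergraph (s + m) (2 + i) → ℕ → Set
CommonHead s i m H M = ∃ λ S → ∣ S ∣ ≡ s × ∃ λ 𝓛 → length 𝓛 * M ≤ (s + m) ^ (1 + i) ×
  -- Sets `B` that contain `a` are exceptional too, since `B ∪ ⁅ a ⁆` is then too small to be an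
  -- edge.
  (∀ B → ∣ B ∣ ≡ 1 + i → ∀ a → a ∈ S → ¬ (B ∪ ⁅ a ⁆) ∈ᴱ H → B ∈ᴸ 𝓛)

-- The constants enter as variables with equations, so that the arithmetic treats them as atoms.
-- `M₂` measures how rare the tuples covered by light vertices are, `M₁` is the threshold at which
-- the weak Kruskal-Katona bound holds with `M₂`, `c` bounds the degree sum in units of `n ^ j`, and
-- `ℓ` bounds the size of `L`.
module CommonType (s i m : ℕ) (r≤m : 2 + i ≤ m) (H : Hypergraph (s + m) (2 + i))
  (cov : AllCovered (s + (1 + i)) H)
  (size≤ : size H ≤ ((s + m) C (2 + i) ∸ m C (2 + i)) + D m (2 + i))
  (M₂ M₁ c ℓ : ℕ) (M₁≡ : M₁ ≡ 2 * M₂ ^ (1 + i)) (c≡ : c ≡ suc (suc s * (2 + i) ^ (2 + i)))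
  (ℓ≡ : ℓ ≡ c * M₁ + s)
  where

  n r j : ℕ
  n = s + m
  r = 2 + i
  j = 1 + i

  F : List (Fin n)
  F = allFin n

  m≤n : m ≤ n
  m≤n = m≤n+m m s

  instance
    n≢0 : NonZero n
    n≢0 = >-nonZero (≤-trans (s≤s z≤n) (≤-trans r≤m m≤n))

    n^j≢0 : NonZero (n ^ j)
    n^j≢0 = m^n≢0 n j

  cover-≤ : ∀ A → ∣ A ∣ ≤ s + j → ∃ λ u → u ∉ A × (∀ Q → Q ⊆ A → ∣ Q ∣ ≡ j → (Q ∪ ⁅ u ⁆) ∈ᴱ H)
  cover-≤ = covered-≤ H cov (+-monoʳ-≤ s (≤-trans (n≤1+n j) r≤m))

  edge-size : ∀ {e} → e ∈ᴱ H → ∣ e ∣ ≡ r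
  edge-size e∈ = All.lookup (uniform H) e∈

  size≤^ : size H ≤ suc s * n ^ j
  size≤^ = begin
    size H                      ≤⟨ size≤ ⟩
    (n C r ∸ m C r) + D m r     ≤⟨ +-mono-≤ (m≤n+o⇒m∸n≤o _ _ (C-head s m i)) (≤-trans (D≤^ m i r≤m) (^-monoˡ-≤ j m≤n)) ⟩
    s * (n C j) + n ^ j         ≤⟨ +-monoˡ-≤ (n ^ j) (*-monoʳ-≤ s (≤-trans (≤-reflexive (sym (length-sets n j))) (length-sets≤^ n j))) ⟩
    s * n ^ j + n ^ j           ≡⟨ +-comm (s * n ^ j) (n ^ j) ⟩
    suc s * n ^ j               ∎
    where open ≤-Reasoning

  -- An ordered link: as edges have size `r`, such a `v` has distinct entries, and `degree u` is
  -- `(r - 1)!` times the usual degree.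
  Link : Fin n → Vec (Fin n) j → Set
  Link u v = u ∉ set v × (set v ∪ ⁅ u ⁆) ∈ᴱ H

  link? : ∀ u → Decidable (Link u)
  link? u v = ¬? (u ∈? set v) ×-dec ((set v ∪ ⁅ u ⁆) ∈ᴱ? H)

  degree : Fin n → ℕ
  degree u = # (link? u) (tuples n j)

  -- A vertex `u` with a tuple in its link is an `r`-tuple spanning an edge, and at most `r ^ r`
  -- tuples span the same edge.
  ∑-degree : ∑ F degree ≤ c * n ^ j
  ∑-degree = begin
    ∑ F degree                                   ≤⟨ ∑-mono F (λ {u} _ → #-mono (link? u) (λ v → set (u ∷ v) ∈ᴱ? H) (tuples n j) (λ _ → proj₂)) ⟩
    ∑[ u ∈ F ] # (λ v → set (u ∷ v) ∈ᴱ? H) (tuples n j) ≡⟨ ∑-tuples j _ ⟨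
    # (λ z → set z ∈ᴱ? H) (tuples n r)           ≤⟨ #tuples≤ (λ z → set z ∈ᴱ? H) (edges H) (λ _ z∈ → z∈) edge-size ⟩
    size H * r ^ r                               ≤⟨ *-monoˡ-≤ (r ^ r) size≤^ ⟩
    suc s * n ^ j * r ^ r                        ≤⟨ m≤n+m _ (n ^ j) ⟩
    n ^ j + suc s * n ^ j * r ^ r                ≡⟨ rearrange (suc s) (n ^ j) (r ^ r) ⟩
    suc (suc s * r ^ r) * n ^ j                  ≡⟨ cong (_* n ^ j) c≡ ⟨
    c * n ^ j                                    ∎
    where
    open ≤-Reasoning
    rearrange : ∀ a b d → b + a * b * d ≡ suc (a * d) * b
    rearrange = solve-∀

  Light : Fin n → Set
  Light u = degree u * M₁ ≤ n ^ j

  light? : Decidable Light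
  light? u = degree u * M₁ ≤? n ^ j

  heavy : List (Fin n)
  heavy = filter (¬? ∘ light?) F

  -- Markov's inequality for the degree sum.
  heavy-few : length heavy ≤ c * M₁
  heavy-few = *-cancelʳ-≤ _ _ (n ^ j) (begin
    length heavy * n ^ j                       ≡⟨ cong (_* n ^ j) (#≡length-filter (¬? ∘ light?) F) ⟨
    # (¬? ∘ light?) F * n ^ j                  ≡⟨ ∑-*ʳ F _ (n ^ j) ⟨
    ∑[ u ∈ F ] (𝟙 (¬? (light? u)) * n ^ j)     ≤⟨ ∑-mono F (λ {u} _ → bound u) ⟩
    ∑[ u ∈ F ] (degree u * M₁)                 ≡⟨ ∑-*ʳ F degree M₁ ⟩
    ∑ F degree * M₁                            ≤⟨ *-monoˡ-≤ M₁ ∑-degree ⟩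
    c * n ^ j * M₁                             ≡⟨ rearrange c (n ^ j) M₁ ⟩
    c * M₁ * n ^ j                             ∎)
    where
    open ≤-Reasoning
    rearrange : ∀ a b d → a * b * d ≡ a * d * b
    rearrange = solve-∀
    bound : ∀ u → 𝟙 (¬? (light? u)) * n ^ j ≤ degree u * M₁
    bound u with light? u
    ... | yes _ = z≤n
    ... | no ¬l = ≤-trans (≤-reflexive (*-identityˡ (n ^ j))) (<⇒≤ (≰⇒> ¬l))

  abstract
    -- The first `s` vertices are added to the heavy ones so that every set avoiding `L` lies in the
    -- tail, where it can be compared with `D m r`. They need not belong to the set `S` found in the
    -- end.
    L : Subset n
    L = insertAll heavy (headSet s)

    ∣L∣≤ : ∣ L ∣ ≤ ℓ
    ∣L∣≤ = ≤-trans (∣insertAll∣≤ heavy (headSet s))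
      (≤-trans (+-mono-≤ heavy-few (≤-reflexive (∣headSet∣ s))) (≤-reflexive (sym ℓ≡)))

    head⊆L : ∀ {x} → toℕ x < s → x ∈ L
    head⊆L x<s = ⊆-insertAll heavy (headSet s) (∈-headSet⁺ s x<s)

    ∉L⇒light : ∀ {u} → u ∉ L → Light u
    ∉L⇒light {u} u∉ with light? u
    ... | yes l = l
    ... | no ¬l = ⊥-elim (u∉ (∈-insertAll (∈-filter⁺ (¬? ∘ light?) (∈-allFin u) ¬l)))

    N : Subset n → Subset n
    N B = ⟪ (λ a → (a ∈? L) ×-dec ((B ∪ ⁅ a ⁆) ∈ᴱ? H)) ⟫

    ∈-N⁺ : ∀ {B a} → a ∈ L → (B ∪ ⁅ a ⁆) ∈ᴱ H → a ∈ N B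
    ∈-N⁺ p q = ∈-⟪⟫⁺ _ (p , q)

    ∈-N⁻ : ∀ {B a} → a ∈ N B → a ∈ L × (B ∪ ⁅ a ⁆) ∈ᴱ H
    ∈-N⁻ p = ∈-⟪⟫⁻ _ p

  ap? : Decidable (Apart L)
  ap? = apart? L

  𝓝 ML low high : List (Subset n)
  𝓝 = filter ap? (sets n j)
  ML = filter (¬? ∘ ap?) (sets n j)
  low = filter (λ B → ∣ N B ∣ <? s) 𝓝
  high = filter (λ B → s <? ∣ N B ∣) 𝓝

  𝓝-apart : ∀ {B} → B ∈ᴸ 𝓝 → ∣ B ∣ ≡ j × Apart L B
  𝓝-apart B∈ = let (p , q) = ∈-filter⁻ ap? {xs = sets n j} B∈ in ∈-sets⁻ {n = n} p , q

  ∈-𝓝 : ∀ {B} → ∣ B ∣ ≡ j → Apart L B → B ∈ᴸ 𝓝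
  ∈-𝓝 p q = ∈-filter⁺ ap? (∈-sets⁺ p) q

  𝓝-unique : Unique 𝓝
  𝓝-unique = Uniqueₚ.filter⁺ ap? (unique (complete n j))

  length-ML : length ML ≤ ℓ * n ^ i
  length-ML = begin
    length ML              ≤⟨ length-mono (Uniqueₚ.filter⁺ (¬? ∘ ap?) (unique (complete n j))) sub ⟩
    length (concatMap (λ a → map (_∪ ⁅ a ⁆) (sets n i)) (elems L))
      ≤⟨ length-concatMap≤ (λ a → map (_∪ ⁅ a ⁆) (sets n i)) (elems L) {n ^ i} (λ {a} _ → ≤-trans (≤-reflexive (length-map (_∪ ⁅ a ⁆) (sets n i))) (length-sets≤^ n i)) ⟩
    length (elems L) * n ^ i ≤⟨ *-monoˡ-≤ (n ^ i) (≤-trans (≤-reflexive (length-elems L)) ∣L∣≤) ⟩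
    ℓ * n ^ i              ∎
    where
    open ≤-Reasoning
    sub : ∀ {B} → B ∈ᴸ ML → B ∈ᴸ concatMap (λ a → map (_∪ ⁅ a ⁆) (sets n i)) (elems L)
    sub {B} B∈ with ∈-filter⁻ (¬? ∘ ap?) {xs = sets n j} B∈
    ... | B∈s , ¬ap with ¬apart⇒meet L B ¬ap
    ...   | a , a∈B , a∈L = ∈-concatMap {h = λ a → map (_∪ ⁅ a ⁆) (sets n i)} (∈-elems⁺ a∈L)
      (subst (_∈ᴸ map (_∪ ⁅ a ⁆) (sets n i)) (remove-insert a∈B)
        (∈-map⁺ (_∪ ⁅ a ⁆) {x = B - a} (∈-sets⁺ {A = B - a} (suc-injective (trans (∣remove∣ a∈B) (∈-sets⁻ {n = n} B∈s))))))

  Out Meet : List (Subset n)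
  Out = filter ap? (edges H)
  Meet = filter (¬? ∘ ap?) (edges H)

  starPairs : List (Subset n × Fin n)
  starPairs = filter (λ p → proj₂ p ∈? N (proj₁ p)) (cartesianProduct 𝓝 F)

  starPairs⁻ : ∀ {B a} → (B , a) ∈ᴸ starPairs → Apart L B × a ∈ L × (B ∪ ⁅ a ⁆) ∈ᴱ H
  starPairs⁻ p∈ with ∈-filter⁻ (λ p → proj₂ p ∈? N (proj₁ p)) {xs = cartesianProduct 𝓝 F} p∈
  ... | p∈× , a∈N = proj₂ (𝓝-apart (proj₁ (∈-cartesianProduct⁻ 𝓝 F p∈×))) , ∈-N⁻ a∈N

  -- The pair can be read off from `B ∪ ⁅ a ⁆`: since `B` avoids `L`, the vertex `a` is the only one
  -- in `L`.
  starPairs≤Meet : length starPairs ≤ length Meet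
  starPairs≤Meet = length-injective (λ (B , a) → B ∪ ⁅ a ⁆)
    (Uniqueₚ.filter⁺ _ (Uniqueₚ.cartesianProduct⁺ 𝓝-unique (Uniqueₚ.allFin⁺ n))) into inj
    where
    into : ∀ {p} → p ∈ᴸ starPairs → (proj₁ p ∪ ⁅ proj₂ p ⁆) ∈ᴸ Meet
    into {B , a} p∈ with starPairs⁻ p∈
    ... | _ , a∈L , e∈ = ∈-filter⁺ (¬? ∘ ap?) e∈ (λ ap → ap a (∈-insertʳ B a) a∈L)
    half : ∀ {B B′ a} → Apart L B → a ∈ L → B ∪ ⁅ a ⁆ ≡ B′ ∪ ⁅ a ⁆ → B ⊆ B′
    half {B} {B′} apB a∈L eq {x} x∈ with ∈-insert⁻ B′ (subst (x ∈_) eq (∈-insertˡ x∈))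
    ... | inj₁ q    = q
    ... | inj₂ refl = ⊥-elim (apB x x∈ a∈L)
    inj : ∀ {p p′} → p ∈ᴸ starPairs → p′ ∈ᴸ starPairs → proj₁ p ∪ ⁅ proj₂ p ⁆ ≡ proj₁ p′ ∪ ⁅ proj₂ p′ ⁆ → p ≡ p′
    inj {B , a} {B′ , a′} p∈ p′∈ eq with starPairs⁻ p∈ | starPairs⁻ p′∈
    ... | apB , a∈L , _ | apB′ , a′∈L , _ with ∈-insert⁻ B′ (subst (a ∈_) eq (∈-insertʳ B a))
    ...   | inj₁ a∈B′ = ⊥-elim (apB′ a a∈B′ a∈L)
    ...   | inj₂ refl = cong (_, a) (⊆-antisym (half apB a∈L eq) (half apB′ a∈L (sym eq)))

  -- Double counting of the pairs `(B , a)` with `a ∈ N B`: a set contributes at least `s`, a high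
  -- one at least one more, and a low one falls short by at most `s`.
  types-sum : s * length 𝓝 + length high ≤ length Meet + s * length low
  types-sum = begin
    s * length 𝓝 + length high   ≡⟨ cong₂ _+_ (trans (*-comm s _) (sym (∑-const 𝓝 s))) (sym (#≡length-filter _ 𝓝)) ⟩
    (∑[ _ ∈ 𝓝 ] s) + # (λ B → s <? ∣ N B ∣) 𝓝 ≡⟨ ∑-distrib-+ 𝓝 _ _ ⟨
    ∑[ B ∈ 𝓝 ] (s + 𝟙 (s <? ∣ N B ∣)) ≤⟨ ∑-mono 𝓝 (λ {B} _ → pointwise B) ⟩
    ∑[ B ∈ 𝓝 ] (# (_∈? N B) F + s * 𝟙 (∣ N B ∣ <? s)) ≡⟨ ∑-distrib-+ 𝓝 _ _ ⟩
    (∑[ B ∈ 𝓝 ] # (_∈? N B) F) + ∑[ B ∈ 𝓝 ] (s * 𝟙 (∣ N B ∣ <? s))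
      ≡⟨ cong₂ _+_ (sym (∑-cartesianProduct 𝓝 F _)) (∑-*ˡ 𝓝 _ s) ⟩
    # (λ p → proj₂ p ∈? N (proj₁ p)) (cartesianProduct 𝓝 F) + s * # (λ B → ∣ N B ∣ <? s) 𝓝
      ≡⟨ cong₂ (λ a b → a + s * b) (#≡length-filter _ (cartesianProduct 𝓝 F)) (#≡length-filter _ 𝓝) ⟩
    length starPairs + s * length low ≤⟨ +-monoˡ-≤ (s * length low) starPairs≤Meet ⟩
    length Meet + s * length low ∎
    where
    open ≤-Reasoning
    pointwise : ∀ B → s + 𝟙 (s <? ∣ N B ∣) ≤ # (_∈? N B) F + s * 𝟙 (∣ N B ∣ <? s)
    pointwise B with s <? ∣ N B ∣ | ∣ N B ∣ <? s
    ... | yes p | _      = ≤-trans (≤-trans (≤-reflexive (+-comm s 1)) p) (≤-trans (∣A∣≤#∈ (N B)) (m≤m+n _ _))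
    ... | no _  | yes _  = ≤-trans (≤-reflexive (trans (+-identityʳ s) (sym (*-identityʳ s)))) (m≤n+m _ _)
    ... | no _  | no ¬q  = ≤-trans (≤-reflexive (+-identityʳ s)) (≤-trans (≮⇒≥ ¬q) (≤-trans (∣A∣≤#∈ (N B)) (m≤m+n _ _)))

  uncovered? : Decidable (λ P → ι s P ∈ᴸ ML ++ high)
  uncovered? P = ∈ᴸ? _≟ˢ_ (ι s P) (ML ++ high)

  uncovered : List (Subset m)
  uncovered = filter uncovered? (sets m j)

  uncovered≤ : length uncovered ≤ length ML + length high
  uncovered≤ = ≤-trans
    (length-injective (ι s) (Uniqueₚ.filter⁺ uncovered? (unique (complete m j)))
      (λ P∈ → proj₂ (∈-filter⁻ uncovered? {xs = sets m j} P∈)) (λ _ _ → ι-injective s))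
    (≤-reflexive (length-++ ML))

  -- Let `B` be a tail set that avoids `L` and is not high. Then `N B ∪ B` is small enough to be
  -- covered, and a covering vertex in `L` would itself belong to `N B`, so some edge in `Out`
  -- contains `B`. The other sets are repaired, with all `i`-sets as keys.
  D≤Out : 2 * D m r ≤ 2 * length Out + (length ML + length high + n ^ i)
  D≤Out with keyed {m} {i} uncovered (λ P∈ → ∈-sets⁻ {n = m} (proj₁ (∈-filter⁻ uncovered? {xs = sets m j} P∈)))
  ... | 𝓔 , len , keys , key-of = ≤-trans
    (D≤-recover r≤m (map (tl s) Out) (sets m i) 𝓔 (∈-sets⁻ {n = m}) keys cover)
    (+-mono-≤ (≤-reflexive (cong (2 *_) (length-map (tl s) Out)))
      (+-mono-≤ (≤-trans (≤-reflexive len) uncovered≤) (≤-trans (length-sets≤^ m i) (^-monoˡ-≤ i m≤n))))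
    where
    cover : ∀ P → ∣ P ∣ ≡ j → (∃ λ e → e ∈ᴸ map (tl s) Out × ∣ e ∣ ≡ r × P ⊆ e) ⊎
                              (∃ λ p → p ∈ᴸ 𝓔 × P ⊆ proj₁ p ∪ ⁅ proj₂ p ⁆)
    cover P P≡ with uncovered? P
    ... | yes p = inj₂ (key-of (∈-filter⁺ uncovered? (∈-sets⁺ {A = P} P≡) p))
    ... | no ¬p = inj₁ (tl s e , ∈-map⁺ (tl s) (∈-filter⁺ ap? e∈H apart-e) , tl-size ,
                        λ x∈ → subst (_⊆ tl s e) (tl-ι s P) (tl-mono s ∈-insertˡ) x∈)
      where
      B = ι s P
      B≡ : ∣ B ∣ ≡ j
      B≡ = trans (∣ι∣ s P) P≡
      apart-B : Apart L B
      apart-B with ap? B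
      ... | yes ap = ap
      ... | no ¬ap = ⊥-elim (¬p (∈-++⁺ˡ (∈-filter⁺ (¬? ∘ ap?) (∈-sets⁺ {A = B} B≡) ¬ap)))
      ∣N∣≤ : ∣ N B ∣ ≤ s
      ∣N∣≤ = ≮⇒≥ (λ s< → ¬p (∈-++⁺ʳ ML (∈-filter⁺ (λ B → s <? ∣ N B ∣) (∈-𝓝 B≡ apart-B) s<)))
      A = N B ∪ B
      covering = cover-≤ A (≤-trans (∣p∪q∣≤∣p∣+∣q∣ (N B) B) (+-mono-≤ ∣N∣≤ (≤-reflexive B≡)))
      u = proj₁ covering
      u∉A : u ∉ A
      u∉A = proj₁ (proj₂ covering)
      e = B ∪ ⁅ u ⁆
      e∈H : e ∈ᴱ H
      e∈H = proj₂ (proj₂ covering) B (q⊆p∪q (N B) B) B≡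
      u∉L : u ∉ L
      u∉L u∈L = u∉A (p⊆p∪q B (∈-N⁺ u∈L e∈H))
      apart-e : Apart L e
      apart-e x x∈ with ∈-insert⁻ B x∈
      ... | inj₁ q    = apart-B x q
      ... | inj₂ refl = u∉L
      tl-size : ∣ tl s e ∣ ≡ r
      tl-size = trans (sym (∣ι∣ s (tl s e))) (trans (cong ∣_∣ (ι-tl s e (λ x x∈ → ≮⇒≥ (λ x<s → apart-e x x∈ (head⊆L x<s)))))
        (edge-size e∈H))

  -- Compares the number of edges in `Out` and `Meet` with the bound on `size H`. A high set gains a
  -- whole edge in `types-sum` but costs only half an edge in `D≤Out`, so a positive multiple of
  -- `length high` stays on the left.
  high≤ : length high ≤ 2 * s * length low + ((2 * s + 1) * ℓ + 1) * n ^ i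
  high≤ = arith (length high) (length low) (length 𝓝) (length ML) (length Meet) (length Out) (D m r) s ℓ (n ^ i)
    total types-sum D≤Out length-ML
    where
    total : length Out + length Meet ≤ s * (length 𝓝 + length ML) + D m r
    total = begin
      length Out + length Meet ≡⟨ #-filters ap? (edges H) ⟩
      size H ≤⟨ size≤ ⟩
      (n C r ∸ m C r) + D m r ≤⟨ +-monoˡ-≤ (D m r) (m≤n+o⇒m∸n≤o _ _ (C-head s m i)) ⟩
      s * (n C j) + D m r ≡⟨ cong (λ w → s * w + D m r) (trans (sym (length-sets n j)) (sym (#-filters ap? (sets n j)))) ⟩
      s * (length 𝓝 + length ML) + D m r ∎
      where open ≤-Reasoning
    arith : ∀ h l a b e o d s ℓ p → o + e ≤ s * (a + b) + d → s * a + h ≤ e + s * l →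
            2 * d ≤ 2 * o + (b + h + p) → b ≤ ℓ * p → h ≤ 2 * s * l + ((2 * s + 1) * ℓ + 1) * p
    arith h l a b e o d s ℓ p h₁ h₂ h₃ h₄ = ≤-certificate _ _ 0
      (+-mono-≤ (*-monoʳ-≤ 2 h₁) (+-mono-≤ (*-monoʳ-≤ 2 h₂) (+-mono-≤ h₃ (*-monoʳ-≤ (2 * s + 1) h₄))))
      (eq h l a b e o d s ℓ p)
      where
      eq : ∀ h l a b e o d s ℓ p →
        h + (2 * (s * (a + b) + d) + (2 * (e + s * l) + (2 * o + (b + h + p) + (2 * s + 1) * (ℓ * p)))) + 0 ≡
        2 * s * l + ((2 * s + 1) * ℓ + 1) * p + (2 * (o + e) + (2 * (s * a + h) + (2 * d + (2 * s + 1) * b)))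
      eq = solve-∀

  LightlyCovered : Vec (Fin n) r → Set
  LightlyCovered z = ∃ λ u → Light u × Omits (Link u) z

  lightlyCovered? : Decidable LightlyCovered
  lightlyCovered? z = any? λ u → light? u ×-dec omits? (link? u) z

  #lc : ℕ
  #lc = # lightlyCovered? (tuples n r)

  -- The weak Kruskal-Katona bound, summed over the light vertices; lightness is exactly its
  -- hypothesis.
  lightlyCovered-few : #lc * M₂ ≤ n * (c * n ^ j)
  lightlyCovered-few = begin
    #lc * M₂ ≤⟨ *-monoˡ-≤ M₂ (∑-mono (tuples n r) (λ {z} _ → witness z)) ⟩
    (∑[ z ∈ tuples n r ] # (λ u → light? u ×-dec omits? (link? u) z) F) * M₂ ≡⟨ cong (_* M₂) (∑-swap (tuples n r) F _) ⟩
    (∑[ u ∈ F ] # (λ z → light? u ×-dec omits? (link? u) z) (tuples n r)) * M₂ ≡⟨ ∑-*ʳ F _ M₂ ⟨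
    ∑[ u ∈ F ] (# (λ z → light? u ×-dec omits? (link? u) z) (tuples n r) * M₂) ≤⟨ ∑-mono F (λ {u} _ → bound u) ⟩
    ∑[ u ∈ F ] (n * degree u) ≡⟨ ∑-*ˡ F degree n ⟩
    n * ∑ F degree ≤⟨ *-monoʳ-≤ n ∑-degree ⟩
    n * (c * n ^ j) ∎
    where
    open ≤-Reasoning
    witness : ∀ z → 𝟙 (lightlyCovered? z) ≤ # (λ u → light? u ×-dec omits? (link? u) z) F
    witness z with lightlyCovered? z
    ... | no _ = z≤n
    ... | yes (u , p) = length≤# (λ u → light? u ×-dec omits? (link? u) z) {xs = [ u ]} ([] ∷ [])
      λ { (here refl) → p , ∈-allFin u }
    bound : ∀ u → # (λ z → light? u ×-dec omits? (link? u) z) (tuples n r) * M₂ ≤ n * degree u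
    bound u = by (light? u)
      where
      by : Dec (Light u) → # (λ z → light? u ×-dec omits? (link? u) z) (tuples n r) * M₂ ≤ n * degree u
      by (yes l) = ≤-trans
        (*-monoˡ-≤ M₂ (#-mono _ (omits? (link? u)) (tuples n r) (λ _ → proj₂)))
        (#-omits n j M₂ (link? u) (subst (λ w → degree u * w ≤ n ^ j) M₁≡ l))
      by (no ¬l) = ≤-trans (*-monoˡ-≤ M₂ (∑≤length* (tuples n r) {c = 0} (λ {z} _ →
          ≤-reflexive (𝟙-no (light? u ×-dec omits? (link? u) z) (¬l ∘ proj₁)))))
        (≤-trans (≤-reflexive (cong (_* M₂) (*-zeroʳ (length (tuples n r))))) z≤n)

  lightly-covered : ∀ z u → u ∉ L → u ∉ set z → ∣ set z ∣ ≡ r →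
    (∀ Q → Q ⊆ set z → ∣ Q ∣ ≡ j → (Q ∪ ⁅ u ⁆) ∈ᴱ H) → LightlyCovered z
  lightly-covered z u u∉L u∉z ∣z∣ h = u , ∉L⇒light u∉L , omits⁺ z λ p →
    (λ u∈ → u∉z (set-removeAt-⊆ z p u∈)) ,
    h (set (removeAt z p)) (set-removeAt-⊆ z p) (∣set-removeAt∣ z p ∣z∣)

  low? : Decidable (λ (v : Vec (Fin n) j) → set v ∈ᴸ low)
  low? v = ∈ᴸ? _≟ˢ_ (set v) low

  #low : ℕ
  #low = # low? (tuples n j)

  low≤#low : length low ≤ #low
  low≤#low = length-sets≤# low? (Uniqueₚ.filter⁺ _ 𝓝-unique) λ B∈ →
    proj₁ (𝓝-apart (proj₁ (∈-filter⁻ (λ B → ∣ N B ∣ <? s) {xs = 𝓝} B∈))) , λ v eq → subst (_∈ᴸ low) (sym eq) B∈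

  -- If ∣ N B ∣ < s, then N B ∪ B ∪ {y} has size at most k.  A vertex of L covering it would be a
  -- further member of N B, so the covering vertex is light.
  low-few : n * #low ≤ #lc + j * #low
  low-few = begin
    n * #low ≡⟨ cong (_* #low) (length-allFin n) ⟨
    length F * #low ≡⟨ ∑-const F #low ⟨
    ∑[ y ∈ F ] #low ≤⟨ ∑-mono F (λ {y} _ → #-mono-⊎ low? (λ v → lightlyCovered? (y ∷ v)) (λ v → low? v ×-dec (y ∈? set v)) (tuples n j) (split y)) ⟩
    ∑[ y ∈ F ] (# (λ v → lightlyCovered? (y ∷ v)) (tuples n j) + # (λ v → low? v ×-dec (y ∈? set v)) (tuples n j))
      ≡⟨ ∑-distrib-+ F _ _ ⟩
    (∑[ y ∈ F ] # (λ v → lightlyCovered? (y ∷ v)) (tuples n j)) + (∑[ y ∈ F ] # (λ v → low? v ×-dec (y ∈? set v)) (tuples n j))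
      ≡⟨ cong₂ _+_ (sym (∑-tuples j _)) (∑-swap F (tuples n j) _) ⟩
    #lc + ∑[ v ∈ tuples n j ] # (λ y → low? v ×-dec (y ∈? set v)) F ≤⟨ +-monoʳ-≤ #lc (∑-mono (tuples n j) (λ {v} _ → inner v)) ⟩
    #lc + ∑[ v ∈ tuples n j ] (j * 𝟙 (low? v)) ≡⟨ cong (#lc +_) (∑-*ˡ (tuples n j) _ j) ⟩
    #lc + j * #low ∎
    where
    open ≤-Reasoning
    -- Values of `y` already in `set v` give no information, but there are at most `j` of them for
    -- each `v`.
    inner : ∀ v → # (λ y → low? v ×-dec (y ∈? set v)) F ≤ j * 𝟙 (low? v)
    inner v = by (low? v) refl
      where
      by : (d : Dec (set v ∈ᴸ low)) → low? v ≡ d → # (λ y → low? v ×-dec (y ∈? set v)) F ≤ j * 𝟙 (low? v)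
      by (yes p) eq rewrite eq = ≤-trans (#-mono _ (_∈? set v) F (λ _ → proj₂))
        (≤-trans (#∈≤∣A∣ (set v)) (≤-trans (∣set∣≤ v) (≤-reflexive (sym (*-identityʳ j)))))
      by (no ¬p) eq = ≤-trans (∑≤length* F {c = 0} (λ {y} _ → ≤-reflexive (𝟙-no (low? v ×-dec (y ∈? set v)) (¬p ∘ proj₁))))
        (≤-trans (≤-reflexive (*-zeroʳ (length F))) z≤n)
    split : ∀ y v → set v ∈ᴸ low → LightlyCovered (y ∷ v) ⊎ (set v ∈ᴸ low × y ∈ set v)
    split y v v∈ with y ∈? set v
    ... | yes y∈ = inj₂ (v∈ , y∈)
    ... | no  y∉ with ∈-filter⁻ (λ B → ∣ N B ∣ <? s) {xs = 𝓝} v∈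
    ...   | B∈ , N<s = inj₁ (lightly-covered (y ∷ v) u u∉L (λ u∈ → u∉A (q⊆p∪q (N B) (set (y ∷ v)) u∈)) ∣z∣ (λ Q Q⊆ → h Q (λ x∈ → q⊆p∪q (N B) (set (y ∷ v)) (Q⊆ x∈))))
      where
      B = set v
      ∣B∣ = proj₁ (𝓝-apart B∈)
      ∣z∣ : ∣ set (y ∷ v) ∣ ≡ r
      ∣z∣ = trans (∣A∪⁅u⁆∣ B y y∉) (cong suc ∣B∣)
      A = N B ∪ set (y ∷ v)
      ∣A∣≤ : ∣ A ∣ ≤ s + j
      ∣A∣≤ = ≤-trans (∣p∪q∣≤∣p∣+∣q∣ (N B) (set (y ∷ v))) (≤-trans (≤-reflexive (trans (cong (∣ N B ∣ +_) ∣z∣) (+-suc ∣ N B ∣ j)))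
        (+-monoˡ-≤ j N<s))
      covering = cover-≤ A ∣A∣≤
      u = proj₁ covering
      u∉A : u ∉ A
      u∉A = proj₁ (proj₂ covering)
      h = proj₂ (proj₂ covering)
      u∉L : u ∉ L
      u∉L u∈L = u∉A (p⊆p∪q (set (y ∷ v)) (∈-N⁺ u∈L (h B (λ x∈ → q⊆p∪q (N B) (set (y ∷ v)) (∈-insertˡ x∈)) ∣B∣)))

  Normal : Vec (Fin n) j → Set
  Normal v = ∣ set v ∣ ≡ j × Apart L (set v) × ∣ N (set v) ∣ ≡ s

  normal? : Decidable Normal
  normal? v = (∣ set v ∣ ≟ j) ×-dec ap? (set v) ×-dec (∣ N (set v) ∣ ≟ s)

  #abnormal : ℕ
  #abnormal = # (¬? ∘ normal?) (tuples n j)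

  high? : Decidable (λ (v : Vec (Fin n) j) → set v ∈ᴸ high)
  high? v = ∈ᴸ? _≟ˢ_ (set v) high

  -- A tuple of distinct entries outside `L` can fail to be normal only by being low or high.
  abnormal≤ : #abnormal ≤ # (degenerate? L) (tuples n j) + (#low + length high * j ^ j)
  abnormal≤ = ≤-trans
    (#-mono-⊎ (¬? ∘ normal?) (degenerate? L) (λ v → low? v ⊎-dec high? v) (tuples n j) split)
    (+-monoʳ-≤ (# (degenerate? L) (tuples n j)) (≤-trans
      (#-mono-⊎ (λ v → low? v ⊎-dec high? v) low? high? (tuples n j) (λ _ p → p))
      (+-monoʳ-≤ #low (#tuples≤ high? high (λ _ p → p)
        (λ B∈ → proj₁ (𝓝-apart (proj₁ (∈-filter⁻ (λ B → s <? ∣ N B ∣) {xs = 𝓝} B∈))))))))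
    where
    split : ∀ v → ¬ Normal v → Degenerate L v ⊎ (set v ∈ᴸ low ⊎ set v ∈ᴸ high)
    split v ¬n with degenerate? L v
    ... | yes d = inj₁ d
    ... | no ¬d with ¬degenerate⇒ L v ¬d
    ...   | v≡ , ap with ∣ N (set v) ∣ <? s | s <? ∣ N (set v) ∣
    ...     | yes p | _     = inj₂ (inj₁ (∈-filter⁺ (λ B → ∣ N B ∣ <? s) (∈-𝓝 v≡ ap) p))
    ...     | no _  | yes q = inj₂ (inj₂ (∈-filter⁺ (λ B → s <? ∣ N B ∣) (∈-𝓝 v≡ ap) q))
    ...     | no ¬p | no ¬q = ⊥-elim (¬n (v≡ , ap , ≤-antisym (≮⇒≥ ¬q) (≮⇒≥ ¬p)))

  -- All abnormal tuples share the value `nothing`, so that types can be compared on the whole space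
  -- of tuples.
  type : Vec (Fin n) j → Maybe (Subset n)
  type v with normal? v
  ... | yes _ = just (N (set v))
  ... | no  _ = nothing

  type-just : ∀ {v S} → type v ≡ just S → Normal v × N (set v) ≡ S
  type-just {v} eq with normal? v
  type-just refl | yes p = p , refl

  type-nothing : ∀ {v} → type v ≡ nothing → ¬ Normal v
  type-nothing {v} eq with normal? v
  type-nothing refl | no ¬p = ¬p

  type-normal : ∀ {v} → Normal v → type v ≡ just (N (set v))
  type-normal {v} p with normal? v
  ... | yes _ = refl
  ... | no ¬p = ⊥-elim (¬p p)

  Bad : Vec (Fin n) r → Set
  Bad z = LightlyCovered z ⊎ ∃ λ p → ¬ Normal (removeAt z p)

  bad? : Decidable Bad
  bad? z = lightlyCovered? z ⊎-dec any? (λ p → ¬? (normal? (removeAt z p)))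

  #bad : ℕ
  #bad = # bad? (tuples n r)

  -- At each of the `r` positions an abnormal `j`-tuple can be extended in `n` ways.
  bad≤ : #bad ≤ #lc + r * (n * #abnormal)
  bad≤ = ≤-trans
    (#-mono-⊎ bad? lightlyCovered? (λ z → any? (λ p → ¬? (normal? (removeAt z p)))) (tuples n r) (λ _ p → p))
    (+-monoʳ-≤ #lc (begin
      # (λ z → any? (λ p → ¬? (normal? (removeAt z p)))) (tuples n r)
        ≤⟨ ∑-mono (tuples n r) (λ {z} _ → witness z) ⟩
      ∑[ z ∈ tuples n r ] ∑[ p ∈ allFin r ] 𝟙 (¬? (normal? (removeAt z p))) ≡⟨ ∑-swap (tuples n r) (allFin r) _ ⟩
      ∑[ p ∈ allFin r ] # (λ z → ¬? (normal? (removeAt z p))) (tuples n r) ≡⟨ ∑-cong (allFin r) (#-removeAt n j (¬? ∘ normal?)) ⟩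
      ∑[ p ∈ allFin r ] (n * #abnormal) ≡⟨ ∑-const (allFin r) _ ⟩
      length (allFin r) * (n * #abnormal) ≡⟨ cong (_* (n * #abnormal)) (length-allFin r) ⟩
      r * (n * #abnormal) ∎))
    where
    open ≤-Reasoning
    witness : ∀ z → 𝟙 (any? (λ p → ¬? (normal? (removeAt z p)))) ≤ ∑[ p ∈ allFin r ] 𝟙 (¬? (normal? (removeAt z p)))
    witness z with any? (λ p → ¬? (normal? (removeAt z p)))
    ... | no _ = z≤n
    ... | yes (p , ¬np) = length≤# (λ p → ¬? (normal? (removeAt z p))) {xs = [ p ]} ([] ∷ [])
      λ { (here refl) → ¬np , ∈-allFin p }

  abnormal≤bad : n * #abnormal ≤ #bad
  abnormal≤bad = ≤-trans (≤-reflexive (sym (#-removeAt n j (¬? ∘ normal?) zero)))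
    (#-mono (λ z → ¬? (normal? (removeAt z zero))) bad? (tuples n r) (λ z ¬n → inj₂ (zero , ¬n)))

  -- Two different neighbour sets of size `s` meet in fewer than `s` vertices, so their intersection
  -- together with `set z` has at most `s + j` vertices and is covered. A covering vertex in `L`
  -- would lie in both neighbour sets; hence it is light, and `z` is lightly covered after all.
  types-agree : ∀ z → ¬ Bad z → ∀ p q → type (removeAt z p) ≡ type (removeAt z q)
  types-agree z ¬bad p q = trans (type-normal (normal p)) (trans (cong just N≡) (sym (type-normal (normal q))))
    where
    normal : ∀ p → Normal (removeAt z p)
    normal p with normal? (removeAt z p)
    ... | yes n = n
    ... | no ¬n = ⊥-elim (¬bad (inj₂ (p , ¬n)))
    B : Fin r → Subset n
    B p = set (removeAt z p)
    ∣z∣ : ∣ set z ∣ ≤ r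
    ∣z∣ = ∣set∣≤ z
    N⊆ : N (B p) ⊆ N (B q)
    N⊆ {a} a∈ with a ∈? N (B q)
    ... | yes a∈q = a∈q
    ... | no  a∉q = ⊥-elim (¬bad (inj₁ (u , ∉L⇒light u∉L , omits⁺ z λ p′ →
        (λ u∈ → u∉A (q⊆p∪q I (set z) (set-removeAt-⊆ z p′ u∈))) , edge p′)))
      where
      I = N (B p) ∩ N (B q)
      I<s : ∣ I ∣ < s
      I<s = subst (∣ I ∣ <_) (proj₂ (proj₂ (normal p)))
        (p⊂q⇒∣p∣<∣q∣ (p∩q⊆p (N (B p)) (N (B q)) , a , a∈ , λ a∈I → a∉q (p∩q⊆q (N (B p)) (N (B q)) a∈I)))
      A = I ∪ set z
      covering = cover-≤ A (≤-trans (∣p∪q∣≤∣p∣+∣q∣ I (set z)) (≤-trans (+-monoʳ-≤ ∣ I ∣ ∣z∣)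
        (≤-trans (≤-reflexive (+-suc ∣ I ∣ j)) (+-monoˡ-≤ j I<s))))
      u = proj₁ covering
      u∉A : u ∉ A
      u∉A = proj₁ (proj₂ covering)
      edge : ∀ p′ → (B p′ ∪ ⁅ u ⁆) ∈ᴱ H
      edge p′ = proj₂ (proj₂ covering) (B p′) (λ x∈ → q⊆p∪q I (set z) (set-removeAt-⊆ z p′ x∈)) (proj₁ (normal p′))
      u∉L : u ∉ L
      u∉L u∈L = u∉A (p⊆p∪q (set z) (x∈p∩q⁺ (∈-N⁺ u∈L (edge p) , ∈-N⁺ u∈L (edge q))))
    N≡ : N (B p) ≡ N (B q)
    N≡ = ⊆∧∣≥∣⇒≡ N⊆ (≤-reflexive (trans (proj₂ (proj₂ (normal q))) (sym (proj₂ (proj₂ (normal p))))))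

  _≟ᴹ_ : DecidableEquality (Maybe (Subset n))
  _≟ᴹ_ = ≡-decᴹ _≟ˢ_

  differ? : ∀ v → Decidable (λ w → ¬ type v ≡ type w)
  differ? v w = ¬? (type v ≟ᴹ type w)

  #differ : Vec (Fin n) j → ℕ
  #differ v = # (differ? v) (tuples n j)

  -- `disagreements-bound`, averaged over the first tuple.
  ∃-typical : ∃ λ v → v ∈ᴸ tuples n j × n * #differ v ≤ j * #bad
  ∃-typical = ∃-small (tuples n j)
    (≤-trans (>-nonZero⁻¹ (n ^ j)) (≤-reflexive (sym (length-tuples n j))))
    (≤-trans (≤-reflexive (∑-*ˡ (tuples n j) #differ n))
      (≤-trans (disagreements-bound _≟ᴹ_ n j type bad? types-agree)
        (≤-reflexive (trans (rearrange j (n ^ j) #bad) (cong (_* (j * #bad)) (sym (length-tuples n j)))))))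
    where
    rearrange : ∀ a b d → a * (b * d) ≡ b * (a * d)
    rearrange = solve-∀

  -- All but a proportion `1 / M` of the tuples share the type of a typical `v`. That type is not
  -- `nothing`: abnormal tuples are equally rare, and as `M` is at least 3 the two exceptional
  -- families cannot exhaust all tuples. If it is `just S`, every set put into `𝓛` is spanned by
  -- tuples of another type only.
  conclusion : ∀ M → 3 ≤ M → j * #bad * M ≤ n * n ^ j → CommonHead s i m H M
  conclusion M 3≤M few-bad = by (type v) refl
    where
    v = proj₁ ∃-typical
    differ≤ : #differ v * M ≤ n ^ j
    differ≤ = *-cancelˡ-≤ n (≤-trans (≤-reflexive (sym (*-assoc n (#differ v) M)))
      (≤-trans (*-monoˡ-≤ M (proj₂ (proj₂ ∃-typical))) few-bad))
    by : ∀ t → type v ≡ t → CommonHead s i m H M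
    by nothing t≡ = ⊥-elim (<⇒≱ (>-nonZero⁻¹ (n ^ j)) (arith (n ^ j) (#differ v) #abnormal M 3≤M all differ≤ abnormal-few))
      where
      all : n ^ j ≤ #differ v + #abnormal
      all = ≤-trans (≤-reflexive (trans (sym (length-tuples n j)) (sym (#+#¬ normal? (tuples n j)))))
        (+-monoˡ-≤ #abnormal (#-mono normal? (differ? v) (tuples n j)
          (λ w nw e → type-nothing (trans (sym e) t≡) nw)))
      abnormal-few : #abnormal * M ≤ n ^ j
      abnormal-few = *-cancelˡ-≤ n (begin
        n * (#abnormal * M) ≡⟨ *-assoc n #abnormal M ⟨
        n * #abnormal * M   ≤⟨ *-monoˡ-≤ M abnormal≤bad ⟩
        #bad * M            ≤⟨ m≤m+n (#bad * M) (i * (#bad * M)) ⟩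
        j * (#bad * M)      ≡⟨ *-assoc j #bad M ⟨
        j * #bad * M        ≤⟨ few-bad ⟩
        n * n ^ j           ∎)
        where open ≤-Reasoning
      arith : ∀ p d a M → 3 ≤ M → p ≤ d + a → d * M ≤ p → a * M ≤ p → p ≤ 0
      arith p d a M h₀ h₁ h₂ h₃ = ≤-certificate _ _ 0
        (+-mono-≤ (*-monoʳ-≤ 3 h₁) (+-mono-≤ h₂ (+-mono-≤ h₃ (*-monoʳ-≤ (d + a) h₀)))) (eq p d a M)
        where
        eq : ∀ p d a M → p + (3 * (d + a) + (p + (p + (d + a) * M))) + 0 ≡ 0 + (3 * p + (d * M + (a * M + (d + a) * 3)))
        eq = solve-∀
    by (just S) t≡ = S , trans (cong ∣_∣ (sym N≡S)) (proj₂ (proj₂ nv)) , 𝓛 , ≤-trans (*-monoˡ-≤ M 𝓛≤) differ≤ , bads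
      where
      nv = proj₁ (type-just t≡)
      N≡S = proj₂ (type-just t≡)
      good? : Decidable (λ B → Apart L B × N B ≡ S)
      good? B = ap? B ×-dec (N B ≟ˢ S)
      𝓛 = filter (¬? ∘ good?) (sets n j)
      𝓛≤ : length 𝓛 ≤ #differ v
      𝓛≤ = length-sets≤# (differ? v) (Uniqueₚ.filter⁺ (¬? ∘ good?) (unique (complete n j)))
        λ B∈ → let (p , ¬g) = ∈-filter⁻ (¬? ∘ good?) {xs = sets n j} B∈ in ∈-sets⁻ {n = n} p ,
          λ w w≡ same → let (nw , NS) = type-just (trans (sym same) t≡) in
            ¬g (subst (λ B → Apart L B × N B ≡ S) w≡ (proj₁ (proj₂ nw) , NS))
      bads : ∀ B → ∣ B ∣ ≡ j → ∀ a → a ∈ S → ¬ (B ∪ ⁅ a ⁆) ∈ᴱ H → B ∈ᴸ 𝓛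
      bads B B≡ a a∈S e∉ = ∈-filter⁺ (¬? ∘ good?) (∈-sets⁺ {A = B} B≡)
        (λ (_ , NS) → e∉ (proj₂ (∈-N⁻ (subst (a ∈_) (sym NS) a∈S))))

  -- In the bound on `#bad`, `w` is the coefficient of `#lc` and `r * K` that of `n ^ j`. The choice
  -- of `M₂` makes the first term at most half of the target, and the lower bound on `n` does so for
  -- the second.
  few-bad : ∀ M w K → w ≡ 1 + r * (2 + 4 * s * j ^ j) → K ≡ j * (j + ℓ) + j ^ j * ((2 * s + 1) * ℓ + 1) →
            M₂ ≡ c * (2 * j * M * w) → 2 * j ≤ n → 2 * j * M * r * K ≤ n → j * #bad * M ≤ n * n ^ j
  few-bad M w K w≡ K≡ M₂≡ 2j≤n large = *-cancelˡ-≤ 2 (arith₄ M #bad #lc w (r * K) j n (n ^ j) bad-bound lc-bound (≤-trans (≤-reflexive (eq₀ j M r K)) large))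
    where
    eq₀ : ∀ j M r K → 2 * j * M * (r * K) ≡ 2 * j * M * r * K
    eq₀ = solve-∀
    lc-bound : #lc * (2 * j * M * w) ≤ n * n ^ j
    lc-bound = *-cancelˡ-≤ c ⦃ subst NonZero (sym c≡) _ ⦄ (begin
      c * (#lc * (2 * j * M * w)) ≡⟨ eq₁ c #lc (2 * j * M * w) ⟩
      #lc * (c * (2 * j * M * w)) ≡⟨ cong (#lc *_) M₂≡ ⟨
      #lc * M₂                    ≤⟨ lightlyCovered-few ⟩
      n * (c * n ^ j)             ≡⟨ eq₁ n c (n ^ j) ⟩
      c * (n * n ^ j)             ∎)
      where
      open ≤-Reasoning
      eq₁ : ∀ a b d → a * (b * d) ≡ b * (a * d)
      eq₁ = solve-∀
    -- In `low-few` the term `j * #low` is at most half of the left side.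
    n#low : n * #low ≤ 2 * #lc
    n#low = arith n #low #lc j 2j≤n low-few
      where
      arith : ∀ n l c j → 2 * j ≤ n → n * l ≤ c + j * l → n * l ≤ 2 * c
      arith n l c j h₁ h₂ = ≤-certificate _ _ 0 (+-mono-≤ (*-monoˡ-≤ l h₁) (*-monoʳ-≤ 2 h₂)) (eq n l c j)
        where
        eq : ∀ n l c j → n * l + (n * l + 2 * (c + j * l)) + 0 ≡ 2 * c + (2 * j * l + 2 * (n * l))
        eq = solve-∀
    n#abnormal : n * #abnormal ≤ (2 + 4 * s * j ^ j) * #lc + K * n ^ j
    n#abnormal = subst (λ K → n * #abnormal ≤ (2 + 4 * s * j ^ j) * #lc + K * n ^ j) (sym K≡)
      (arith n #abnormal (# (degenerate? L) (tuples n j)) #low (length low) (length high) #lc (j ^ j) s ℓ j (n ^ i)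
        abnormal≤ (#-degenerate n j L ℓ ∣L∣≤) n#low high≤ low≤#low)
      where
      arith : ∀ n a d #l l h c J s ℓ j p → a ≤ d + (#l + h * J) → n * d ≤ j * (j + ℓ) * (n * p) → n * #l ≤ 2 * c →
        h ≤ 2 * s * l + ((2 * s + 1) * ℓ + 1) * p → l ≤ #l →
        n * a ≤ (2 + 4 * s * J) * c + (j * (j + ℓ) + J * ((2 * s + 1) * ℓ + 1)) * (n * p)
      arith n a d #l l h c J s ℓ j p h₁ h₂ h₃ h₄ h₅ = ≤-certificate _ _ 0
        (+-mono-≤ (*-monoʳ-≤ n h₁) (+-mono-≤ h₂ (+-mono-≤ (*-monoʳ-≤ (1 + 2 * s * J) h₃)
          (+-mono-≤ (*-monoʳ-≤ (n * J) h₄) (*-monoʳ-≤ (n * J * (2 * s)) h₅)))))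
        (eq n a d #l l h c J s ℓ j p)
        where
        eq : ∀ n a d #l l h c J s ℓ j p →
          n * a + (n * (d + (#l + h * J)) + (j * (j + ℓ) * (n * p) + ((1 + 2 * s * J) * (2 * c) + (n * J * (2 * s * l + ((2 * s + 1) * ℓ + 1) * p) + n * J * (2 * s) * #l)))) + 0
          ≡ (2 + 4 * s * J) * c + (j * (j + ℓ) + J * ((2 * s + 1) * ℓ + 1)) * (n * p) +
            (n * a + (n * d + ((1 + 2 * s * J) * (n * #l) + (n * J * h + n * J * (2 * s) * l))))
        eq = solve-∀
    bad-bound : #bad ≤ w * #lc + r * K * n ^ j
    bad-bound = subst (λ w → #bad ≤ w * #lc + r * K * n ^ j) (sym w≡)
      (arith #bad #lc r (n * #abnormal) (2 + 4 * s * j ^ j) K (n ^ j) bad≤ n#abnormal)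
      where
      arith : ∀ b c r a x K p → b ≤ c + r * a → a ≤ x * c + K * p → b ≤ (1 + r * x) * c + r * K * p
      arith b c r a x K p h₁ h₂ = ≤-certificate _ _ 0 (+-mono-≤ h₁ (*-monoʳ-≤ r h₂)) (eq b c r a x K p)
        where
        eq : ∀ b c r a x K p → b + (c + r * a + r * (x * c + K * p)) + 0 ≡ (1 + r * x) * c + r * K * p + (b + r * a)
        eq = solve-∀
    arith₄ : ∀ M b c w k j n p → b ≤ w * c + k * p → c * (2 * j * M * w) ≤ n * p → 2 * j * M * k ≤ n →
             2 * (j * b * M) ≤ 2 * (n * p)
    arith₄ M b c w k j n p h₁ h₂ h₃ = ≤-certificate _ _ 0
      (+-mono-≤ (*-monoʳ-≤ (2 * j * M) h₁) (+-mono-≤ h₂ (*-monoˡ-≤ p h₃))) (eq M b c w k j n p)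
      where
      eq : ∀ M b c w k j n p → 2 * (j * b * M) + (2 * j * M * (w * c + k * p) + (n * p + n * p)) + 0 ≡
           2 * (n * p) + (2 * j * M * b + (c * (2 * j * M * w) + 2 * j * M * k * p))
      eq = solve-∀

CommonHeadFrom : ℕ → ℕ → ℕ → ℕ → Set
CommonHeadFrom s i M m₀ = ∀ m → m₀ ≤ m → (H : Hypergraph (s + m) (2 + i)) → AllCovered (s + (1 + i)) H →
  size H ≤ ((s + m) C (2 + i) ∸ m C (2 + i)) + D m (2 + i) → CommonHead s i m H M

opaque
  -- The constants are fixed in the order `w`, `M₂`, `M₁`, `ℓ`, `K`. There is no circularity: `ℓ`
  -- depends on the threshold `M₁`, and only `K` and the lower bound on `m` depend on `ℓ`.
  common-head : ∀ s i M → 3 ≤ M → ∃ (CommonHeadFrom s i M)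
  common-head s i M 3≤M = 2 + i + (2 * j + 2 * j * M * r * K) , main
    where
    r j c w M₂ M₁ ℓ K : ℕ
    r = 2 + i
    j = 1 + i
    c = suc (suc s * r ^ r)
    w = 1 + r * (2 + 4 * s * j ^ j)
    M₂ = c * (2 * j * M * w)
    M₁ = 2 * M₂ ^ j
    ℓ = c * M₁ + s
    K = j * (j + ℓ) + j ^ j * ((2 * s + 1) * ℓ + 1)
    main : CommonHeadFrom s i M (2 + i + (2 * j + 2 * j * M * r * K))
    main m large H cov size≤ = conclusion M 3≤M (few-bad M w K refl refl refl
      (≤-trans (m≤m+n (2 * j) (2 * j * M * r * K)) (≤-trans rest (m≤n+m m s)))
      (≤-trans (m≤n+m (2 * j * M * r * K) (2 * j)) (≤-trans rest (m≤n+m m s))))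
      where
      rest : 2 * j + 2 * j * M * r * K ≤ m
      rest = ≤-trans (m≤n+m _ r) large
      open CommonType s i m (≤-trans (m≤m+n r _) large) H cov size≤ M₂ M₁ c ℓ refl refl refl
        using (conclusion; few-bad)

-- Relabelling of vertices, and the number of sets that meet the head.

module Relabelling where

  private variable
    n m i j k r s : ℕ
    A B : Subset n
    x y u : Fin n

  punchOut-<⁺ : ∀ {p y : Fin (suc n)} (p≢y : p ≢ y) → toℕ y < toℕ p → toℕ (punchOut p≢y) < toℕ p
  punchOut-<⁺ {n = suc n} {suc p} {zero}  _   _       = s≤s z≤n
  punchOut-<⁺ {n = suc n} {suc p} {suc y} p≢y (s≤s h) = s≤s (punchOut-<⁺ (p≢y ∘ cong suc) h)

  punchOut-<⁻ : ∀ {p y : Fin (suc n)} (p≢y : p ≢ y) → toℕ (punchOut p≢y) < toℕ p → toℕ y < toℕ p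
  punchOut-<⁻ {n = suc n} {suc p} {zero}  _   _       = s≤s z≤n
  punchOut-<⁻ {n = suc n} {suc p} {suc y} p≢y (s≤s h) = s≤s (punchOut-<⁻ (p≢y ∘ cong suc) h)

  Sorts : Permutation′ n → Subset n → Set
  Sorts π S = ∀ y → (toℕ y < ∣ S ∣ → π ⟨$⟩ˡ y ∈ S) × (π ⟨$⟩ˡ y ∈ S → toℕ y < ∣ S ∣)

  -- A first vertex in `S` stays first; one outside `S` is inserted at position `∣ S ∣`, directly
  -- behind the images of `S`.
  ∃-sorting : ∀ (S : Subset n) → ∃ λ π → Sorts π S
  ∃-sorting []           = id , λ ()
  ∃-sorting (inside ∷ S) with ∃-sorting S
  ... | π , h = lift₀ π , λ where
    zero    → (λ _ → here) , (λ _ → s≤s z≤n)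
    (suc y) → (λ { (s≤s y<) → there (proj₁ (h y) y<) }) , (λ { (there π∈) → s≤s (proj₂ (h y) π∈) })
  ∃-sorting {suc n} (outside ∷ S) with ∃-sorting S
  ... | π , h = insert zero p π , sorts
    where
    p : Fin (suc n)
    p = fromℕ< (s≤s (∣p∣≤n S))
    p≡ : toℕ p ≡ ∣ S ∣
    p≡ = toℕ-fromℕ< (s≤s (∣p∣≤n S))
    sorts : Sorts (insert zero p π) (outside ∷ S)
    sorts y with p ≟ᶠ y
    ... | yes refl = (λ y< → ⊥-elim (<-irrefl p≡ y<)) , λ ()
    ... | no  p≢y  =
      (λ y< → there (proj₁ (h (punchOut p≢y))
        (subst (toℕ (punchOut p≢y) <_) p≡ (punchOut-<⁺ p≢y (subst (toℕ y <_) (sym p≡) y<))))) ,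
      (λ { (there π∈) → subst (toℕ y <_) p≡ (punchOut-<⁻ p≢y
        (subst (toℕ (punchOut p≢y) <_) (sym p≡) (proj₂ (h (punchOut p≢y)) π∈))) })

  ∈-image⁻ : ∀ (π : Permutation′ n) (e : Subset n) {y} → y ∈ image π e → π ⟨$⟩ˡ y ∈ e
  ∈-image⁻ π e {y} y∈ = lookup⇒[]= _ e (trans (sym (lookup∘tabulate (λ i → lookup e (π ⟨$⟩ˡ i)) y)) ([]=⇒lookup y∈))

  ∈-image⁺ˡ : ∀ (π : Permutation′ n) (e : Subset n) {y} → π ⟨$⟩ˡ y ∈ e → y ∈ image π e
  ∈-image⁺ˡ π e {y} h = lookup⇒[]= y _ (trans (lookup∘tabulate (λ i → lookup e (π ⟨$⟩ˡ i)) y) ([]=⇒lookup h))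

  ∈-image⁺ : ∀ (π : Permutation′ n) {e : Subset n} {x} → x ∈ e → π ⟨$⟩ʳ x ∈ image π e
  ∈-image⁺ π {e} x∈ = ∈-image⁺ˡ π e (subst (_∈ e) (sym (inverseˡ π)) x∈)

  image-mono : ∀ (π : Permutation′ n) {A B : Subset n} → A ⊆ B → image π A ⊆ image π B
  image-mono π {A} {B} A⊆B y∈ = ∈-image⁺ˡ π B (A⊆B (∈-image⁻ π A y∈))

  image-flip : ∀ (π : Permutation′ n) (e : Subset n) → image π (image (flip π) e) ≡ e
  image-flip π e = ⊆-antisym
    (λ {y} y∈ → subst (_∈ e) (inverseʳ π) (∈-image⁻ (flip π) e (∈-image⁻ π (image (flip π) e) y∈)))
    (λ {y} y∈ → ∈-image⁺ˡ π (image (flip π) e) (∈-image⁺ˡ (flip π) e (subst (_∈ e) (sym (inverseʳ π)) y∈)))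

  flip-image : ∀ (π : Permutation′ n) (e : Subset n) → image (flip π) (image π e) ≡ e
  flip-image π e = ⊆-antisym
    (λ {y} y∈ → subst (_∈ e) (inverseˡ π) (∈-image⁻ π e (∈-image⁻ (flip π) (image π e) y∈)))
    (λ {y} y∈ → ∈-image⁺ˡ (flip π) (image π e) (∈-image⁺ π {e} y∈))

  image-injective : ∀ (π : Permutation′ n) {A B : Subset n} → image π A ≡ image π B → A ≡ B
  image-injective π {A} {B} eq = trans (sym (flip-image π A)) (trans (cong (image (flip π)) eq) (flip-image π B))

  ∣image∣≥ : ∀ (π : Permutation′ n) (e : Subset n) → ∣ e ∣ ≤ ∣ image π e ∣
  ∣image∣≥ π e = subst₂ _≤_ (length-elems e) (length-elems (image π e))
    (length-injective {xs = elems e} {ys = elems (image π e)} (π ⟨$⟩ʳ_) (elems-unique e)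
      (λ x∈ → ∈-elems⁺ {A = image π e} (∈-image⁺ π {e} (∈-elems⁻ {A = e} x∈)))
      (λ _ _ eq → trans (sym (inverseˡ π)) (trans (cong (π ⟨$⟩ˡ_) eq) (inverseˡ π))))

  ∣image∣ : ∀ (π : Permutation′ n) (e : Subset n) → ∣ image π e ∣ ≡ ∣ e ∣
  ∣image∣ π e = ≤-antisym
    (≤-trans (∣image∣≥ (flip π) (image π e)) (≤-reflexive (cong ∣_∣ (flip-image π e)))) (∣image∣≥ π e)

  image-∪ : ∀ (π : Permutation′ n) (B : Subset n) u → image π (B ∪ ⁅ u ⁆) ≡ image π B ∪ ⁅ π ⟨$⟩ʳ u ⁆
  image-∪ π B u = ⊆-antisym to
    (insert-⊆ (image-mono π {B} {B ∪ ⁅ u ⁆} ∈-insertˡ) (∈-image⁺ π {B ∪ ⁅ u ⁆} (∈-insertʳ B u)))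
    where
    to : image π (B ∪ ⁅ u ⁆) ⊆ image π B ∪ ⁅ π ⟨$⟩ʳ u ⁆
    to {y} y∈ with ∈-insert⁻ B (∈-image⁻ π (B ∪ ⁅ u ⁆) y∈)
    ... | inj₁ p    = ∈-insertˡ (∈-image⁺ˡ π B p)
    ... | inj₂ refl = subst (λ w → y ∈ image π B ∪ ⁅ w ⁆) (sym (inverseʳ π)) (∈-insertʳ (image π B) y)

  imageᴴ : Permutation′ n → Hypergraph n r → Hypergraph n r
  imageᴴ π H = record
    { edges   = map (image π) (edges H)
    ; uniform = All.tabulate λ e∈ → case ∈-map⁻ (image π) e∈ of λ where
        (e , e∈H , refl) → trans (∣image∣ π e) (All.lookup (uniform H) e∈H)
    ; unique  = Uniqueₚ.map⁺ (image-injective π) (unique H)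
    }

  size-imageᴴ : ∀ (π : Permutation′ n) (H : Hypergraph n r) → size (imageᴴ π H) ≡ size H
  size-imageᴴ π H = length-map (image π) (edges H)

  ≅-imageᴴ : ∀ (π : Permutation′ n) (H : Hypergraph n r) → H ≅ imageᴴ π H
  ≅-imageᴴ π H = π , λ e → mk⇔ (∈-map⁺ (image π)) λ πe∈ → case ∈-map⁻ (image π) πe∈ of λ where
    (e′ , e′∈ , eq) → subst (_∈ᴱ H) (sym (image-injective π eq)) e′∈

  ∈-imageᴴ : ∀ (π : Permutation′ n) (H : Hypergraph n r) B u →
             (image (flip π) B ∪ ⁅ u ⁆) ∈ᴱ H → (B ∪ ⁅ π ⟨$⟩ʳ u ⁆) ∈ᴱ imageᴴ π H
  ∈-imageᴴ π H B u h = subst (_∈ᴱ imageᴴ π H)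
    (trans (image-∪ π (image (flip π) B) u) (cong (_∪ ⁅ π ⟨$⟩ʳ u ⁆) (image-flip π B)))
    (∈-map⁺ (image π) h)

  imageᴴ-covered : ∀ (π : Permutation′ n) (H : Hypergraph n r) → AllCovered k H → AllCovered k (imageᴴ π H)
  imageᴴ-covered π H cov A A≡ with cov (image (flip π) A) (trans (∣image∣ (flip π) A) A≡)
  ... | u , u∉ , h = π ⟨$⟩ʳ u , (λ πu∈A → u∉ (∈-image⁺ˡ (flip π) A πu∈A)) ,
    λ B B⊆A B≡ → ∈-imageᴴ π H B u (h (image (flip π) B) (image-mono (flip π) B⊆A) (trans (∣image∣ (flip π) B) B≡))

  ∃-to-head : ∀ s (S : Subset (s + m)) → ∣ S ∣ ≡ s → ∃ λ π → ∀ {a : Fin (s + m)} → toℕ a < s → π ⟨$⟩ˡ a ∈ S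
  ∃-to-head s S S≡ with ∃-sorting S
  ... | π , h = π , λ {a} a< → proj₁ (h a) (subst (toℕ a <_) (sym S≡) a<)

  ι-tl-⊆ : ∀ s (e : Subset (s + m)) → ι s (tl s e) ⊆ e
  ι-tl-⊆ zero    e       x∈         = x∈
  ι-tl-⊆ (suc s) (_ ∷ e) (there x∈) = there (ι-tl-⊆ s e x∈)

  ∣head⊆∣ : ∀ s (A : Subset (s + m)) → headSet s ⊆ A → ∣ A ∣ ≡ s + ∣ tl s A ∣
  ∣head⊆∣ zero    A             _ = refl
  ∣head⊆∣ (suc s) (inside  ∷ A) h = cong suc (∣head⊆∣ s A (drop-∷-⊆ h))
  ∣head⊆∣ (suc s) (outside ∷ A) h = case h here of λ ()

  MeetsTop : ∀ s → Subset (s + m) → Set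
  MeetsTop s e = ∃ λ x → x ∈ e × toℕ x < s

  meetsTop? : ∀ s → Decidable (MeetsTop {m} s)
  meetsTop? s e = any? λ x → (x ∈? e) ×-dec (toℕ x <? s)

  ¬meets⇒ι : ∀ s (e : Subset (s + m)) → ¬ MeetsTop s e → ι s (tl s e) ≡ e
  ¬meets⇒ι s e ¬mt = ι-tl s e (λ x x∈ → ≮⇒≥ (λ x< → ¬mt (x , x∈ , x<)))

  ¬meets-ι : ∀ s (B : Subset m) → ¬ MeetsTop s (ι s B)
  ¬meets-ι s B (x , x∈ , x<) = <⇒≱ x< (∈-ι⇒≥ s x∈)

  meeting : ∀ s m r → List (Subset (s + m))
  meeting s m r = filter (meetsTop? s) (sets (s + m) r)

  ∈-meeting⁻ : ∀ {s m r} {e : Subset (s + m)} → e ∈ᴸ meeting s m r → ∣ e ∣ ≡ r × MeetsTop s e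
  ∈-meeting⁻ {s} {m} {r} e∈ = let (p , q) = ∈-filter⁻ (meetsTop? s) {xs = sets (s + m) r} e∈ in ∈-sets⁻ {n = s + m} p , q

  meeting-unique : ∀ s m r → Unique (meeting s m r)
  meeting-unique s m r = Uniqueₚ.filter⁺ (meetsTop? s) (unique (complete (s + m) r))

  meeting++ι-unique : ∀ s m r {T : List (Subset m)} → Unique T → Unique (meeting s m r ++ map (ι s) T)
  meeting++ι-unique s m r uT = Uniqueₚ.++⁺ (meeting-unique s m r) (Uniqueₚ.map⁺ (ι-injective s) uT)
    λ (p , q) → case ∈-map⁻ (ι s) q of λ { (B , _ , refl) → ¬meets-ι s B (proj₂ (∈-meeting⁻ {s} {m} {r} p)) }

  length-meeting++ι : ∀ s m r (T : List (Subset m)) →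
                      length (meeting s m r ++ map (ι s) T) ≡ length (meeting s m r) + length T
  length-meeting++ι s m r T = trans (length-++ (meeting s m r)) (cong (length (meeting s m r) +_) (length-map (ι s) T))

  -- The `r`-sets that do not meet the head are the copies under `ι s` of the `r`-sets of the tail.
  length-meeting : ∀ s m r → length (meeting s m r) ≡ (s + m) C r ∸ m C r
  length-meeting s m r = sym (trans (cong (_∸ m C r) (trans (sym (length-sets (s + m) r)) total)) (m+n∸n≡m _ (m C r)))
    where
    both : ℕ
    both = length (meeting s m r) + m C r
    total : length (sets (s + m) r) ≡ both
    total = trans (≤-antisym
      (length-mono (unique (complete (s + m) r)) split)
      (length-mono (meeting++ι-unique s m r (unique (complete m r))) join))
      (trans (length-meeting++ι s m r (sets m r)) (cong (length (meeting s m r) +_) (length-sets m r)))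
      where
      split : ∀ {e} → e ∈ᴸ sets (s + m) r → e ∈ᴸ meeting s m r ++ map (ι s) (sets m r)
      split {e} e∈ with meetsTop? s e
      ... | yes mt = ∈-++⁺ˡ (∈-filter⁺ (meetsTop? s) e∈ mt)
      ... | no ¬mt = ∈-++⁺ʳ (meeting s m r) (subst (_∈ᴸ map (ι s) (sets m r)) (¬meets⇒ι s e ¬mt)
        (∈-map⁺ (ι s) {x = tl s e} (∈-sets⁺ {A = tl s e} (trans (sym (∣ι∣ s (tl s e))) (trans (cong ∣_∣ (¬meets⇒ι s e ¬mt)) (∈-sets⁻ {n = s + m} e∈))))))
      join : ∀ {e} → e ∈ᴸ meeting s m r ++ map (ι s) (sets m r) → e ∈ᴸ sets (s + m) r
      join e∈ with ∈-++⁻ (meeting s m r) e∈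
      ... | inj₁ p = proj₁ (∈-filter⁻ (meetsTop? s) {xs = sets (s + m) r} p)
      ... | inj₂ q with ∈-map⁻ (ι s) q
      ...   | B , B∈ , refl = ∈-sets⁺ {A = ι s B} (trans (∣ι∣ s B) (∈-sets⁻ {n = m} B∈))

open Relabelling

-- Edges within the tail, and missing edges that meet the head.

tailEdges : ∀ s i m → Hypergraph (s + m) (2 + i) → Hypergraph m (2 + i)
tailEdges s i m H = hyper (2 + i) (λ e → ι s e ∈ᴱ? H)

module Tail (s i m : ℕ) (r≤m : 2 + i ≤ m) (H : Hypergraph (s + m) (2 + i)) (cov : AllCovered (s + (1 + i)) H) where

  n r j : ℕ
  n = s + m
  r = 2 + i
  j = 1 + i

  cover-≤ : ∀ A → ∣ A ∣ ≤ s + j → ∃ λ u → u ∉ A × (∀ Q → Q ⊆ A → ∣ Q ∣ ≡ j → (Q ∪ ⁅ u ⁆) ∈ᴱ H)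
  cover-≤ = covered-≤ H cov (+-monoʳ-≤ s (≤-trans (n≤1+n j) r≤m))

  T : List (Subset m)
  T = edges (tailEdges s i m H)

  ∣T∣ : ∀ {e} → e ∈ᴸ T → ∣ e ∣ ≡ r
  ∣T∣ e∈ = proj₁ (∈-hyper⁻ {r = r} (λ e → ι s e ∈ᴱ? H) e∈)

  ι-T : ∀ {e} → e ∈ᴸ T → ι s e ∈ᴱ H
  ι-T e∈ = proj₂ (∈-hyper⁻ {r = r} (λ e → ι s e ∈ᴱ? H) e∈)

  ∈-T : ∀ Q u → u ∉ Q → ∣ Q ∣ ≡ j → (ι s Q ∪ ⁅ s ↑ʳ u ⁆) ∈ᴱ H → (Q ∪ ⁅ u ⁆) ∈ᴸ T
  ∈-T Q u u∉ Q≡ h = ∈-hyper⁺ (λ e → ι s e ∈ᴱ? H) {e = Q ∪ ⁅ u ⁆}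
    (trans (∣A∪⁅u⁆∣ Q u u∉) (cong suc Q≡)) (subst (_∈ᴱ H) (sym (ι-∪ s Q u)) h)

  -- The whole head together with `P` has size `k`; a vertex covering this set must lie in the tail
  -- and gives an edge of `T` above `P`.
  T-contains : AllContained (tailEdges s i m H)
  T-contains P P≡ with cover-≤ (headSet s ∪ ι s P)
    (≤-trans (∣p∪q∣≤∣p∣+∣q∣ (headSet s) (ι s P)) (≤-reflexive (cong₂ _+_ (∣headSet∣ s) (trans (∣ι∣ s P) P≡))))
  ... | u , u∉ , h with head-or-tail s u
  ...   | inj₁ u< = ⊥-elim (u∉ (p⊆p∪q (ι s P) (∈-headSet⁺ s u<)))
  ...   | inj₂ (u′ , refl) = P ∪ ⁅ u′ ⁆ ,
    ∈-T P u′ (λ u∈ → u∉ (q⊆p∪q (headSet s) (ι s P) (∈-ι⁺ s u∈))) P≡ (h (ι s P) (q⊆p∪q (headSet s) (ι s P)) (trans (∣ι∣ s P) P≡)) ,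
    ∈-insertˡ

  D≤T : D m r ≤ length T
  D≤T = IsMinimum.least (D-isMinimum (s≤s z≤n) r≤m) (tailEdges s i m H) T-contains

  missing? : Decidable (λ e → ¬ e ∈ᴱ H)
  missing? e = ¬? (e ∈ᴱ? H)

  missing : List (Subset n)
  missing = filter missing? (meeting s m r)

  missing⁻ : ∀ {e} → e ∈ᴸ missing → ∣ e ∣ ≡ r × MeetsTop s e × ¬ e ∈ᴱ H
  missing⁻ e∈ with ∈-filter⁻ missing? {xs = meeting s m r} e∈
  ... | e∈m , e∉H = let (p , q) = ∈-meeting⁻ {s} {m} {r} e∈m in p , q , e∉H

  meeting+T≤ : length (meeting s m r) + length T ≤ size H + length missing
  meeting+T≤ = ≤-trans (≤-reflexive (sym (length-meeting++ι s m r T)))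
    (≤-trans (length-mono (meeting++ι-unique s m r (unique (tailEdges s i m H))) split) (≤-reflexive (length-++ (edges H))))
    where
    split : ∀ {e} → e ∈ᴸ meeting s m r ++ map (ι s) T → e ∈ᴸ edges H ++ missing
    split {e} e∈ with ∈-++⁻ (meeting s m r) e∈
    ... | inj₂ q with ∈-map⁻ (ι s) q
    ...   | B , B∈ , refl = ∈-++⁺ˡ (ι-T B∈)
    split {e} e∈ | inj₁ p with e ∈ᴱ? H
    ... | yes e∈H = ∈-++⁺ˡ e∈H
    ... | no  e∉H = ∈-++⁺ʳ (edges H) (∈-filter⁺ missing? p e∉H)

  -- The k-set (head ∖ {a}) ∪ R contains e ∖ {a}, so a missing edge e = (e ∖ {a}) ∪ {a} prevents a
  -- from covering it.
  missing-joined : ∀ {e} → e ∈ᴸ missing → ∀ R → tl s e ⊆ R → ∣ R ∣ ≡ r → ∃ λ u → u ∉ R × Joined T j R u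
  missing-joined {e} e∈ R tl⊆R R≡ with missing⁻ e∈
  ... | e≡ , (a , a∈e , a<s) , e∉H with cover-≤ ((headSet s - a) ∪ ι s R) bound
    where
    bound : ∣ (headSet s - a) ∪ ι s R ∣ ≤ s + j
    bound = ≤-trans (∣p∪q∣≤∣p∣+∣q∣ (headSet s - a) (ι s R)) (≤-reflexive
      (trans (cong (∣ headSet s - a ∣ +_) (trans (∣ι∣ s R) R≡)) (trans (+-suc ∣ headSet s - a ∣ j)
        (cong (_+ j) (trans (∣remove∣ (∈-headSet⁺ s a<s)) (∣headSet∣ s))))))
  ...   | u , u∉ , h with head-or-tail s u
  ...     | inj₂ (u′ , refl) = u′ , (λ u∈ → u∉ (q⊆p∪q (headSet s - a) (ι s R) (∈-ι⁺ s u∈))) ,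
    λ Q Q⊆R Q≡ → ∈-T Q u′ (λ u∈ → u∉ (q⊆p∪q (headSet s - a) (ι s R) (∈-ι⁺ s (Q⊆R u∈)))) Q≡
      (h (ι s Q) (λ x∈ → q⊆p∪q (headSet s - a) (ι s R) (ι-mono s Q⊆R x∈)) (trans (∣ι∣ s Q) Q≡))
  ...     | inj₁ u< with u ≟ᶠ a
  ...       | no u≢a = ⊥-elim (u∉ (p⊆p∪q (ι s R) (x∈p∧x≢y⇒x∈p-y (∈-headSet⁺ s u<) u≢a)))
  ...       | yes refl = ⊥-elim (e∉H (subst (_∈ᴱ H) (remove-insert a∈e)
    (h (e - a) sub (suc-injective (trans (∣remove∣ a∈e) e≡)))))
    where
    sub : e - a ⊆ (headSet s - a) ∪ ι s R
    sub x∈ with ∈-remove⁻ e x∈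
    ... | x∈e , x≢a with x∈p∪q⁻ (ι s (tl s e)) (headSet s) (tl∪headSet-⊇ s e x∈e)
    ...   | inj₁ p = q⊆p∪q (headSet s - a) (ι s R) (ι-mono s tl⊆R p)
    ...   | inj₂ q = p⊆p∪q (ι s R) (x∈p∧x≢y⇒x∈p-y q x≢a)

  -- `Savings` works with a uniform family, while `tl s e` may have any size up to `j`. Enlarging it
  -- is harmless, as `missing-joined` holds for all `r`-sets above `tl s e`.
  base : Subset n → Subset m
  base e = fillTo j (tl s e)

  tl-missing : ∀ {e} → e ∈ᴸ missing → ∣ tl s e ∣ ≤ j
  tl-missing {e} e∈ with missing⁻ e∈
  ... | e≡ , (a , a∈e , a<s) , _ = ≤-pred (≤-trans (∣tl∣< s e a∈e a<s) (≤-reflexive e≡))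

  base? : Decidable (λ B → Any.Any (λ e → base e ≡ B) missing)
  base? B = Any.any? (λ e → base e ≟ˢ B) missing

  𝓑 : List (Subset m)
  𝓑 = filter base? (sets m j)

  𝓑⁻ : ∀ {B} → B ∈ᴸ 𝓑 → ∃ λ e → e ∈ᴸ missing × base e ≡ B
  𝓑⁻ B∈ = find (proj₂ (∈-filter⁻ base? {xs = sets m j} B∈))

  ∣𝓑∣ : ∀ {B} → B ∈ᴸ 𝓑 → ∣ B ∣ ≡ j
  ∣𝓑∣ B∈ = ∈-sets⁻ {n = m} (proj₁ (∈-filter⁻ base? {xs = sets m j} B∈))

  𝓑-unique : Unique 𝓑
  𝓑-unique = Uniqueₚ.filter⁺ base? (unique (complete m j))

  ∣base∣ : ∀ {e} → e ∈ᴸ missing → ∣ base e ∣ ≡ j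
  ∣base∣ {e} e∈ = ∣fillTo∣ (tl s e) (tl-missing e∈) (≤-trans (n≤1+n j) r≤m)

  𝓑-joined : ∀ {B} → B ∈ᴸ 𝓑 → ∀ R → B ⊆ R → ∣ R ∣ ≡ r → ∃ λ u → u ∉ R × Joined T j R u
  𝓑-joined B∈ R B⊆R R≡ with 𝓑⁻ B∈
  ... | e , e∈ , refl = missing-joined e∈ R (λ x∈ → B⊆R (⊆-fillTo j (tl s e) x∈)) R≡

  -- A missing edge is determined by its base, by which subset of the base is its tail part, and by
  -- its head part.
  missing≤ : length missing ≤ length 𝓑 * (2 ^ j * 2 ^ s)
  missing≤ = length-fibres (λ B → concatMap (prepends s) (subsetsOf B)) (Uniqueₚ.filter⁺ missing? (meeting-unique s m r))
    (λ {e} e∈ → base e , ∈-filter⁺ base? (∈-sets⁺ {A = base e} (∣base∣ e∈)) (lose e∈ refl) ,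
      ∈-concatMap {h = prepends s} {x = tl s e} (∈-subsetsOf {A = tl s e} {B = base e} (⊆-fillTo j (tl s e))) (∈-prepends s e))
    (λ {B} B∈ → ≤-trans
      (length-concatMap≤ (prepends s) (subsetsOf B) {2 ^ s} (λ {C} _ → ≤-reflexive (length-prepends s C)))
      (≤-reflexive (cong (_* 2 ^ s) (trans (length-subsetsOf B) (cong (2 ^_) (∣𝓑∣ B∈))))))

  -- If `tl s e` has size `j`, then `e` arises from it by adding one head vertex, and `ι s (tl s e)`
  -- is exceptional. Otherwise `tl s e` is one of at most `j * m ^ i` smaller sets.
  𝓑≤ : ∀ 𝓛 → (∀ B → ∣ B ∣ ≡ j → ∀ a → toℕ a < s → ¬ (B ∪ ⁅ a ⁆) ∈ᴱ H → B ∈ᴸ 𝓛) → length 𝓑 ≤ length 𝓛 + j * m ^ i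
  𝓑≤ 𝓛 bad = begin
    length 𝓑 ≤⟨ length-mono 𝓑-unique split ⟩
    length (map (tl s) 𝓛 ++ map (fillTo j) small) ≡⟨ length-++ (map (tl s) 𝓛) ⟩
    length (map (tl s) 𝓛) + length (map (fillTo j) small) ≡⟨ cong₂ _+_ (length-map (tl s) 𝓛) (length-map (fillTo j) small) ⟩
    length 𝓛 + length small ≤⟨ +-monoʳ-≤ (length 𝓛) small≤ ⟩
    length 𝓛 + j * m ^ i ∎
    where
    open ≤-Reasoning
    small : List (Subset m)
    small = concatMap (sets m) (upTo j)
    small≤ : length small ≤ j * m ^ i
    small≤ = ≤-trans (length-concatMap≤ (sets m) (upTo j) {m ^ i}
      (λ {p} p∈ → ≤-trans (length-sets≤^ m p) (^-monoʳ-≤ m ⦃ >-nonZero (≤-trans (s≤s z≤n) r≤m) ⦄ (≤-pred (∈-upTo⁻ p∈)))))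
      (≤-reflexive (cong (_* m ^ i) (length-upTo j)))
    split : ∀ {B} → B ∈ᴸ 𝓑 → B ∈ᴸ map (tl s) 𝓛 ++ map (fillTo j) small
    split B∈ with 𝓑⁻ B∈
    ... | e , e∈ , refl with ∣ tl s e ∣ ≟ j
    ...   | no  C≢ = ∈-++⁺ʳ (map (tl s) 𝓛) (∈-map⁺ (fillTo j) {x = tl s e}
      (∈-concatMap {h = sets m} (∈-upTo⁺ (≤∧≢⇒< (tl-missing e∈) C≢)) (∈-sets⁺ {A = tl s e} refl)))
    ...   | yes C≡ with missing⁻ e∈
    ...     | e≡ , (a , a∈e , a<s) , e∉H = ∈-++⁺ˡ (subst (_∈ᴸ map (tl s) 𝓛) tl≡base (∈-map⁺ (tl s) ιC∈))
      where
      C = tl s e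
      ιC∪a≡e : ι s C ∪ ⁅ a ⁆ ≡ e
      ιC∪a≡e = ⊆∧∣≥∣⇒≡ (insert-⊆ (ι-tl-⊆ s e) a∈e) (≤-reflexive (trans e≡ (sym
        (trans (∣A∪⁅u⁆∣ (ι s C) a (λ a∈ → <⇒≱ a<s (∈-ι⇒≥ s a∈))) (cong suc (trans (∣ι∣ s C) C≡))))))
      ιC∈ : ι s C ∈ᴸ 𝓛
      ιC∈ = bad (ι s C) (trans (∣ι∣ s C) C≡) a a<s (λ h → e∉H (subst (_∈ᴱ H) ιC∪a≡e h))
      tl≡base : tl s (ι s C) ≡ base e
      tl≡base = trans (tl-ι s C) (⊆∧∣≥∣⇒≡ (⊆-fillTo j C) (≤-reflexive (trans (∣base∣ e∈) (sym C≡))))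

  open Savings m i r≤m T (unique (tailEdges s i m H)) ∣T∣ T-contains 𝓑 𝓑-unique ∣𝓑∣ 𝓑-joined using (savings)

  -- With `c = 2 ^ j * 2 ^ s`, a member of `𝓑` accounts for at most `c` missing edges but forces
  -- `suc c` additional edges in `T`. The bound on `size H` thus leaves no room for any member of
  -- `𝓑`.
  nothing-missing : size H ≤ ((s + m) C r ∸ m C r) + D m r → 2 * (1 + i + overcount i) ≤ m →
    (let M = 4 * overcount i * suc (i ^ i) * suc (2 ^ j * 2 ^ s) in length 𝓑 * (M * (2 * M ^ i)) ≤ m ^ j) →
    length missing ≡ 0
  nothing-missing size≤ m-large 𝓑-small = n≤0⇒n≡0
    (arith (length (meeting s m r)) (length T) (size H) (length missing) (D m r) (length 𝓑) (2 ^ j * 2 ^ s)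
      meeting+T≤ (≤-trans size≤ (≤-reflexive (cong (_+ D m r) (sym (length-meeting s m r))))) missing≤
      (savings (2 ^ j * 2 ^ s) m-large 𝓑-small))
    where
    arith : ∀ x t h μ d b c → x + t ≤ h + μ → h ≤ x + d → μ ≤ b * c → d + suc c * b ≤ t → μ ≤ 0
    arith x t h μ d b c h₁ h₂ h₃ h₄ = ≤-trans h₃ (≤-reflexive (cong (_* c) (n≤0⇒n≡0 b≤0)))
      where
      b≤0 : b ≤ 0
      b≤0 = ≤-certificate b 0 0 (+-mono-≤ h₁ (+-mono-≤ h₂ (+-mono-≤ h₃ h₄))) (eq x t h μ d b c)
        where
        eq : ∀ x t h μ d b c → b + (h + μ + (x + d + (b * c + t))) + 0 ≡ 0 + (x + t + (h + (μ + (d + suc c * b))))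
        eq = solve-∀

  Full : Set
  Full = ∀ e → ∣ e ∣ ≡ r → MeetsTop s e → e ∈ᴱ H

  full : length missing ≡ 0 → Full
  full none e e≡ mt with e ∈ᴱ? H
  ... | yes e∈H = e∈H
  ... | no  e∉H = ⊥-elim (empty none (∈-filter⁺ missing? (∈-filter⁺ (meetsTop? s) (∈-sets⁺ {A = e} e≡) mt) e∉H))
    where
    empty : ∀ {X : Set} {xs : List X} {x} → length xs ≡ 0 → ¬ x ∈ᴸ xs
    empty {xs = []} _ ()

  full-size : Full → ((s + m) C r ∸ m C r) + length T ≤ size H
  full-size full = begin
    (n C r ∸ m C r) + length T            ≡⟨ cong (_+ length T) (length-meeting s m r) ⟨
    length (meeting s m r) + length T     ≡⟨ length-meeting++ι s m r T ⟨
    length (meeting s m r ++ map (ι s) T) ≤⟨ length-mono (meeting++ι-unique s m r (unique (tailEdges s i m H))) sub ⟩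
    size H                                ∎
    where
    open ≤-Reasoning
    sub : ∀ {e} → e ∈ᴸ meeting s m r ++ map (ι s) T → e ∈ᴱ H
    sub {e} e∈ with ∈-++⁻ (meeting s m r) e∈
    ... | inj₁ p = let (e≡ , mt) = ∈-meeting⁻ {s} {m} {r} p in full e e≡ mt
    ... | inj₂ q = case ∈-map⁻ (ι s) q of λ { (B , B∈ , refl) → ι-T B∈ }

-- The construction that attains the bound.

module Extremal (s i m : ℕ) (T₀ : Hypergraph m (2 + i)) (T₀-contains : AllContained T₀) where

  n r j : ℕ
  n = s + m
  r = 2 + i
  j = 1 + i

  edge? : Decidable (λ e → MeetsTop s e ⊎ e ∈ᴸ map (ι s) (edges T₀))
  edge? e = meetsTop? s e ⊎-dec ∈ᴸ? _≟ˢ_ e (map (ι s) (edges T₀))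

  G₀ : Hypergraph n r
  G₀ = hyper r edge?

  size-G₀ : size G₀ ≤ ((s + m) C r ∸ m C r) + size T₀
  size-G₀ = begin
    size G₀                                        ≤⟨ length-mono (unique G₀) sub ⟩
    length (meeting s m r ++ map (ι s) (edges T₀)) ≡⟨ length-meeting++ι s m r (edges T₀) ⟩
    length (meeting s m r) + size T₀               ≡⟨ cong (_+ size T₀) (length-meeting s m r) ⟩
    (n C r ∸ m C r) + size T₀                      ∎
    where
    open ≤-Reasoning
    sub : ∀ {e} → e ∈ᴱ G₀ → e ∈ᴸ meeting s m r ++ map (ι s) (edges T₀)
    sub {e} e∈ with ∈-hyper⁻ {r = r} edge? e∈
    ... | e≡ , inj₁ mt = ∈-++⁺ˡ (∈-filter⁺ (meetsTop? s) (∈-sets⁺ {A = e} e≡) mt)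
    ... | e≡ , inj₂ q  = ∈-++⁺ʳ (meeting s m r) q

  meets-edge : ∀ B u → ∣ B ∣ ≡ j → u ∉ B → MeetsTop s (B ∪ ⁅ u ⁆) → (B ∪ ⁅ u ⁆) ∈ᴱ G₀
  meets-edge B u B≡ u∉B mt = ∈-hyper⁺ edge? {e = B ∪ ⁅ u ⁆} (trans (∣A∪⁅u⁆∣ B u u∉B) (cong suc B≡)) (inj₁ mt)

  -- A head vertex outside `A` covers `A`. If `A` contains the whole head, exactly `j` of its
  -- vertices are in the tail, and the remaining vertex of an edge of `T₀` above them covers `A`.
  G₀-covered : AllCovered (s + j) G₀
  G₀-covered A A≡ with any? (λ a → (a ∈? headSet s) ×-dec ¬? (a ∈? A))
  ... | yes (a , a∈ , a∉A) = a , a∉A , λ B B⊆A B≡ →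
    meets-edge B a B≡ (a∉A ∘ B⊆A) (a , ∈-insertʳ B a , ∈-headSet⁻ s a∈)
  ... | no ¬p = u , u∉A , edge
    where
    head⊆A : headSet s ⊆ A
    head⊆A {a} a∈ with a ∈? A
    ... | yes a∈A = a∈A
    ... | no  a∉A = ⊥-elim (¬p (a , a∈ , a∉A))
    P = tl s A
    P≡ : ∣ P ∣ ≡ j
    P≡ = +-cancelˡ-≡ s _ _ (trans (sym (∣head⊆∣ s A head⊆A)) A≡)
    contained = T₀-contains P P≡
    e = proj₁ contained
    e∈ : e ∈ᴱ T₀
    e∈ = proj₁ (proj₂ contained)
    P⊆e : P ⊆ e
    P⊆e = proj₂ (proj₂ contained)
    e≡ : ∣ e ∣ ≡ r
    e≡ = All.lookup (uniform T₀) e∈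
    extra = ∃∈∉ P e (≤-reflexive (trans (cong suc P≡) (sym e≡)))
    u′ = proj₁ extra
    u = s ↑ʳ u′
    P∪u′≡e : P ∪ ⁅ u′ ⁆ ≡ e
    P∪u′≡e = ⊆∧∣≥∣⇒≡ (insert-⊆ P⊆e (proj₁ (proj₂ extra)))
      (≤-reflexive (trans e≡ (sym (trans (∣A∪⁅u⁆∣ P u′ (proj₂ (proj₂ extra))) (cong suc P≡)))))
    u∉head : u ∉ headSet s
    u∉head u∈ = <⇒≱ (∈-headSet⁻ s u∈) (∈-ι⇒≥ s (∈-ι⁺ s (proj₁ (proj₂ extra))))
    u∉A : u ∉ A
    u∉A u∈A with x∈p∪q⁻ (ι s P) (headSet s) (tl∪headSet-⊇ s A u∈A)
    ... | inj₁ p = proj₂ (proj₂ extra) (∈-ι⁻ s p)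
    ... | inj₂ q = u∉head q
    edge : ∀ B → B ⊆ A → ∣ B ∣ ≡ j → (B ∪ ⁅ u ⁆) ∈ᴱ G₀
    -- By its size, `B` either meets the head or is the whole tail part of `A`.
    edge B B⊆A B≡ with meetsTop? s B
    ... | yes (x , x∈ , x<) = meets-edge B u B≡ (u∉A ∘ B⊆A) (x , ∈-insertˡ x∈ , x<)
    ... | no ¬mt = ∈-hyper⁺ edge? {e = B ∪ ⁅ u ⁆} (trans (∣A∪⁅u⁆∣ B u (u∉A ∘ B⊆A)) (cong suc B≡))
      (inj₂ (subst (_∈ᴸ map (ι s) (edges T₀)) (sym B∪u≡) (∈-map⁺ (ι s) e∈)))
      where
      ∣tlB∣ : ∣ tl s B ∣ ≡ j
      ∣tlB∣ = trans (sym (∣ι∣ s (tl s B))) (trans (cong ∣_∣ (¬meets⇒ι s B ¬mt)) B≡)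
      tlB≡P : tl s B ≡ P
      tlB≡P = ⊆∧∣≥∣⇒≡ (tl-mono s B⊆A) (≤-reflexive (trans P≡ (sym ∣tlB∣)))
      B∪u≡ : B ∪ ⁅ u ⁆ ≡ ι s e
      B∪u≡ = trans (cong (_∪ ⁅ u ⁆) (trans (sym (¬meets⇒ι s B ¬mt)) (cong (ι s) tlB≡P)))
        (trans (sym (ι-∪ s P u′)) (cong (ι s) P∪u′≡e))

-- For large `m`, all `r`-sets meeting the relabelled head are edges.

*-^-distrib : ∀ a b p → (a * b) ^ p ≡ a ^ p * b ^ p
*-^-distrib a b zero    = refl
*-^-distrib a b (suc p) = trans (cong (a * b *_) (*-^-distrib a b p)) (rearrange a b (a ^ p) (b ^ p))
  where
  rearrange : ∀ a b c d → a * b * (c * d) ≡ a * c * (b * d)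
  rearrange = solve-∀

FullImage : ∀ s i m → 2 + i ≤ m → (H : Hypergraph (s + m) (2 + i)) → AllCovered (s + (1 + i)) H → Set
FullImage s i m r≤m H cov = ∃ λ π → Tail.Full s i m r≤m (imageᴴ π H) (imageᴴ-covered π H cov)

FullFrom : ℕ → ℕ → ℕ → Set
FullFrom s i m₀ = ∀ m → m₀ ≤ m → (r≤m : 2 + i ≤ m) (H : Hypergraph (s + m) (2 + i)) (cov : AllCovered (s + (1 + i)) H) →
  size H ≤ ((s + m) C (2 + i) ∸ m C (2 + i)) + D m (2 + i) → FullImage s i m r≤m H cov

opaque
  -- `M` and `X` are dictated by `nothing-missing`. In `M′` the factor `2 ^ j` pays for
  -- `s + m ≤ 2 * m`, the factor 2 leaves half of the budget on `𝓑` to the `j * m ^ i` smaller tail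
  -- parts, and the summand 3 meets the condition of `common-head`.
  ∃-full : ∀ s i → ∃ (FullFrom s i)
  ∃-full s i = proj₁ common + (s + (2 * (1 + i + overcount i) + 2 * j * X)) , main
    where
    j M X M′ : ℕ
    j = 1 + i
    M = 4 * overcount i * suc (i ^ i) * suc (2 ^ j * 2 ^ s)
    X = M * (2 * M ^ i)
    M′ = 3 + 2 * X * 2 ^ j
    common : ∃ (CommonHeadFrom s i M′)
    common = common-head s i M′ (s≤s (s≤s (s≤s z≤n)))
    main : FullFrom s i (proj₁ common + (s + (2 * (1 + i + overcount i) + 2 * j * X)))
    main m large r≤m H cov size≤ = finish (proj₂ common m (≤-trans (m≤m+n _ _) large) H cov size≤)
      where
      rest : s + (2 * (1 + i + overcount i) + 2 * j * X) ≤ m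
      rest = ≤-trans (m≤n+m _ (proj₁ common)) large
      s≤m : s ≤ m
      s≤m = ≤-trans (m≤m+n s _) rest
      m-large : 2 * (1 + i + overcount i) ≤ m
      m-large = ≤-trans (m≤m+n _ (2 * j * X)) (≤-trans (m≤n+m _ s) rest)
      m-large′ : 2 * j * X ≤ m
      m-large′ = ≤-trans (m≤n+m _ (2 * (1 + i + overcount i))) (≤-trans (m≤n+m _ s) rest)
      finish : CommonHead s i m H M′ → FullImage s i m r≤m H cov
      finish (S , S≡ , 𝓛 , 𝓛-small , bad) = π ,
        Tail.full s i m r≤m H′ cov′ (Tail.nothing-missing s i m r≤m H′ cov′
          (≤-trans (≤-reflexive (size-imageᴴ π H)) size≤) m-large 𝓑-small)
        where
        sorting : ∃ λ (π : Permutation′ (s + m)) → ∀ {a} → toℕ a < s → π ⟨$⟩ˡ a ∈ S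
        sorting = ∃-to-head s S S≡
        π : Permutation′ (s + m)
        π = proj₁ sorting
        H′ : Hypergraph (s + m) (2 + i)
        H′ = imageᴴ π H
        cov′ : AllCovered (s + (1 + i)) H′
        cov′ = imageᴴ-covered π H cov
        𝓛′ : List (Subset (s + m))
        𝓛′ = map (image π) 𝓛
        bad′ : ∀ B → ∣ B ∣ ≡ j → ∀ a → toℕ a < s → ¬ (B ∪ ⁅ a ⁆) ∈ᴱ H′ → B ∈ᴸ 𝓛′
        bad′ B B≡ a a<s e∉ = subst (_∈ᴸ 𝓛′) (image-flip π B) (∈-map⁺ (image π)
          (bad (image (flip π) B) (trans (∣image∣ (flip π) B) B≡) (π ⟨$⟩ˡ a) (proj₂ sorting a<s)
            (λ h → e∉ (subst (λ w → (B ∪ ⁅ w ⁆) ∈ᴱ H′) (inverseʳ π) (∈-imageᴴ π H B (π ⟨$⟩ˡ a) h)))))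
        𝓛≤ : length 𝓛 * (2 * X) ≤ m ^ j
        𝓛≤ = *-cancelʳ-≤ _ _ (2 ^ j) ⦃ m^n≢0 2 j ⦄ (begin
          length 𝓛 * (2 * X) * 2 ^ j  ≡⟨ *-assoc (length 𝓛) (2 * X) (2 ^ j) ⟩
          length 𝓛 * (2 * X * 2 ^ j)  ≤⟨ *-monoʳ-≤ (length 𝓛) (m≤n+m (2 * X * 2 ^ j) 3) ⟩
          length 𝓛 * M′               ≤⟨ 𝓛-small ⟩
          (s + m) ^ j                 ≤⟨ ^-monoˡ-≤ j (≤-trans (+-monoˡ-≤ m s≤m) (≤-reflexive (double m))) ⟩
          (m * 2) ^ j                 ≡⟨ *-^-distrib m 2 j ⟩
          m ^ j * 2 ^ j               ∎)
          where
          open ≤-Reasoning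
          double : ∀ m → m + m ≡ m * 2
          double = solve-∀
        𝓑 : List (Subset m)
        𝓑 = Tail.𝓑 s i m r≤m H′ cov′
        𝓑-small : length 𝓑 * X ≤ m ^ j
        𝓑-small = *-cancelˡ-≤ 2 (arith (length 𝓑) (length 𝓛) X j m (m ^ i)
          (≤-trans (Tail.𝓑≤ s i m r≤m H′ cov′ 𝓛′ bad′) (≤-reflexive (cong (_+ j * m ^ i) (length-map (image π) 𝓛)))) 𝓛≤ m-large′)
          where
          arith : ∀ b l x j m p → b ≤ l + j * p → l * (2 * x) ≤ m * p → 2 * j * x ≤ m → 2 * (b * x) ≤ 2 * (m * p)
          arith b l x j m p h₁ h₂ h₃ = ≤-certificate _ _ 0 (+-mono-≤ (*-monoʳ-≤ (2 * x) h₁) (+-mono-≤ h₂ (*-monoˡ-≤ p h₃))) (eq b l x j m p)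
            where
            eq : ∀ b l x j m p → 2 * (b * x) + (2 * x * (l + j * p) + (m * p + m * p)) + 0 ≡
                                 2 * (m * p) + (2 * x * b + (l * (2 * x) + 2 * j * x * p))
            eq = solve-∀

-- The value of `f` and the structure of the extremal hypergraphs.

g-cong : ∀ n k r {m} → (n ∸ k) + (r ∸ 1) ≡ m → g n k r ≡ (n C r ∸ m C r) + D m r
g-cong n k r refl = refl

module Conclude (s i m : ℕ) (r≤m : 2 + i ≤ m)
  (structure : (H : Hypergraph (s + m) (2 + i)) (cov : AllCovered (s + (1 + i)) H) →
    size H ≤ ((s + m) C (2 + i) ∸ m C (2 + i)) + D m (2 + i) →
    FullImage s i m r≤m H cov)
  where

  n r j k : ℕ
  n = s + m
  r = 2 + i
  j = 1 + i
  k = s + j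

  tail-size : (n ∸ k) + (r ∸ 1) ≡ m
  tail-size = trans (cong (_+ j) ([m+n]∸[m+o]≡n∸o s m j)) (m∸n+n≡m (≤-trans (n≤1+n j) r≤m))

  head-size : suc k ∸ r ≡ s
  head-size = m+n∸n≡m s j

  g≡ : g n k r ≡ (n C r ∸ m C r) + D m r
  g≡ = g-cong n k r tail-size

  f-min : IsMinimum {n} {r} (AllCovered k) (f n k r)
  f-min = f-isMinimum (s≤s z≤n) (+-monoʳ-< s r≤m)

  f≤ : f n k r ≤ (n C r ∸ m C r) + D m r
  f≤ = bound (IsMinimum.attained (D-isMinimum {m} {r} (s≤s z≤n) r≤m))
    where
    bound : (∃ λ (T : Hypergraph m r) → AllContained T × size T ≡ D m r) → f n k r ≤ (n C r ∸ m C r) + D m r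
    bound (T₀ , contains , T₀≡) = ≤-trans (IsMinimum.least f-min G₀ G₀-covered)
      (≤-trans size-G₀ (≤-reflexive (cong ((n C r ∸ m C r) +_) T₀≡)))
      where open Extremal s i m T₀ contains using (G₀; G₀-covered; size-G₀)

  -- By `f≤` a minimum hypergraph is small enough for `structure`. Once relabelled, it contains all
  -- `r`-sets meeting the head and a covering of the tail, which has at least `D m r` edges.
  ≤f : (n C r ∸ m C r) + D m r ≤ f n k r
  ≤f = bound (IsMinimum.attained f-min)
    where
    bound : (∃ λ (H : Hypergraph n r) → AllCovered k H × size H ≡ f n k r) → (n C r ∸ m C r) + D m r ≤ f n k r
    bound (H , cov , H≡) = bound′ (structure H cov (≤-trans (≤-reflexive H≡) f≤))
      where
      bound′ : FullImage s i m r≤m H cov → (n C r ∸ m C r) + D m r ≤ f n k r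
      bound′ (π , full) = ≤-trans
        (+-monoʳ-≤ (n C r ∸ m C r) (Tail.D≤T s i m r≤m (imageᴴ π H) (imageᴴ-covered π H cov)))
        (≤-trans (Tail.full-size s i m r≤m (imageᴴ π H) (imageᴴ-covered π H cov) full)
          (≤-reflexive (trans (size-imageᴴ π H) H≡)))

  f≡g : f n k r ≡ g n k r
  f≡g = trans (≤-antisym f≤ ≤f) (sym g≡)

  -- Equality of sizes forces the relabelled hypergraph to have exactly `D m r` edges in the tail;
  -- all its other edges meet the head, and every such `r`-set occurs.
  extremal : ∀ (H : Hypergraph n r) → size H ≡ f n k r → AllCovered k H → ∃ λ G → 𝒢 n k r G × H ≅ G
  extremal H H≡ cov = G , (Tᴴ , collection , characterised) , ≅-imageᴴ π H
    where
    structured : FullImage s i m r≤m H cov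
    structured = structure H cov (≤-trans (≤-reflexive H≡) f≤)
    π = proj₁ structured
    full = proj₂ structured
    G = imageᴴ π H
    module G = Tail s i m r≤m G (imageᴴ-covered π H cov)
    size-T : length G.T ≡ D m r
    size-T = ≤-antisym
      (+-cancelˡ-≤ (n C r ∸ m C r) _ _ (≤-trans (G.full-size full) (≤-trans (≤-reflexive (trans (size-imageᴴ π H) H≡)) f≤)))
      G.D≤T
    Tᴴ : Hypergraph n r
    Tᴴ = record
      { edges   = map (ι s) G.T
      ; uniform = All.tabulate λ e∈ → case ∈-map⁻ (ι s) e∈ of λ { (B , B∈ , refl) → trans (∣ι∣ s B) (G.∣T∣ B∈) }
      ; unique  = Uniqueₚ.map⁺ (ι-injective s) (unique (tailEdges s i m G))
      }
    inTail⇒ι : ∀ A → InTail k r A → ι s (tl s A) ≡ A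
    inTail⇒ι A h = ι-tl s A (λ x x∈ → subst (_≤ toℕ x) head-size (h x x∈))
    collection : TailCollection n k r Tᴴ
    collection = record
      { inTail  = λ e e∈ x x∈ → case ∈-map⁻ (ι s) e∈ of λ where
          (B , B∈ , refl) → subst (_≤ toℕ x) (sym head-size) (∈-ι⇒≥ s x∈)
      ; covers  = λ A inT A≡ →
          let (e , e∈ , tl⊆e) = G.T-contains (tl s A) (trans (sym (∣ι∣ s (tl s A))) (trans (cong ∣_∣ (inTail⇒ι A inT)) A≡))
          in ι s e , ∈-map⁺ (ι s) e∈ , λ {x} x∈ → ι-mono s tl⊆e (subst (x ∈_) (sym (inTail⇒ι A inT)) x∈)
      ; minimal = trans (length-map (ι s) G.T) (trans size-T (cong (λ w → D w r) (sym tail-size)))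
      }
    characterised : ∀ e → e ∈ᴱ G ⇔ ((∣ e ∣ ≡ r × MeetsHead k r e) ⊎ e ∈ᴱ Tᴴ)
    characterised e = mk⇔ to from
      where
      to : e ∈ᴱ G → (∣ e ∣ ≡ r × MeetsHead k r e) ⊎ e ∈ᴱ Tᴴ
      to e∈ = by (meetsTop? s e)
        where
        by : Dec (MeetsTop s e) → (∣ e ∣ ≡ r × MeetsHead k r e) ⊎ e ∈ᴱ Tᴴ
        by (yes (x , x∈ , x<)) = inj₁ (All.lookup (uniform G) e∈ , x , x∈ , subst (toℕ x <_) (sym head-size) x<)
        by (no ¬mt) = inj₂ (subst (_∈ᴸ map (ι s) G.T) ιtl≡e (∈-map⁺ (ι s) {x = tl s e}
          (∈-hyper⁺ (λ e → ι s e ∈ᴱ? G) {e = tl s e}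
            (trans (sym (∣ι∣ s (tl s e))) (trans (cong ∣_∣ ιtl≡e) (All.lookup (uniform G) e∈)))
            (subst (_∈ᴱ G) (sym ιtl≡e) e∈))))
          where
          ιtl≡e : ι s (tl s e) ≡ e
          ιtl≡e = ¬meets⇒ι s e ¬mt
      from : (∣ e ∣ ≡ r × MeetsHead k r e) ⊎ e ∈ᴱ Tᴴ → e ∈ᴱ G
      from (inj₁ (e≡ , x , x∈ , x<)) = full e e≡ (x , x∈ , subst (toℕ x <_) head-size x<)
      from (inj₂ q) = case ∈-map⁻ (ι s) q of λ { (B , B∈ , refl) → G.ι-T B∈ }

Claim : ℕ → ℕ → ℕ → Set
Claim n k r = f n k r ≡ g n k r ×
  (∀ (H : Hypergraph n r) → size H ≡ f n k r → AllCovered k H → ∃ λ (G : Hypergraph n r) → 𝒢 n k r G × H ≅ G)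

-- Each large `n` is written as `s + m`; the summands of `n₀` ensure `s ≤ n`, `m₀ ≤ m` and
-- `2 + i ≤ m`.
claim : ∀ s i → ∃ λ n₀ → ∀ n → n₀ < n → Claim n (s + suc i) (2 + i)
claim s i = n₀ , λ n n₀<n → subst (λ n → Claim n (s + suc i) (2 + i)) (m+[n∸m]≡n (≤-trans (m≤m+n s _) (<⇒≤ n₀<n)))
  (main (n ∸ s) (m+n≤o⇒m≤o∸n _ (≤-trans (≤-reflexive (+-comm _ s)) (<⇒≤ n₀<n))))
  where
  m₀ = proj₁ (∃-full s i)
  n₀ = s + (m₀ + (2 + i))
  main : ∀ m → m₀ + (2 + i) ≤ m → Claim (s + m) (s + suc i) (2 + i)
  main m large = C.f≡g , C.extremal
    where
    r≤m = ≤-trans (m≤n+m (2 + i) m₀) large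
    module C = Conclude s i m r≤m (proj₂ (∃-full s i) m (≤-trans (m≤m+n m₀ _) large) r≤m)

theorem1 : ∀ (r k : ℕ) → 2 ≤ r → r ∸ 1 ≤ k →
    ∃ λ (n₀ : ℕ) → ∀ (n : ℕ) → n₀ < n →
    f n k r ≡ g n k r ×
    (∀ (H : Hypergraph n r) → size H ≡ f n k r → AllCovered k H →
    ∃ λ (G : Hypergraph n r) → 𝒢 n k r G × H ≅ G)
-- The head gets `s = k ∸ (r ∸ 1)` vertices, so that `k` is `s + (r ∸ 1)`.
theorem1 (suc (suc i)) k _ j≤k = subst (λ k → ∃ λ n₀ → ∀ n → n₀ < n → Claim n k (2 + i))
  (m∸n+n≡m j≤k) (claim (k ∸ suc i) i)
theorem1 (suc zero) k (s≤s ()) _
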